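{- Let $G=(V,E)$ be a weighted graph with measure $\mu$ satisfying the standing assumptions given in the context, let $n\in(0,\infty)$ and $K\in\mathbb{R}$. Then the condition $CD(n,-K)$ is equivalent to each one of the following statements (each statement being required to hold pointwise on $V$ for all $t\ge 0$ and all positive bounded functions $0<f\in\ell^\infty(V,\mu)$): 1. $\displaystyle \Gamma(P_{t}f) \leq e^{2Kt}P_{t}(\Gamma(f))-\frac{2}{n}\int_{0}^{t}e^{2Ks}P_{s}\big((P_{t-s} \Delta f)^{2}\big)\, ds.$ 2. $\displaystyle \Gamma(P_{t}f) \leq e^{2Kt}P_{t}(\Gamma(f))-\frac{e^{2Kt}-1}{Kn}\left(P_{t} \Delta f\right)^{2}.$ 3. $\displaystyle P_{t}(f^{2})-(P_{t}f)^{2}\leq \frac{e^{2Kt}-1}{K}P_{t}(\Gamma(f))-\frac{e^{2Kt}-1-2Kt}{K^{2}n}\left(P_{t} \Delta f\right)^{2}.$ 4. $\displaystyle P_{t}(f^{2})-(P_{t}f)^{2}\geq \frac{1-e^{ -2Kt}}{K}\Gamma(P_{t}f)+\frac{e^{ -2Kt}-1+2Kt}{K^{2}n}\left(P_{t} \Delta f\right)^{2}.$ For $K=0$ the quotients are understood as their limits as $K\to0$: $\frac{e^{2Kt}-1}{K}$ and $\frac{1-e^{ -2Kt}}{K}$ are read as $2t$, and $\frac{e^{2Kt}-1-2Kt}{K^2}$ and $\frac{e^{ -2Kt}-1+2Kt}{K^2}$ are read as $2t^2$.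
   Context: Standing assumptions. $G=(V,E)$ is a connected (finite or infinite) graph with symmetric weight $\omega:V\times V\to[0,\infty)$, $\omega_{xy}=\omega_{yx}$, where $x\sim y$ (i.e. $xy$ is an edge) iff $\omega_{xy}>0$; $\omega_{\min}=\inf_{x\sim y}\omega_{xy}>0$; $G$ is locally finite, $m(x):=\sum_{y\sim x}\omega_{xy}<\infty$ for all $x$. $\mu:V\to(0,\infty)$ is a measure with $D_\mu:=\sup_{x\in V} m(x)/\mu(x)<\infty$. $\ell^\infty(V,\mu)$ is the space of bounded real functions on $V$ with the sup norm. Laplacian: $\Delta f(x)=\frac1{\mu(x)}\sum_{y\sim x}\omega_{xy}(f(y)-f(x))$. Gradient forms: $2\Gamma(f,g)=\Delta(fg)-f\Delta g-g\Delta f$, i.e. $2\Gamma(f,g)(x)=\frac1{\mu(x)}\sum_{y\sim x}\omega_{xy}(f(y)-f(x))(g(y)-g(x))$, $\Gamma(f)=\Gamma(f,f)$; $2\Gamma_2(f,g)=\Delta\Gamma(f,g)-\Gamma(f,\Delta g)-\Gamma(\Delta f,g)$, $\Gamma_2(f)=\Gamma_2(f,f)$. $CD(n,K)$: for every function $f:V\to\mathbb{R}$, $\Gamma_2(f)\ge\frac1n(\Delta f)^2+K\Gamma(f)$ pointwise on $V$. Heat semigroup: for a finite $U\subset V$ let $\overset{\circ}{U}=\{x\in U: y\in U\text{ for all }y\sim x\}$, let $\Delta_U$ be the Dirichlet Laplacian on $\ell^2(\overset{\circ}{U},\mu)$ (extend by $0$ outside $\overset{\circ}{U}$, apply $\Delta$,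 restrict to $\overset{\circ}{U}$), and let $p_U(t,x,y)=\sum_i e^{ -\lambda_i t}\phi_i(x)\phi_i(y)$ for $x,y\in\overset{\circ}{U}$, where $(\phi_i)$ is an $\ell^2(\overset{\circ}{U},\mu)$-orthonormal basis of eigenfunctions of $-\Delta_U$ with eigenvalues $\lambda_i$; extend $p_U$ by $0$ to $V\times V$. For an exhaustion of $V$ by finite sets $U_k$ with $U_k\subset\overset{\circ}{U}_{k+1}$, $\bigcup_k U_k=V$, the heat kernel is $p_t(x,y)=\lim_{k\to\infty}p_{U_k}(t,x,y)$ (independent of the exhaustion). For $f\in\ell^\infty(V,\mu)$ and $t>0$, $P_tf(x)=\sum_{y\in V}\mu(y)p_t(x,y)f(y)$, and $P_0f=f$. -}

module Defs where

open import Level using (0ℓ) renaming (suc to lsuc)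
open import Algebra.Bundles using (CommutativeRing; Semiring)
import Algebra.Construct.NaturalChoice.Max as Max
import Algebra.Definitions.RawMonoid as RawMonoidDefs
import Algebra.Definitions.RawSemiring as RawSemiringDefs
open import Axiom.ExcludedMiddle using (ExcludedMiddle)
open import Data.Bool.Base using (if_then_else_)
open import Data.Fin.Base using (Fin; suc; toℕ; fromℕ; inject₁)
import Data.Fin.Properties as Fin
import Data.Fin.Base as Fin
open import Data.List.Base using (List; foldr; filter)
open import Data.List.Membership.Propositional using (_∈_)
open import Data.List.Relation.Binary.Subset.Propositional using (_⊆_)
open import Data.List.Relation.Unary.Unique.Propositional using (Unique)
open import Data.List.Relation.Unary.Unique.Propositional.Properties using (filter⁺)
open import Data.Nat.Base as ℕ using (ℕ; _!)
open import Data.Product.Base using (Σ; ∃; _×_; _,_; proj₁)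

open import Function.Bundles using (_⇔_)
open import Relation.Binary.Bundles using (TotalOrder)
open import Relation.Binary.Construct.Closure.ReflexiveTransitive using (Star)
import Relation.Binary.Construct.NonStrictToStrict as NonStrictToStrict
open import Relation.Binary.Core using (Rel)
open import Relation.Binary.Structures using (IsTotalOrder)
open import Relation.Nullary using (¬_; Dec; yes; no; does)

-- The real numbers, up to isomorphism.  As with the usual convention in
-- classical libraries, _⁻¹ is total and unspecified at zero.
record CompleteOrderedField : Set (lsuc 0ℓ) where
  field
    commutativeRing : CommutativeRing 0ℓ 0ℓ
  open CommutativeRing commutativeRing public

  infix  4 _≤_
  infix  9 _⁻¹
  field
    _≤_          : Rel Carrier 0ℓ
    isTotalOrder : IsTotalOrder _≈_ _≤_
    _⁻¹          : Carrier → Carrier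
    0≉1          : ¬ 0# ≈ 1#
    ⁻¹-inverseʳ  : ∀ x → ¬ x ≈ 0# → x * x ⁻¹ ≈ 1#
    +-monoˡ-≤    : ∀ z {x y} → x ≤ y → x + z ≤ y + z
    *-nonneg     : ∀ {x y} → 0# ≤ x → 0# ≤ y → 0# ≤ x * y
    supremum     : (P : Carrier → Set) → ∃ P →
                   (∃ λ b → ∀ x → P x → x ≤ b) →
                   ∃ λ s → (∀ x → P x → x ≤ s) ×
                           (∀ b → (∀ x → P x → x ≤ b) → s ≤ b)

  totalOrder : TotalOrder 0ℓ 0ℓ 0ℓ
  totalOrder = record { isTotalOrder = isTotalOrder }

  open NonStrictToStrict _≈_ _≤_ public using (_<_)
  open Max totalOrder public using (_⊔_)
  open RawMonoidDefs +-rawMonoid public using (sum) renaming (_×_ to _·_)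
  open RawSemiringDefs (Semiring.rawSemiring semiring) public using (_^_)

  infixl 7 _/_
  _/_ : Carrier → Carrier → Carrier
  x / y = x * y ⁻¹

  ∣_∣ : Carrier → Carrier
  ∣ x ∣ = x ⊔ (- x)

  2# : Carrier
  2# = 1# + 1#

  ∑ : {A : Set} → List A → (A → Carrier) → Carrier
  ∑ xs g = foldr (λ y s → g y + s) 0# xs

record FiniteSubset (A : Set) : Set where
  field
    elements : List A
    unique   : Unique elements

open FiniteSubset public

infix 4 _∈ᶠ_
_∈ᶠ_ : {A : Set} → A → FiniteSubset A → Set
x ∈ᶠ S = x ∈ elements S

-- Limits, infinite sums and integrals are given as in classical libraries:
-- the value characterised by the usual ε-definition if there is one, and 0
-- otherwise.  Excluded middle makes these total operations.
module Analysis (em : ExcludedMiddle 0ℓ) (ℝ : CompleteOrderedField) where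
  open CompleteOrderedField ℝ

  the : (Carrier → Set) → Carrier
  the P with em {∃ P}
  ... | yes (l , _) = l
  ... | no  _ = 0#

  ConvergesTo : (ℕ → Carrier) → Carrier → Set
  ConvergesTo s l =
    ∀ ε → 0# < ε → ∃ λ N → ∀ k → N ℕ.≤ k → ∣ s k - l ∣ < ε

  lim : (ℕ → Carrier) → Carrier
  lim s = the (ConvergesTo s)

  -- Unconditional summation over an arbitrary index set: the limit over the
  -- net of finite subsets.
  HasSum : {A : Set} → (A → Carrier) → Carrier → Set
  HasSum {A} g l =
    ∀ ε → 0# < ε → ∃ λ (S : FiniteSubset A) → ∀ (T : FiniteSubset A) →
    elements S ⊆ elements T → ∣ ∑ (elements T) g - l ∣ < ε

  ∑∞ : {A : Set} → (A → Carrier) → Carrier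
  ∑∞ g = the (HasSum g)

  exp : Carrier → Carrier
  exp x = lim λ n → sum {n} λ k → x ^ toℕ k / ((toℕ k !) · 1#)

  record TaggedPartition (a b : Carrier) : Set where
    field
      pieces   : ℕ
      point    : Fin (ℕ.suc pieces) → Carrier
      tag      : Fin pieces → Carrier
      point-0  : point Fin.zero ≈ a
      point-n  : point (fromℕ pieces) ≈ b
      left≤tag  : ∀ i → point (inject₁ i) ≤ tag i
      tag≤right : ∀ i → tag i ≤ point (suc i)

    length : Fin pieces → Carrier
    length i = point (suc i) - point (inject₁ i)

    riemannSum : (Carrier → Carrier) → Carrier
    riemannSum g = sum λ i → g (tag i) * length i

  HasIntegral : Carrier → Carrier → (Carrier → Carrier) → Carrier → Set
  HasIntegral a b g l =
    ∀ ε → 0# < ε → ∃ λ δ → 0# < δ × (∀ (π : TaggedPartition a b) →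
    let open TaggedPartition π in
    (∀ i → length i < δ) → ∣ riemannSum g - l ∣ < ε)

  ∫ : Carrier → Carrier → (Carrier → Carrier) → Carrier
  ∫ a b g = the (HasIntegral a b g)

record WeightedGraph (ℝ : CompleteOrderedField) : Set (lsuc 0ℓ) where
  open CompleteOrderedField ℝ

  field
    V     : Set
    ω     : V → V → Carrier
    ω-sym : ∀ x y → ω x y ≈ ω y x
    ω-nonneg : ∀ x y → 0# ≤ ω x y

  infix 4 _~_
  _~_ : V → V → Set
  x ~ y = 0# < ω x y

  field
    connected     : ∀ x y → Star _~_ x y
    ω-min         : ∃ λ c → 0# < c × (∀ x y → x ~ y → c ≤ ω x y)
    locallyFinite : ∀ x → Σ (FiniteSubset V) λ N → ∀ y → y ∈ᶠ N ⇔ x ~ y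

  neighbours : V → List V
  neighbours x = elements (proj₁ (locallyFinite x))

  m : V → Carrier
  m x = ∑ (neighbours x) (ω x)

  field
    μ          : V → Carrier
    μ-positive : ∀ x → 0# < μ x
    Dμ-finite  : ∃ λ D → ∀ x → m x / μ x ≤ D

module GradientForms (ℝ : CompleteOrderedField) (G : WeightedGraph ℝ) where
  open CompleteOrderedField ℝ
  open WeightedGraph G

  Function : Set
  Function = V → Carrier

  infixl 7 _⊙_
  _⊙_ : Function → Function → Function
  (f ⊙ g) x = f x * g x

  Bounded : Function → Set
  Bounded f = ∃ λ b → ∀ x → ∣ f x ∣ ≤ b

  Δ : Function → Function
  Δ f x = μ x ⁻¹ * ∑ (neighbours x) λ y → ω x y * (f y - f x)

  Γ₁ : Function → Function → Function
  Γ₁ f g x = 2# ⁻¹ * (Δ (f ⊙ g) x - f x * Δ g x - g x * Δ f x)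

  Γ : Function → Function
  Γ f = Γ₁ f f

  Γ₂ : Function → Function
  Γ₂ f x = 2# ⁻¹ * (Δ (Γ₁ f f) x - Γ₁ f (Δ f) x - Γ₁ (Δ f) f x)

  CD : Carrier → Carrier → Set
  CD n K = ∀ (f : Function) x → n ⁻¹ * Δ f x ^ 2 + K * Γ f x ≤ Γ₂ f x

module HeatKernel (em : ExcludedMiddle 0ℓ) (ℝ : CompleteOrderedField)
                  (G : WeightedGraph ℝ) where
  open CompleteOrderedField ℝ
  open Analysis em ℝ
  open WeightedGraph G
  open GradientForms ℝ G

  interior : FiniteSubset V → FiniteSubset V
  interior U = record
    { elements = filter inside? (elements U)
    ; unique   = filter⁺ inside? (unique U)
    }
    where
    inside? : ∀ x → Dec (∀ y → x ~ y → y ∈ᶠ U)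
    inside? x = em

  extendByZero : FiniteSubset V → Function → Function
  extendByZero S f x = if does (em {x ∈ᶠ S}) then f x else 0#

  -- An element of ℓ²(Ů, μ) is represented by any function on V with the given
  -- values on Ů; its values elsewhere are never used.
  Δᴰ : FiniteSubset V → Function → Function
  Δᴰ U f = Δ (extendByZero (interior U) f)

  inner : FiniteSubset V → Function → Function → Carrier
  inner U f g = ∑ (elements (interior U)) λ x → μ x * f x * g x

  record Eigenbasis (U : FiniteSubset V) : Set where
    field
      dimension   : ℕ
      φ           : Fin dimension → Function
      eigenvalue  : Fin dimension → Carrier
      isEigen     : ∀ i x → x ∈ᶠ interior U →
                    - Δᴰ U (φ i) x ≈ eigenvalue i * φ i x
      orthonormal : ∀ i j →
                    inner U (φ i) (φ j) ≈ (if does (i Fin.≟ j) then 1# else 0#)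
      spanning    : ∀ (f : Function) → ∃ λ (c : Fin dimension → Carrier) →
                    ∀ x → x ∈ᶠ interior U → f x ≈ sum λ i → c i * φ i x

  dirichletKernel : (U : FiniteSubset V) → Eigenbasis U →
                    Carrier → V → V → Carrier
  dirichletKernel U B t x y =
    sum λ i → exp (- (eigenvalue i * t)) * φ₀ i x * φ₀ i y
    where
    open Eigenbasis B
    φ₀ : Fin dimension → Function
    φ₀ i = extendByZero (interior U) (φ i)

  record Exhaustion : Set where
    field
      U      : ℕ → FiniteSubset V
      nested : ∀ k x → x ∈ᶠ U k → x ∈ᶠ interior (U (ℕ.suc k))
      covers : ∀ x → ∃ λ k → x ∈ᶠ U k

module HeatSemigroup (em : ExcludedMiddle 0ℓ) (ℝ : CompleteOrderedField)
                     (G : WeightedGraph ℝ)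
                     (E : HeatKernel.Exhaustion em ℝ G)
                     (B : ∀ k → HeatKernel.Eigenbasis em ℝ G
                                  (HeatKernel.Exhaustion.U E k)) where
  open CompleteOrderedField ℝ
  open Analysis em ℝ
  open WeightedGraph G
  open GradientForms ℝ G
  open HeatKernel em ℝ G
  open Exhaustion E

  heatKernel : Carrier → V → V → Carrier
  heatKernel t x y = lim λ k → dirichletKernel (U k) (B k) t x y

  P : Carrier → Function → Function
  P t f x = if does (em {t ≈ 0#})
            then f x
            else ∑∞ λ y → μ y * heatKernel t x y * f y

-- The four coefficients, with their limits as K → 0 taken as values at K = 0.
module Coefficients (em : ExcludedMiddle 0ℓ) (ℝ : CompleteOrderedField) where
  open CompleteOrderedField ℝ
  open Analysis em ℝ

  -- (e^{2Kt} - 1) / K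
  α⁺ : Carrier → Carrier → Carrier
  α⁺ K t = if does (em {K ≈ 0#}) then 2# * t
           else (exp (2# * K * t) - 1#) / K

  -- (1 - e^{-2Kt}) / K
  α⁻ : Carrier → Carrier → Carrier
  α⁻ K t = if does (em {K ≈ 0#}) then 2# * t
           else (1# - exp (- (2# * K * t))) / K

  -- (e^{2Kt} - 1 - 2Kt) / K²
  β⁺ : Carrier → Carrier → Carrier
  β⁺ K t = if does (em {K ≈ 0#}) then 2# * t ^ 2
           else (exp (2# * K * t) - 1# - 2# * K * t) / K ^ 2

  -- (e^{-2Kt} - 1 + 2Kt) / K²
  β⁻ : Carrier → Carrier → Carrier
  β⁻ K t = if does (em {K ≈ 0#}) then 2# * t ^ 2
           else (exp (- (2# * K * t)) - 1# + 2# * K * t) / K ^ 2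

{-# OPTIONS --safe #-}
-- Since Δ is bounded on ℓ^∞, Q t = Σ tᵏ Δᵏ / k! converges, and every quantity in the theorem is an
-- entire function of t with explicit Taylor coefficients.  The spectral sum for p_U is the
-- exponential of the Dirichlet Laplacian, and Δᵏ f (x) involves only the k-ball around x, so along
-- an exhaustion the Dirichlet semigroups agree with Q up to ever higher order and P_t = Q t on
-- bounded functions.
--
-- Assume CD(n,-K) and let g = Q (t - s) f.  Then Φ(s) = Q s (Γ g) satisfies
--   Φ' = 2 Q s (Γ₂ g) ≥ -2K Φ + (2/n) Q s ((Δ g)²).
-- Integrating e^{2Ks} Φ gives (1), and Jensen's inequality Q s ((Δ g)²) ≥ (Q t (Δ f))² gives (2).
-- As 2Φ is the derivative of Q s (g²), weighting the same inequality by primitives of e^{±2Ks}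
-- gives (3) and (4).
--
-- Conversely, both sides of (2) agree at t = 0, and those of (3) and (4) agree to first order.  The
-- sign of the first nonzero Taylor coefficient of the difference is the curvature inequality for
-- f at x.  A general f becomes positive and bounded, without changing Γ₂ f (x), by adding a constant
-- on the 2-ball around x and replacing f by 1 outside.
module Submission where

open import Defs
open import Level using (0ℓ)
import Algebra.Construct.NaturalChoice.Max as Max
import Algebra.Properties.AbelianGroup as AbelianGroupProperties
import Algebra.Properties.CommutativeSemiring.Exp as ExpProperties
import Algebra.Properties.Monoid.Mult.TCOptimised as MultTC
import Algebra.Properties.Ring as RingProperties
import Algebra.Properties.Semiring.Mult as MultProperties
import Algebra.Properties.Semiring.Sum as SumProperties
import Algebra.Solver.Ring as RingSolver
open import Algebra.Solver.Ring.AlmostCommutativeRing using (AlmostCommutativeRing; fromCommutativeRing; _-Raw-AlmostCommutative⟶_)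
open import Axiom.ExcludedMiddle using (ExcludedMiddle)
open import Data.Bool.Base using (if_then_else_)
open import Data.Empty using (⊥-elim)
open import Data.Fin.Base as Fin using (Fin; toℕ; fromℕ; inject₁)
import Data.Fin.Properties as Fin
import Data.Integer.Base as ℤ
import Data.Integer.Properties as ℤ
open import Data.List.Base using (List; []; _∷_; _++_; concatMap; deduplicate)
open import Data.List.Membership.Propositional using (_∈_)
open import Data.List.Membership.Propositional.Properties using (∈-++⁺ˡ; ∈-++⁺ʳ; ∈-concatMap⁺; ∈-filter⁻; ∈-deduplicate⁺)
open import Data.List.Relation.Binary.Subset.Propositional using (_⊆_)
open import Data.List.Relation.Unary.All as All using (All)
import Data.List.Relation.Unary.All.Properties as All
open import Data.List.Relation.Unary.AllPairs using ([]; _∷_)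
open import Data.List.Relation.Unary.Any as Any using (here; there)
open import Data.List.Relation.Unary.Unique.DecPropositional.Properties using (deduplicate-!)
open import Data.List.Relation.Unary.Unique.Propositional using (Unique)
open import Data.Maybe.Base using (Maybe; just; nothing)
open import Data.Nat.Base as ℕ using (ℕ; zero; suc; z≤n; s≤s; _!)
import Data.Nat.Properties as ℕ
open import Data.Product.Base using (∃; _×_; _,_; proj₁; proj₂)
open import Data.Sign.Base as Sign using (Sign)
open import Data.Sum.Base using (inj₁; inj₂)
open import Relation.Binary.Structures using (IsTotalOrder)
open import Function.Base using (_∘_)
open import Function.Bundles using (_⇔_; mk⇔)
import Relation.Binary.Construct.NonStrictToStrict as Strict
open import Relation.Binary.Bundles using (Poset)
open import Relation.Binary.PropositionalEquality as ≡ using (_≡_)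
import Relation.Binary.Reasoning.PartialOrder as PartialOrderReasoning
open import Relation.Nullary using (¬_; Dec; yes; no; does)

-- Taylor coefficients are stored without their factorials. Differentiation in time is then a shift
-- of indices, and the Leibniz rule, for products as well as for s ↦ Q s (F s), is the Pascal
-- recursion by which `diag` is defined. Derivative formulas thus reduce to algebra, and the
-- analysis is concentrated in two facts: a double exponential series may be summed along its
-- diagonals, and an entire function whose derivative is nonnegative on [0, t] does not end below
-- its starting value.
--
-- All coefficient sequences of a curve obey one bound C Mᵏ, uniformly over V. Since Mᵏ / k! is at
-- most a constant times 2⁻ᵏ, every truncation error is a uniform multiple of 2⁻ⁿ. This takes the
-- place of dominated convergence in P_t = Q t: changing a function or the Laplacian far away from x
-- leaves the first N coefficients at x untouched and moves the value by O(2⁻ᴺ), with a constant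
-- that does not depend on the change.

module OrderedField (em : ExcludedMiddle 0ℓ) (ℝ : CompleteOrderedField) where
  open CompleteOrderedField ℝ

  -- A ring solver with integer coefficients.

  private
    almostCommutativeRing : AlmostCommutativeRing 0ℓ 0ℓ
    almostCommutativeRing = fromCommutativeRing commutativeRing

  module R = RingProperties ring
  module Exp = ExpProperties commutativeSemiring
  module Mult = MultProperties semiring
  module Sum = SumProperties semiring
  module ⊔ = Max totalOrder

  private
    module TC = MultTC +-monoid
    open TC using () renaming (_×_ to _×′_)

    -- This form of multiplication by naturals computes 1 ×′ x to x, so that the solver constant 1
    -- is interpreted as `1#` itself and not as a sum with zero.
    natHom : ℕ → Carrier
    natHom n = n ×′ 1#

    fromSign : Sign → Carrier → Carrier
    fromSign Sign.+ x = x
    fromSign Sign.- x = - x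

    intHom : ℤ.ℤ → Carrier
    intHom (ℤ.+ n)      = natHom n
    intHom ℤ.-[1+ n ] = - natHom (suc n)

    natHom-suc : ∀ n → natHom (suc n) ≈ 1# + natHom n
    natHom-suc n = TC.1+× n 1#

    natHom-+ : ∀ m n → natHom (m ℕ.+ n) ≈ natHom m + natHom n
    natHom-+ m n = TC.×-homo-+ 1# m n

    natHom-* : ∀ m n → natHom (m ℕ.* n) ≈ natHom m * natHom n
    natHom-* m n = trans (sym (TC.×ᵤ≈× (m ℕ.* n) 1#))
      (trans (Mult.×1-homo-* m n) (*-cong (TC.×ᵤ≈× m 1#) (TC.×ᵤ≈× n 1#)))

    cancel-1 : ∀ x y → (1# + x) - (1# + y) ≈ x - y
    cancel-1 x y = trans (+-congˡ (sym (R.-‿+-comm 1# y)))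
      (trans (+-congʳ (+-comm 1# x))
      (trans (+-assoc x 1# _)
      (+-congˡ (trans (sym (+-assoc 1# (- 1#) (- y)))
        (trans (+-congʳ (-‿inverseʳ 1#)) (+-identityˡ _))))))

    intHom-⊖ : ∀ m n → intHom (m ℤ.⊖ n) ≈ natHom m - natHom n
    intHom-⊖ zero    zero    = sym (-‿inverseʳ 0#)
    intHom-⊖ (suc m) zero    = sym (trans (+-congˡ R.-0#≈0#) (+-identityʳ _))
    intHom-⊖ zero    (suc n) = sym (+-identityˡ _)
    intHom-⊖ (suc m) (suc n) rewrite ℤ.[1+m]⊖[1+n]≡m⊖n m n =
      trans (intHom-⊖ m n) (sym (trans (+-cong (natHom-suc m) (-‿cong (natHom-suc n))) (cancel-1 _ _)))

    intHom-+ : ∀ i j → intHom (i ℤ.+ j) ≈ intHom i + intHom j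
    intHom-+ (ℤ.+ m)      (ℤ.+ n)      = natHom-+ m n
    intHom-+ (ℤ.+ m)      ℤ.-[1+ n ] = intHom-⊖ m (suc n)
    intHom-+ ℤ.-[1+ m ] (ℤ.+ n)      = trans (intHom-⊖ n (suc m)) (+-comm _ _)
    intHom-+ ℤ.-[1+ m ] ℤ.-[1+ n ] = trans
      (-‿cong (trans (reflexive (≡.cong natHom (≡.cong suc (≡.sym (ℕ.+-suc m n))))) (natHom-+ (suc m) (suc n))))
      (sym (R.-‿+-comm _ _))

    intHom-◃ : ∀ s n → intHom (s ℤ.◃ n) ≈ fromSign s (natHom n)
    intHom-◃ Sign.+ zero    = refl
    intHom-◃ Sign.- zero    = sym R.-0#≈0#
    intHom-◃ Sign.+ (suc n) = refl
    intHom-◃ Sign.- (suc n) = refl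

    fromSign-* : ∀ s t x y → fromSign (s Sign.* t) (x * y) ≈ fromSign s x * fromSign t y
    fromSign-* Sign.+ Sign.+ x y = refl
    fromSign-* Sign.+ Sign.- x y = R.-‿distribʳ-* x y
    fromSign-* Sign.- Sign.+ x y = R.-‿distribˡ-* x y
    fromSign-* Sign.- Sign.- x y = trans (sym (R.-‿involutive (x * y)))
      (trans (-‿cong (R.-‿distribˡ-* x y)) (R.-‿distribʳ-* (- x) y))

    fromSign-cong : ∀ s {x y} → x ≈ y → fromSign s x ≈ fromSign s y
    fromSign-cong Sign.+ e = e
    fromSign-cong Sign.- e = -‿cong e

    intHom-sign : ∀ i → intHom i ≈ fromSign (ℤ.sign i) (natHom ℤ.∣ i ∣)
    intHom-sign (ℤ.+ n)      = refl
    intHom-sign ℤ.-[1+ n ] = refl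

    intHom-* : ∀ i j → intHom (i ℤ.* j) ≈ intHom i * intHom j
    intHom-* i j = trans (intHom-◃ (ℤ.sign i Sign.* ℤ.sign j) (ℤ.∣ i ∣ ℕ.* ℤ.∣ j ∣))
      (trans (fromSign-cong (ℤ.sign i Sign.* ℤ.sign j) (natHom-* ℤ.∣ i ∣ ℤ.∣ j ∣))
      (trans (fromSign-* (ℤ.sign i) (ℤ.sign j) _ _)
      (*-cong (sym (intHom-sign i)) (sym (intHom-sign j)))))

    intHom-neg : ∀ i → intHom (ℤ.- i) ≈ - intHom i
    intHom-neg (ℤ.+ zero)    = sym R.-0#≈0#
    intHom-neg (ℤ.+ (suc n)) = refl
    intHom-neg ℤ.-[1+ n ]  = sym (R.-‿involutive _)

    intMorphism : ℤ.+-*-rawRing -Raw-AlmostCommutative⟶ almostCommutativeRing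
    intMorphism = record
      { ⟦_⟧    = intHom
      ; +-homo = intHom-+
      ; *-homo = intHom-*
      ; -‿homo = intHom-neg
      ; 0-homo = refl
      ; 1-homo = refl
      }

    coefficient≟ : ∀ i j → Maybe (intHom i ≈ intHom j)
    coefficient≟ i j with i ℤ.≟ j
    ... | yes ≡.refl = just refl
    ... | no _       = nothing

  open RingSolver ℤ.+-*-rawRing almostCommutativeRing intMorphism coefficient≟ public
    using (Polynomial; solve; _:=_; _:+_; _:*_; _:-_; :-_; _:^_; con)

  -- Order, inverses, absolute values and powers.

  poset : Poset 0ℓ 0ℓ 0ℓ
  poset = record { isPartialOrder = IsTotalOrder.isPartialOrder isTotalOrder }

  open Poset poset public using ()
    renaming (refl to ≤-refl; trans to ≤-trans; antisym to ≤-antisym; reflexive to ≤-reflexive;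
              ≤-respˡ-≈ to ≤-respˡ; ≤-respʳ-≈ to ≤-respʳ)
  open IsTotalOrder isTotalOrder public using () renaming (total to ≤-total)

  module ≤-Reasoning = PartialOrderReasoning poset

  <⇒≤ : ∀ {x y} → x < y → x ≤ y
  <⇒≤ = proj₁

  pos⇒≉0 : ∀ {x} → 0# < x → ¬ x ≈ 0#
  pos⇒≉0 p e = proj₂ p (sym e)

  <⇒≱ : ∀ {x y} → x < y → ¬ y ≤ x
  <⇒≱ = Strict.<⇒≱ _≈_ _≤_ ≤-antisym

  ≰⇒> : ∀ {x y} → ¬ x ≤ y → y < x
  ≰⇒> = Strict.≰⇒> _≈_ _≤_ sym ≤-reflexive ≤-total

  <-≤-trans : ∀ {x y z} → x < y → y ≤ z → x < z
  <-≤-trans = Strict.<-≤-trans _≈_ _≤_ sym ≤-trans ≤-antisym ≤-respʳ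

  ≤-<-trans : ∀ {x y z} → x ≤ y → y < z → x < z
  ≤-<-trans = Strict.≤-<-trans _≈_ _≤_ ≤-trans ≤-antisym ≤-respˡ

  ≮⇒≥ : ∀ {x y} → ¬ x < y → y ≤ x
  ≮⇒≥ = Strict.≮⇒≥ _≈_ _≤_ sym (λ x y → em) ≤-reflexive ≤-total

  +-mono-≤ : ∀ {x y u v} → x ≤ y → u ≤ v → x + u ≤ y + v
  +-mono-≤ {x} {y} {u} {v} p q = ≤-trans (+-monoˡ-≤ u p)
    (≤-respˡ (+-comm u y) (≤-respʳ (+-comm v y) (+-monoˡ-≤ y q)))

  0≤y-x : ∀ {x y} → x ≤ y → 0# ≤ y - x
  0≤y-x {x} p = ≤-respˡ (-‿inverseʳ x) (+-monoˡ-≤ (- x) p)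

  ≤-from : ∀ {x y d} → 0# ≤ d → d ≈ y - x → x ≤ y
  ≤-from {x} {y} {d} p e = ≤-respˡ (+-identityˡ x)
    (≤-respʳ (trans (+-congʳ e) (solve 2 (λ a b → b :- a :+ a := b) refl x y)) (+-monoˡ-≤ x p))

  +-nonneg : ∀ {x y} → 0# ≤ x → 0# ≤ y → 0# ≤ x + y
  +-nonneg p q = ≤-respˡ (+-identityˡ 0#) (+-mono-≤ p q)

  neg-antimono : ∀ {x y} → x ≤ y → - y ≤ - x
  neg-antimono {x} {y} p = ≤-from (0≤y-x p) (solve 2 (λ a b → b :- a := :- a :- :- b) refl x y)

  *-monoˡ-≤ : ∀ {z x y} → 0# ≤ z → x ≤ y → z * x ≤ z * y
  *-monoˡ-≤ {z} {x} {y} p q = ≤-from (*-nonneg p (0≤y-x q))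
    (solve 3 (λ z x y → z :* (y :- x) := z :* y :- z :* x) refl z x y)

  *-monoʳ-≤ : ∀ {z x y} → 0# ≤ z → x ≤ y → x * z ≤ y * z
  *-monoʳ-≤ {z} {x} {y} p q = ≤-respˡ (*-comm z x) (≤-respʳ (*-comm z y) (*-monoˡ-≤ p q))

  *-mono-≤ : ∀ {x y u v} → 0# ≤ x → x ≤ y → 0# ≤ u → u ≤ v → x * u ≤ y * v
  *-mono-≤ p q r s = ≤-trans (*-monoˡ-≤ p s) (*-monoʳ-≤ (≤-trans r s) q)

  square-nonneg : ∀ x → 0# ≤ x ^ 2
  square-nonneg x with ≤-total 0# x
  ... | inj₁ p = ≤-respʳ (solve 1 (λ x → x :* x := x :^ 2) refl x) (*-nonneg p p)
  ... | inj₂ p = ≤-respʳ (solve 1 (λ x → (con ℤ.0ℤ :- x) :* (con ℤ.0ℤ :- x) := x :^ 2) refl x)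
                   (*-nonneg (0≤y-x p) (0≤y-x p))

  0≤1 : 0# ≤ 1#
  0≤1 = ≤-respʳ (solve 0 (con ℤ.1ℤ :^ 2 := con ℤ.1ℤ) refl) (square-nonneg 1#)

  0≤2 : 0# ≤ 2#
  0≤2 = +-nonneg 0≤1 0≤1

  0<1 : 0# < 1#
  0<1 = 0≤1 , 0≉1

  ≤+nonneg : ∀ {x y} → 0# ≤ y → x ≤ x + y
  ≤+nonneg {x} {y} p = ≤-from p (solve 2 (λ x y → y := x :+ y :- x) refl x y)

  0<2 : 0# < 2#
  0<2 = <-≤-trans 0<1 (≤+nonneg 0≤1)

  pos+nonneg : ∀ {x y} → 0# < x → 0# ≤ y → 0# < x + y
  pos+nonneg p q = <-≤-trans p (≤+nonneg q)

  inverse-unique : ∀ {x y} → ¬ x ≈ 0# → x * y ≈ 1# → y ≈ x ⁻¹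
  inverse-unique {x} {y} x≉0 e = begin-equality
    y                ≈⟨ solve 1 (λ y → y := y :* con ℤ.1ℤ) refl y ⟩
    y * 1#           ≈⟨ *-congˡ (⁻¹-inverseʳ x x≉0) ⟨
    y * (x * x ⁻¹)   ≈⟨ solve 3 (λ x y z → y :* (x :* z) := (x :* y) :* z) refl x y (x ⁻¹) ⟩
    (x * y) * x ⁻¹   ≈⟨ *-congʳ e ⟩
    1# * x ⁻¹        ≈⟨ *-identityˡ _ ⟩
    x ⁻¹             ∎
    where open ≤-Reasoning

  ⁻¹-inverseˡ : ∀ x → ¬ x ≈ 0# → x ⁻¹ * x ≈ 1#
  ⁻¹-inverseˡ x p = trans (*-comm _ _) (⁻¹-inverseʳ x p)

  -- If y ≤ 0 as well, then x y ≤ 0, so x y = 0, and multiplying by the inverse of x leaves y = 0.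
  *-cancel-pos : ∀ {x y} → 0# < x → 0# ≤ x * y → 0# ≤ y
  *-cancel-pos {x} {y} p q with ≤-total 0# y
  ... | inj₁ r = r
  ... | inj₂ r = ≤-reflexive (sym y≈0)
    where
    xy≈0 : x * y ≈ 0#
    xy≈0 = ≤-antisym (≤-from (*-nonneg (<⇒≤ p) (0≤y-x r))
      (solve 2 (λ x y → x :* (con ℤ.0ℤ :- y) := con ℤ.0ℤ :- x :* y) refl x y)) q
    y≈0 : y ≈ 0#
    y≈0 = begin-equality
      y               ≈⟨ *-identityˡ y ⟨
      1# * y          ≈⟨ *-congʳ (⁻¹-inverseˡ x (pos⇒≉0 p)) ⟨
      x ⁻¹ * x * y    ≈⟨ *-assoc _ _ _ ⟩
      x ⁻¹ * (x * y)  ≈⟨ *-congˡ xy≈0 ⟩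
      x ⁻¹ * 0#       ≈⟨ zeroʳ _ ⟩
      0#              ∎
      where open ≤-Reasoning

  ⁻¹-nonneg : ∀ {x} → 0# < x → 0# ≤ x ⁻¹
  ⁻¹-nonneg {x} p = *-cancel-pos p (≤-respʳ (sym (⁻¹-inverseʳ x (pos⇒≉0 p))) 0≤1)

  ⁻¹-pos : ∀ {x} → 0# < x → 0# < x ⁻¹
  ⁻¹-pos {x} p = ⁻¹-nonneg p , λ e → 0≉1 (begin-equality
    0#        ≈⟨ zeroʳ x ⟨
    x * 0#    ≈⟨ *-congˡ e ⟩
    x * x ⁻¹  ≈⟨ ⁻¹-inverseʳ x (pos⇒≉0 p) ⟩
    1#        ∎)
    where open ≤-Reasoning

  *-pos : ∀ {x y} → 0# < x → 0# < y → 0# < x * y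
  *-pos {x} {y} p q = *-nonneg (<⇒≤ p) (<⇒≤ q) , λ e → proj₂ q (begin-equality
    0#              ≈⟨ zeroʳ _ ⟨
    x ⁻¹ * 0#       ≈⟨ *-congˡ e ⟩
    x ⁻¹ * (x * y)  ≈⟨ *-assoc _ _ _ ⟨
    x ⁻¹ * x * y    ≈⟨ *-congʳ (⁻¹-inverseˡ x (pos⇒≉0 p)) ⟩
    1# * y          ≈⟨ *-identityˡ y ⟩
    y               ∎)
    where open ≤-Reasoning

  half : Carrier
  half = 2# ⁻¹

  half+half : half + half ≈ 1#
  half+half = trans (solve 1 (λ h → h :+ h := (con ℤ.1ℤ :+ con ℤ.1ℤ) :* h) refl half)
                (⁻¹-inverseʳ 2# (pos⇒≉0 0<2))

  half-* : ∀ x → half * x + half * x ≈ x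
  half-* x = trans (sym (distribʳ x half half)) (trans (*-congʳ half+half) (*-identityˡ x))

  0<half : 0# < half
  0<half = ⁻¹-pos 0<2

  0≤half : 0# ≤ half
  0≤half = <⇒≤ 0<half

  double-nonneg : ∀ {x} → 0# ≤ x + x → 0# ≤ x
  double-nonneg {x} p = ≤-respʳ (trans (distribˡ half x x) (half-* x)) (*-nonneg 0≤half p)

  x≤∣x∣ : ∀ x → x ≤ ∣ x ∣
  x≤∣x∣ x = ⊔.x≤x⊔y x (- x)

  -x≤∣x∣ : ∀ x → - x ≤ ∣ x ∣
  -x≤∣x∣ x = ⊔.x≤y⊔x x (- x)

  ∣∣-lub : ∀ {x b} → x ≤ b → - x ≤ b → ∣ x ∣ ≤ b
  ∣∣-lub = ⊔.⊔-lub

  ∣∣-cong : ∀ {x y} → x ≈ y → ∣ x ∣ ≈ ∣ y ∣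
  ∣∣-cong e = ⊔.⊔-cong e (-‿cong e)

  0≤∣x∣ : ∀ x → 0# ≤ ∣ x ∣
  0≤∣x∣ x = double-nonneg (≤-respˡ (-‿inverseʳ x) (+-mono-≤ (x≤∣x∣ x) (-x≤∣x∣ x)))

  0≤-bound : ∀ {x b} → ∣ x ∣ ≤ b → 0# ≤ b
  0≤-bound {x} p = ≤-trans (0≤∣x∣ x) p

  ∣0∣ : ∣ 0# ∣ ≤ 0#
  ∣0∣ = ∣∣-lub ≤-refl (≤-reflexive R.-0#≈0#)

  ∣0∣≤ : ∀ {b} → 0# ≤ b → ∣ 0# ∣ ≤ b
  ∣0∣≤ = ≤-trans ∣0∣

  ∣nonneg∣ : ∀ {x b} → 0# ≤ x → x ≤ b → ∣ x ∣ ≤ b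
  ∣nonneg∣ {x} p q = ∣∣-lub q (≤-trans (≤-respʳ R.-0#≈0# (neg-antimono p)) (≤-trans p q))

  ∣∣≤-cong : ∀ {x y b} → x ≈ y → ∣ x ∣ ≤ b → ∣ y ∣ ≤ b
  ∣∣≤-cong e = ≤-respˡ (∣∣-cong e)

  ∣neg∣≤ : ∀ {x b} → ∣ x ∣ ≤ b → ∣ - x ∣ ≤ b
  ∣neg∣≤ {x} p = ∣∣-lub (≤-trans (-x≤∣x∣ x) p) (≤-trans (≤-reflexive (R.-‿involutive x)) (≤-trans (x≤∣x∣ x) p))

  ∣+∣≤ : ∀ {x y a b} → ∣ x ∣ ≤ a → ∣ y ∣ ≤ b → ∣ x + y ∣ ≤ a + b
  ∣+∣≤ {x} {y} p q = ∣∣-lub (+-mono-≤ (≤-trans (x≤∣x∣ x) p) (≤-trans (x≤∣x∣ y) q))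
    (≤-respˡ (R.-‿+-comm x y) (+-mono-≤ (≤-trans (-x≤∣x∣ x) p) (≤-trans (-x≤∣x∣ y) q)))

  ∣-∣≤ : ∀ {x y a b} → ∣ x ∣ ≤ a → ∣ y ∣ ≤ b → ∣ x - y ∣ ≤ a + b
  ∣-∣≤ p q = ∣+∣≤ p (∣neg∣≤ q)

  ∣∣-triangle : ∀ {x y z a b} → ∣ x - y ∣ ≤ a → ∣ y - z ∣ ≤ b → ∣ x - z ∣ ≤ a + b
  ∣∣-triangle {x} {y} {z} p q = ∣∣≤-cong (solve 3 (λ x y z → x :- y :+ (y :- z) := x :- z) refl x y z) (∣+∣≤ p q)

  ∣-∣-sym : ∀ {x y a} → ∣ x - y ∣ ≤ a → ∣ y - x ∣ ≤ a
  ∣-∣-sym {x} {y} p = ∣∣≤-cong (solve 2 (λ x y → :- (x :- y) := y :- x) refl x y) (∣neg∣≤ p)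

  ∣-∣-upper : ∀ {x y a} → ∣ x - y ∣ ≤ a → x ≤ y + a
  ∣-∣-upper {x} {y} {a} p = ≤-from (0≤y-x (≤-trans (x≤∣x∣ (x - y)) p))
    (solve 3 (λ x y a → a :- (x :- y) := y :+ a :- x) refl x y a)

  ∣-∣-lub : ∀ {x y a} → x ≤ y + a → y ≤ x + a → ∣ x - y ∣ ≤ a
  ∣-∣-lub {x} {y} {a} p q = ∣∣-lub
    (≤-from (0≤y-x p) (solve 3 (λ x y a → y :+ a :- x := a :- (x :- y)) refl x y a))
    (≤-from (0≤y-x q) (solve 3 (λ x y a → x :+ a :- y := a :- :- (x :- y)) refl x y a))

  -- The two halves of |xy| ≤ ab come from (a ∓ x)(b ± y) ≥ 0.
  ∣*∣≤ : ∀ {x y a b} → ∣ x ∣ ≤ a → ∣ y ∣ ≤ b → ∣ x * y ∣ ≤ a * b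
  ∣*∣≤ {x} {y} {a} {b} p q = ∣∣-lub
    (≤-from (double-nonneg (≤-respʳ e₁ (+-nonneg (*-nonneg a-x b+y) (*-nonneg a+x b-y)))) refl)
    (≤-from (double-nonneg (≤-respʳ e₂ (+-nonneg (*-nonneg a-x b-y) (*-nonneg a+x b+y)))) refl)
    where
    a-x = 0≤y-x (≤-trans (x≤∣x∣ x) p)
    a+x = 0≤y-x (≤-trans (-x≤∣x∣ x) p)
    b-y = 0≤y-x (≤-trans (x≤∣x∣ y) q)
    b+y = 0≤y-x (≤-trans (-x≤∣x∣ y) q)
    e₁ = solve 4 (λ x y a b → (a :- x) :* (b :- :- y) :+ (a :- :- x) :* (b :- y)
                   := (a :* b :- x :* y) :+ (a :* b :- x :* y)) refl x y a b
    e₂ = solve 4 (λ x y a b → (a :- x) :* (b :- y) :+ (a :- :- x) :* (b :- :- y)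
                   := (a :* b :- :- (x :* y)) :+ (a :* b :- :- (x :* y))) refl x y a b

  ∣*∣ˡ≤ : ∀ {c x a} → 0# ≤ c → ∣ x ∣ ≤ a → ∣ c * x ∣ ≤ c * a
  ∣*∣ˡ≤ p q = ∣*∣≤ (∣nonneg∣ p ≤-refl) q

  ∣^∣≤ : ∀ {x a} k → ∣ x ∣ ≤ a → ∣ x ^ k ∣ ≤ a ^ k
  ∣^∣≤ zero    p = ∣nonneg∣ 0≤1 ≤-refl
  ∣^∣≤ (suc k) p = ∣*∣≤ p (∣^∣≤ k p)

  ^-nonneg : ∀ {x} k → 0# ≤ x → 0# ≤ x ^ k
  ^-nonneg zero    p = 0≤1
  ^-nonneg (suc k) p = *-nonneg p (^-nonneg k p)

  ^-pos : ∀ {x} k → 0# < x → 0# < x ^ k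
  ^-pos zero    p = 0<1
  ^-pos (suc k) p = *-pos p (^-pos k p)

  ^-mono : ∀ {x y} k → 0# ≤ x → x ≤ y → x ^ k ≤ y ^ k
  ^-mono zero    p q = ≤-refl
  ^-mono (suc k) p q = *-mono-≤ p q (^-nonneg k p) (^-mono k p q)

  ^-cong : ∀ {x y} k → x ≈ y → x ^ k ≈ y ^ k
  ^-cong zero    e = refl
  ^-cong (suc k) e = *-cong e (^-cong k e)

  -- Naturals in the field, the Archimedean property and geometric decay.

  ι : ℕ → Carrier
  ι n = n · 1#

  ι-nonneg : ∀ n → 0# ≤ ι n
  ι-nonneg zero    = ≤-refl
  ι-nonneg (suc n) = +-nonneg 0≤1 (ι-nonneg n)

  ι-pos : ∀ n → 0# < ι (suc n)
  ι-pos n = pos+nonneg 0<1 (ι-nonneg n)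

  ι-+ : ∀ m n → ι (m ℕ.+ n) ≈ ι m + ι n
  ι-+ = Mult.×-homo-+ 1#

  ι-* : ∀ m n → ι (m ℕ.* n) ≈ ι m * ι n
  ι-* = Mult.×1-homo-*

  ι-^ : ∀ m k → ι (m ℕ.^ k) ≈ ι m ^ k
  ι-^ m zero    = +-identityʳ 1#
  ι-^ m (suc k) = trans (ι-* m (m ℕ.^ k)) (*-congˡ (ι-^ m k))

  ι-mono : ∀ {m n} → m ℕ.≤ n → ι m ≤ ι n
  ι-mono {n = n} z≤n = ι-nonneg n
  ι-mono (s≤s p) = +-mono-≤ ≤-refl (ι-mono p)

  -- Otherwise the naturals are bounded by x and have a supremum s. As they are closed under
  -- successor, s - 1 bounds them too, against the minimality of s.
  archimedean : ∀ x → ∃ λ n → x ≤ ι n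
  archimedean x with em {∃ λ n → x ≤ ι n}
  ... | yes p = p
  ... | no ¬p = ⊥-elim (<⇒≱ s-1<s (least (s - 1#) s-1-bound))
    where
    IsNat : Carrier → Set
    IsNat y = ∃ λ n → y ≈ ι n
    sup = supremum IsNat (0# , 0 , refl)
            (x , λ { y (n , e) → ≤-respˡ (sym e) (<⇒≤ (≰⇒> λ q → ¬p (n , q))) })
    s     = proj₁ sup
    upper = proj₁ (proj₂ sup)
    least = proj₂ (proj₂ sup)
    s-1-bound : ∀ y → IsNat y → y ≤ s - 1#
    s-1-bound y (n , e) = ≤-respˡ (sym e) (≤-from (0≤y-x (upper (ι (suc n)) (suc n , refl)))
      (solve 2 (λ s i → s :- (con ℤ.1ℤ :+ i) := s :- con ℤ.1ℤ :- i) refl s (ι n)))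
    s-1<s : s - 1# < s
    s-1<s = ≤-from 0≤1 e , λ q → 0≉1 (trans (sym (-‿inverseʳ s)) (trans (+-congˡ (-‿cong (sym q))) (sym e)))
      where
      e : 1# ≈ s - (s - 1#)
      e = solve 1 (λ s → con ℤ.1ℤ := s :- (s :- con ℤ.1ℤ)) refl s

  -- A quantitative form of 2⁻ⁿ → 0: combined with `archimedean` it makes any multiple of 2⁻ⁿ
  -- smaller than a given ε.
  ι*half^≤1 : ∀ n → ι n * half ^ n ≤ 1#
  ι*half^≤1 zero    = ≤-respˡ (sym (zeroˡ _)) 0≤1
  ι*half^≤1 (suc n) = begin
    (1# + ι n) * (half * half ^ n)
      ≈⟨ solve 3 (λ i h p → (con ℤ.1ℤ :+ i) :* (h :* p) := h :* p :+ h :* (i :* p)) refl (ι n) half (half ^ n) ⟩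
    half * half ^ n + half * (ι n * half ^ n)
      ≤⟨ +-mono-≤ (*-monoˡ-≤ 0≤half (half^≤1 n)) (*-monoˡ-≤ 0≤half (ι*half^≤1 n)) ⟩
    half * 1# + half * 1# ≈⟨ half-* 1# ⟩
    1# ∎
    where
    open ≤-Reasoning
    half≤1 : half ≤ 1#
    half≤1 = ≤-respʳ half+half (≤+nonneg 0≤half)
    half^≤1 : ∀ k → half ^ k ≤ 1#
    half^≤1 zero    = ≤-refl
    half^≤1 (suc k) = ≤-respʳ (*-identityˡ 1#) (*-mono-≤ 0≤half half≤1 (^-nonneg k 0≤half) (half^≤1 k))

  half^-nonneg : ∀ n → 0# ≤ half ^ n
  half^-nonneg n = ^-nonneg n 0≤half

  half^-step : ∀ n → half ^ suc n ≤ half ^ n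
  half^-step n = ≤-respʳ (half-* (half ^ n)) (≤+nonneg (*-nonneg 0≤half (half^-nonneg n)))

  half^-antimono : ∀ {m n} → m ℕ.≤ n → half ^ n ≤ half ^ m
  half^-antimono {m} {n} p with ℕ.≤⇒≤′ p
  ... | ℕ.≤′-reflexive ≡.refl = ≤-refl
  ... | ℕ.≤′-step {n = k} q   = ≤-trans (half^-step k) (half^-antimono (ℕ.≤′⇒≤ q))

  small-power : ∀ A ε → 0# < ε → ∃ λ N → A * half ^ N < ε
  -- With n ≥ A / ε, the index n + 1 makes the estimate strict: A 2⁻⁽ⁿ⁺¹⁾ ≤ n 2⁻⁽ⁿ⁺¹⁾ ε < (n + 1)
  -- 2⁻⁽ⁿ⁺¹⁾ ε ≤ ε.
  small-power A ε 0<ε = suc n , ≤-<-trans A≤ strict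
    where
    n = proj₁ (archimedean (A * ε ⁻¹))
    A≤ : A * half ^ suc n ≤ ι n * half ^ suc n * ε
    A≤ = begin
      A * half ^ suc n              ≈⟨ *-congʳ (trans (*-congˡ (⁻¹-inverseˡ ε (pos⇒≉0 0<ε))) (*-identityʳ A)) ⟨
      A * (ε ⁻¹ * ε) * half ^ suc n ≈⟨ solve 4 (λ A i e h → A :* (i :* e) :* h := A :* i :* (h :* e)) refl A (ε ⁻¹) ε (half ^ suc n) ⟩
      A * ε ⁻¹ * (half ^ suc n * ε) ≤⟨ *-monoʳ-≤ (*-nonneg (half^-nonneg (suc n)) (<⇒≤ 0<ε)) (proj₂ (archimedean (A * ε ⁻¹))) ⟩
      ι n * (half ^ suc n * ε)      ≈⟨ *-assoc _ _ _ ⟨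
      ι n * half ^ suc n * ε        ∎
      where open ≤-Reasoning
    p = half ^ suc n
    0<εp : 0# < ε * p
    0<εp = *-pos 0<ε (^-pos (suc n) 0<half)
    strict : ι n * p * ε < ε
    strict = <-≤-trans (≤-from (<⇒≤ 0<εp) e , λ q → pos⇒≉0 0<εp (trans e (trans (+-congˡ (-‿cong q)) (-‿inverseʳ _)))) le
      where
      e : ε * p ≈ ε * (ι (suc n) * p) - ι n * p * ε
      e = solve 3 (λ ε p i → ε :* p := ε :* ((con ℤ.1ℤ :+ i) :* p) :- i :* p :* ε) refl ε p (ι n)
      le : ε * (ι (suc n) * p) ≤ ε
      le = ≤-respʳ (*-identityʳ ε) (*-monoˡ-≤ (<⇒≤ 0<ε) (ι*half^≤1 (suc n)))

  -- Errors are kept in this geometric form throughout, so that an ε is met only where a limit, sum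
  -- or integral is unfolded.
  ≤-limit : ∀ {x y} A → (∀ n → x ≤ y + A * half ^ n) → x ≤ y
  ≤-limit {x} {y} A p with em {y < x}
  ... | no ¬q = ≮⇒≥ ¬q
  ... | yes q = ⊥-elim (<⇒≱ (proj₂ small) (≤-from (0≤y-x (p (proj₁ small)))
      (solve 3 (λ x y a → y :+ a :- x := a :- (x :- y)) refl x y (A * half ^ proj₁ small))))
    where
    small = small-power A (x - y) (0≤y-x (<⇒≤ q) , λ e → proj₂ q (sym (AbelianGroupProperties.x∙y⁻¹≈ε⇒x≈y +-abelianGroup x y (sym e))))

  ≈-limit : ∀ {x y} A → (∀ n → ∣ x - y ∣ ≤ A * half ^ n) → x ≈ y
  ≈-limit A p = ≤-antisym (≤-limit A λ n → ∣-∣-upper (p n)) (≤-limit A λ n → ∣-∣-upper (∣-∣-sym (p n)))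

-- Limits and exponential generating series.

module Series (em : ExcludedMiddle 0ℓ) (ℝ : CompleteOrderedField) where
  open CompleteOrderedField ℝ
  open Analysis em ℝ
  open OrderedField em ℝ

  the-satisfies : (P : Carrier → Set) → ∃ P → P (the P)
  the-satisfies P p with em {∃ P}
  ... | yes (l , q) = q
  ... | no ¬p       = ⊥-elim (¬p p)

  lim-unique : ∀ {s l l′} → ConvergesTo s l → ConvergesTo s l′ → l ≈ l′
  lim-unique {s} {l} {l′} p q = ≈-limit 2# bound
    where
    bound : ∀ n → ∣ l - l′ ∣ ≤ 2# * half ^ n
    bound n = ≤-respʳ (solve 1 (λ e → e :+ e := (con ℤ.1ℤ :+ con ℤ.1ℤ) :* e) refl ε)
      (∣∣-triangle (∣-∣-sym (<⇒≤ (proj₂ pN k (ℕ.m≤m⊔n _ _)))) (<⇒≤ (proj₂ qN k (ℕ.m≤n⊔m _ _))))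
      where
      ε  = half ^ n
      pN = p ε (^-pos n 0<half)
      qN = q ε (^-pos n 0<half)
      k  = proj₁ pN ℕ.⊔ proj₁ qN

  lim-≈ : ∀ {s l} → ConvergesTo s l → lim s ≈ l
  lim-≈ {s} {l} p = lim-unique (the-satisfies (ConvergesTo s) (l , p)) p

  geometric⇒converges : ∀ {s l} A → 0# ≤ A → (∀ n → ∣ s n - l ∣ ≤ A * half ^ n) → ConvergesTo s l
  geometric⇒converges {s} {l} A 0≤A p ε 0<ε = N , λ k N≤k → ≤-<-trans (p k)
    (≤-<-trans (*-monoˡ-≤ 0≤A (half^-antimono N≤k)) (proj₂ small))
    where
    small = small-power A ε 0<ε
    N = proj₁ small

  module _ {s : ℕ → Carrier} {A : Carrier} (step : ∀ k → ∣ s (suc k) - s k ∣ ≤ A * half ^ k) where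
    private
      0≤A : 0# ≤ A
      0≤A = ≤-respʳ (*-identityʳ A) (0≤-bound (step 0))

      C = A + A

      0≤C : 0# ≤ C
      0≤C = +-nonneg 0≤A 0≤A

      C-step : ∀ k → A * half ^ k + C * half ^ suc k ≈ C * half ^ k
      C-step k = trans (solve 3 (λ A h p → A :* p :+ (A :+ A) :* (h :* p) := A :* p :+ (A :* (h :* p :+ h :* p)))
                   refl A half (half ^ k))
        (trans (+-congˡ (*-congˡ (half-* (half ^ k)))) (sym (distribʳ (half ^ k) A A)))

      lower : ∀ k → s k - C * half ^ k ≤ s (suc k) - C * half ^ suc k
      lower k = ≤-from (0≤y-x (∣-∣-upper (∣-∣-sym (step k)))) (trans
        (solve 4 (λ a b p q → b :+ p :- a := b :- q :- (a :- (p :+ q))) refl (s k) (s (suc k)) (A * half ^ k) (C * half ^ suc k))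
        (+-congˡ (-‿cong (+-congˡ (-‿cong (C-step k))))))

      upper : ∀ k → s (suc k) + C * half ^ suc k ≤ s k + C * half ^ k
      upper k = ≤-from (0≤y-x (∣-∣-upper (step k))) (trans
        (solve 4 (λ a b p q → a :+ p :- b := a :+ (p :+ q) :- (b :+ q)) refl (s k) (s (suc k)) (A * half ^ k) (C * half ^ suc k))
        (+-congʳ (+-congˡ (C-step k))))

      lower-mono : ∀ {m n} → m ℕ.≤′ n → s m - C * half ^ m ≤ s n - C * half ^ n
      lower-mono (ℕ.≤′-reflexive ≡.refl) = ≤-refl
      lower-mono (ℕ.≤′-step {n = n} p)   = ≤-trans (lower-mono p) (lower n)

      upper-mono : ∀ {m n} → m ℕ.≤′ n → s n + C * half ^ n ≤ s m + C * half ^ m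
      upper-mono (ℕ.≤′-reflexive ≡.refl) = ≤-refl
      upper-mono (ℕ.≤′-step {n = n} p)   = ≤-trans (upper n) (upper-mono p)

      lower≤upper : ∀ m n → s m - C * half ^ m ≤ s n + C * half ^ n
      lower≤upper m n = ≤-trans (lower-mono (ℕ.≤⇒≤′ (ℕ.m≤m⊔n m n)))
        (≤-trans (≤-from (+-nonneg e e) (solve 2 (λ a p → p :+ p := a :+ p :- (a :- p)) refl _ _))
          (upper-mono (ℕ.≤⇒≤′ (ℕ.m≤n⊔m m n))))
        where
        e : 0# ≤ C * half ^ (m ℕ.⊔ n)
        e = *-nonneg 0≤C (half^-nonneg (m ℕ.⊔ n))

    -- Completeness enters as nested intervals s k ± C 2⁻ᵏ. The radius C = 2A is the one with A 2⁻ᵏ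
    -- + C 2⁻⁽ᵏ⁺¹⁾ = C 2⁻ᵏ, which makes them decrease. The limit is the supremum of the left ends,
    -- each right end being an upper bound of these.
    geometric-limit : ∃ λ l → ∀ n → ∣ s n - l ∣ ≤ (A + A) * half ^ n
    geometric-limit = l , λ n → ∣-∣-lub
      (≤-from (0≤y-x (ub _ (n , refl))) (solve 3 (λ l a p → l :- (a :- p) := l :+ p :- a) refl l (s n) (C * half ^ n)))
      (lub _ λ x (m , e) → ≤-respˡ (sym e) (lower≤upper m n))
      where
      sup = supremum (λ x → ∃ λ n → x ≈ s n - C * half ^ n) (_ , 0 , refl)
              (s 0 + C * half ^ 0 , λ x (m , e) → ≤-respˡ (sym e) (lower≤upper m 0))
      l   = proj₁ sup
      ub  = proj₁ (proj₂ sup)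
      lub = proj₂ (proj₂ sup)

  invFact : ℕ → Carrier
  invFact k = ι (k !) ⁻¹

  fact≉0 : ∀ k → ¬ ι (k !) ≈ 0#
  fact≉0 k = pos⇒≉0 (<-≤-trans (ι-pos 0) (ι-mono (1≤n! k)))
    where
    1≤n! : ∀ n → 1 ℕ.≤ n !
    1≤n! zero    = s≤s z≤n
    1≤n! (suc n) = ℕ.≤-trans (1≤n! n) (ℕ.m≤m+n (n !) _)

  invFact-nonneg : ∀ k → 0# ≤ invFact k
  invFact-nonneg k = ⁻¹-nonneg (ι-nonneg (k !) , λ e → fact≉0 k (sym e))

  fact*invFact : ∀ k → ι (k !) * invFact k ≈ 1#
  fact*invFact k = ⁻¹-inverseʳ _ (fact≉0 k)

  invFact-0 : invFact 0 ≈ 1#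
  invFact-0 = trans (sym (*-identityˡ _)) (trans (*-congʳ (sym (+-identityʳ 1#))) (fact*invFact 0))

  invFact-suc : ∀ k → ι (suc k) * invFact (suc k) ≈ invFact k
  invFact-suc k = inverse-unique (fact≉0 k) (begin-equality
    ι (k !) * (ι (suc k) * invFact (suc k)) ≈⟨ solve 3 (λ a b c → a :* (b :* c) := b :* a :* c) refl _ _ _ ⟩
    ι (suc k) * ι (k !) * invFact (suc k)   ≈⟨ *-congʳ (sym (ι-* (suc k) (k !))) ⟩
    ι (suc k !) * invFact (suc k)           ≈⟨ fact*invFact (suc k) ⟩
    1#                                      ∎)
    where open ≤-Reasoning

  Seq : Set
  Seq = ℕ → Carrier

  infix 4 _≐_
  _≐_ : Seq → Seq → Set
  c ≐ d = ∀ k → c k ≈ d k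

  partial : ℕ → Seq → Carrier
  partial zero    c = 0#
  partial (suc n) c = partial n c + c n * invFact n

  -- The value at 1 of the exponential generating series of c.
  egf : Seq → Carrier
  egf c = lim λ n → partial n c

  partial-cong : ∀ n {c d} → c ≐ d → partial n c ≈ partial n d
  partial-cong zero    e = refl
  partial-cong (suc n) e = +-cong (partial-cong n e) (*-congʳ (e n))

  partial-+ : ∀ n c d → partial n (λ k → c k + d k) ≈ partial n c + partial n d
  partial-+ zero    c d = sym (+-identityˡ 0#)
  partial-+ (suc n) c d = trans (+-congʳ (partial-+ n c d))
    (solve 5 (λ p q a b f → p :+ q :+ (a :+ b) :* f := p :+ a :* f :+ (q :+ b :* f)) refl _ _ (c n) (d n) (invFact n))

  partial-* : ∀ n a c → partial n (λ k → a * c k) ≈ a * partial n c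
  partial-* zero    a c = sym (zeroʳ a)
  partial-* (suc n) a c = trans (+-congʳ (partial-* n a c))
    (solve 4 (λ a p c f → a :* p :+ a :* c :* f := a :* (p :+ c :* f)) refl a _ (c n) (invFact n))

  -- Geometric growth, with any rate, makes the exponential series entire, and it survives shifts,
  -- products and the substitution of c k tᵏ for c k. The rate is a natural number so that Mᵏ can be
  -- compared with k! inside ℕ.
  record Dom (C : Carrier) (M : ℕ) (c : Seq) : Set where
    constructor dom
    field
      bound : ∀ k → ∣ c k ∣ ≤ C * ι M ^ k

  open Dom public

  Tame : Seq → Set
  Tame c = ∃ λ C → ∃ λ M → Dom C M c

  dom-nonneg : ∀ {C M c} → Dom C M c → 0# ≤ C
  dom-nonneg {C} p = ≤-respʳ (*-identityʳ C) (0≤-bound (bound p 0))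

  dom-cong : ∀ {C M c d} → c ≐ d → Dom C M c → Dom C M d
  dom-cong e p = dom λ k → ∣∣≤-cong (e k) (bound p k)

  dom-weaken : ∀ {C D M N c} → C ≤ D → M ℕ.≤ N → Dom C M c → Dom D N c
  dom-weaken {M = M} C≤D M≤N p = dom λ k → ≤-trans (bound p k)
    (*-mono-≤ (dom-nonneg p) C≤D (^-nonneg k (ι-nonneg M)) (^-mono k (ι-nonneg M) (ι-mono M≤N)))

  dom-+ : ∀ {C D M c d} → Dom C M c → Dom D M d → Dom (C + D) M (λ k → c k + d k)
  dom-+ p q = dom λ k → ≤-respʳ (sym (distribʳ _ _ _)) (∣+∣≤ (bound p k) (bound q k))

  dom-* : ∀ {C M c a A} → ∣ a ∣ ≤ A → Dom C M c → Dom (A * C) M (λ k → a * c k)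
  dom-* p q = dom λ k → ≤-respʳ (sym (*-assoc _ _ _)) (∣*∣≤ p (bound q k))

  -- M ^ k / k! ≤ expBound M / 2 ^ (k + 1)
  expBound : ℕ → Carrier
  expBound M = ι Y + ι Y
    where Y = (2 ℕ.* M) ℕ.^ (2 ℕ.* M)

  private
    -- For k ≤ A the power A ^ A already dominates. From then on each further factor A is at most
    -- the new factor of the factorial.
    ^≤^*! : ∀ A k → A ℕ.^ k ℕ.≤ A ℕ.^ A ℕ.* (k !)
    ^≤^*! zero    zero    = ℕ.≤-refl
    ^≤^*! zero    (suc k) = z≤n
    ^≤^*! (suc A) zero    = ℕ.≤-trans (ℕ.m^n>0 (suc A) (suc A)) (ℕ.≤-reflexive (≡.sym (ℕ.*-identityʳ _)))
    ^≤^*! (suc A) (suc k) with ℕ.≤-total A k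
    ... | inj₁ A≤k = ℕ.≤-trans (ℕ.*-mono-≤ (s≤s A≤k) (^≤^*! (suc A) k))
          (ℕ.≤-reflexive (≡.trans (≡.sym (ℕ.*-assoc (suc k) Y (k !)))
            (≡.trans (≡.cong (ℕ._* (k !)) (ℕ.*-comm (suc k) Y)) (ℕ.*-assoc Y (suc k) (k !)))))
      where Y = suc A ℕ.^ suc A
    ... | inj₂ k≤A = ℕ.≤-trans (ℕ.^-monoʳ-≤ (suc A) (s≤s k≤A))
          (ℕ.m≤m*n (suc A ℕ.^ suc A) (suc k !) {{ℕ._!≢0 (suc k)}})

    -- Writing M as 2M · 1/2 splits off the decay 2⁻ᵏ, and the remaining (2M)ᵏ / k! is at most
    -- (2M)^(2M).
    term-bound : ∀ M k → ι M ^ k * invFact k ≤ ι ((2 ℕ.* M) ℕ.^ (2 ℕ.* M)) * half ^ k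
    term-bound M k = begin
      ι M ^ k * invFact k                              ≈⟨ *-congʳ e ⟩
      ι ((2 ℕ.* M) ℕ.^ k) * half ^ k * invFact k
        ≤⟨ *-monoʳ-≤ (invFact-nonneg k) (*-monoʳ-≤ (half^-nonneg k) (ι-mono (^≤^*! (2 ℕ.* M) k))) ⟩
      ι (Y ℕ.* k !) * half ^ k * invFact k             ≈⟨ *-congʳ (*-congʳ (ι-* Y (k !))) ⟩
      ι Y * ι (k !) * half ^ k * invFact k             ≈⟨ solve 4 (λ a b c d → a :* b :* c :* d := a :* c :* (b :* d)) refl _ _ _ _ ⟩
      ι Y * half ^ k * (ι (k !) * invFact k)           ≈⟨ trans (*-congˡ (fact*invFact k)) (*-identityʳ _) ⟩
      ι Y * half ^ k                                   ∎
      where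
      open ≤-Reasoning
      Y = (2 ℕ.* M) ℕ.^ (2 ℕ.* M)
      e : ι M ^ k ≈ ι ((2 ℕ.* M) ℕ.^ k) * half ^ k
      e = begin-equality
        ι M ^ k                          ≈⟨ ^-cong k (half-* (ι M)) ⟨
        (half * ι M + half * ι M) ^ k    ≈⟨ ^-cong k (solve 2 (λ h m → h :* m :+ h :* m := (m :+ m) :* h) refl half (ι M)) ⟩
        ((ι M + ι M) * half) ^ k         ≈⟨ Exp.^-distrib-* _ _ k ⟩
        (ι M + ι M) ^ k * half ^ k       ≈⟨ *-congʳ (^-cong k (trans (sym (ι-+ M M)) (reflexive (≡.cong (λ n → ι (M ℕ.+ n)) (≡.sym (ℕ.+-identityʳ M)))))) ⟩
        ι (2 ℕ.* M) ^ k * half ^ k       ≈⟨ *-congʳ (sym (ι-^ (2 ℕ.* M) k)) ⟩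
        ι ((2 ℕ.* M) ℕ.^ k) * half ^ k   ∎

  expBound-nonneg : ∀ M → 0# ≤ expBound M
  expBound-nonneg M = +-nonneg (ι-nonneg ((2 ℕ.* M) ℕ.^ (2 ℕ.* M))) (ι-nonneg ((2 ℕ.* M) ℕ.^ (2 ℕ.* M)))

  egf-limit : ∀ {C M c l A} → Dom C M c → 0# ≤ A → (∀ n → ∣ partial n c - l ∣ ≤ A * half ^ n) → egf c ≈ l
  egf-limit _ 0≤A p = lim-≈ (geometric⇒converges _ 0≤A p)

  -- Consecutive partial sums differ by at most C Y 2⁻ᵏ with Y = (2M)^(2M). Passing to the limit
  -- doubles the constant, whence the two summands of `expBound`.
  egf-approx : ∀ {C M c} → Dom C M c → ∀ n → ∣ partial n c - egf c ∣ ≤ C * expBound M * half ^ n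
  egf-approx {C} {M} {c} p n = ∣∣≤-cong (+-congˡ (-‿cong (sym (lim-≈ (geometric⇒converges _ (*-nonneg 0≤C (expBound-nonneg M)) near)))))
      (near n)
    where
    0≤C = dom-nonneg p
    Y = ι ((2 ℕ.* M) ℕ.^ (2 ℕ.* M))
    step : ∀ k → ∣ partial (suc k) c - partial k c ∣ ≤ C * Y * half ^ k
    step k = ∣∣≤-cong (solve 2 (λ p t → t := p :+ t :- p) refl _ _)
      (≤-trans (∣*∣≤ (bound p k) (∣nonneg∣ (invFact-nonneg k) ≤-refl))
      (≤-trans (≤-reflexive (*-assoc _ _ _))
      (≤-trans (*-monoˡ-≤ 0≤C (term-bound M k)) (≤-reflexive (sym (*-assoc _ _ _))))))
    l = proj₁ (geometric-limit step)
    near : ∀ n → ∣ partial n c - l ∣ ≤ C * expBound M * half ^ n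
    near n = ≤-respʳ (*-congʳ (sym (distribˡ C Y Y))) (proj₂ (geometric-limit step) n)

  egf-bound : ∀ {C M c} → Dom C M c → ∣ egf c ∣ ≤ C * expBound M
  egf-bound p = ≤-respʳ (*-identityʳ _) (∣∣≤-cong (solve 1 (λ e → e :- con ℤ.0ℤ := e) refl _) (∣-∣-sym (egf-approx p 0)))

  egf-cong : ∀ {c d} → Tame c → c ≐ d → egf c ≈ egf d
  egf-cong {c} {d} (C , M , p) e = sym (egf-limit (dom-cong {C} {M} e p) (*-nonneg (dom-nonneg p) (expBound-nonneg M))
    λ n → ∣∣≤-cong (+-congʳ (partial-cong n e)) (egf-approx p n))

  tame-+ : ∀ {c d} → Tame c → Tame d → Tame (λ k → c k + d k)
  tame-+ (C , M , p) (D , N , q) = C + D , M ℕ.+ N ,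
    dom-+ (dom-weaken ≤-refl (ℕ.m≤m+n M N) p) (dom-weaken ≤-refl (ℕ.m≤n+m N M) q)

  tame-* : ∀ {c} a → Tame c → Tame (λ k → a * c k)
  tame-* a (C , M , p) = ∣ a ∣ * C , M , dom-* ≤-refl p

  tame-cong : ∀ {c d} → c ≐ d → Tame c → Tame d
  tame-cong e (C , M , p) = C , M , dom-cong e p

  tame-0 : Tame (λ k → 0#)
  tame-0 = 0# , 0 , dom λ k → ∣0∣≤ (≤-reflexive (sym (zeroˡ _)))

  egf-+ : ∀ {c d} → Tame c → Tame d → egf (λ k → c k + d k) ≈ egf c + egf d
  egf-+ {c} {d} tc@(C , M , p) td@(D , N , q) = egf-limit (proj₂ (proj₂ (tame-+ tc td)))
    (+-nonneg (*-nonneg (dom-nonneg p) (expBound-nonneg M)) (*-nonneg (dom-nonneg q) (expBound-nonneg N)))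
    λ n → ≤-respʳ (sym (distribʳ _ _ _))
      (∣∣≤-cong (trans (solve 4 (λ a b x y → a :- x :+ (b :- y) := a :+ b :- (x :+ y)) refl _ _ (egf c) (egf d))
                        (+-congʳ (sym (partial-+ n c d))))
        (∣+∣≤ (egf-approx p n) (egf-approx q n)))

  egf-* : ∀ a {c} → Tame c → egf (λ k → a * c k) ≈ a * egf c
  egf-* a {c} t@(C , M , p) = egf-limit (proj₂ (proj₂ (tame-* a t)))
    (*-nonneg (0≤∣x∣ a) (*-nonneg (dom-nonneg p) (expBound-nonneg M)))
    λ n → ≤-respʳ (sym (*-assoc _ _ _))
      (∣∣≤-cong (trans (solve 3 (λ a x y → a :* (x :- y) := a :* x :- a :* y) refl _ _ (egf c))
                        (+-congʳ (sym (partial-* n a c))))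
        (∣*∣≤ ≤-refl (egf-approx p n)))

  egf-nonneg : ∀ {c} → Tame c → (∀ k → 0# ≤ c k) → 0# ≤ egf c
  egf-nonneg {c} (C , M , p) q = ≤-limit (C * expBound M) λ n → ≤-trans (pos n) (∣-∣-upper (egf-approx p n))
    where
    pos : ∀ n → 0# ≤ partial n c
    pos zero    = ≤-refl
    pos (suc n) = +-nonneg (pos n) (*-nonneg (q n) (invFact-nonneg n))

  egf-0 : egf (λ k → 0#) ≈ 0#
  egf-0 = egf-limit {0#} {0} {λ k → 0#} (proj₂ (proj₂ tame-0)) ≤-refl λ n →
    ∣∣≤-cong (trans (sym (-‿inverseʳ 0#)) (+-congʳ (sym (z n)))) (∣0∣≤ (≤-reflexive (sym (zeroˡ _))))
    where
    z : ∀ n → partial n (λ k → 0#) ≈ 0#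
    z zero    = refl
    z (suc n) = trans (+-cong (z n) (zeroˡ _)) (+-identityʳ 0#)

-- Summing double exponential series along diagonals.

module Fubini (em : ExcludedMiddle 0ℓ) (ℝ : CompleteOrderedField) where
  open CompleteOrderedField ℝ
  open OrderedField em ℝ
  open Series em ℝ

  Array : Set
  Array = ℕ → ℕ → Carrier

  record Dom₂ (C : Carrier) (M : ℕ) (c : Array) : Set where
    constructor dom₂
    field
      bound₂ : ∀ i j → ∣ c i j ∣ ≤ C * (ι M ^ i * ι M ^ j)

  open Dom₂ public

  -- diag c k = Σ_{i + j = k} (k choose i) c i j
  diag : Array → Seq
  diag c zero    = c 0 0
  diag c (suc k) = diag (λ i j → c (suc i) j) k + diag (λ i j → c i (suc j)) k

  double : Array → Carrier
  double c = egf λ i → egf (c i)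

  diag-cong : ∀ {c d} → (∀ i j → c i j ≈ d i j) → diag c ≐ diag d
  diag-cong e zero    = e 0 0
  diag-cong e (suc k) = +-cong (diag-cong (λ i j → e (suc i) j) k) (diag-cong (λ i j → e i (suc j)) k)

  diag-+ : ∀ c d → diag (λ i j → c i j + d i j) ≐ λ k → diag c k + diag d k
  diag-+ c d zero    = refl
  diag-+ c d (suc k) = trans (+-cong (diag-+ _ _ k) (diag-+ _ _ k))
    (solve 4 (λ a b x y → a :+ b :+ (x :+ y) := a :+ x :+ (b :+ y)) refl _ _ _ _)

  diag-* : ∀ a c → diag (λ i j → a * c i j) ≐ λ k → a * diag c k
  diag-* a c zero    = refl
  diag-* a c (suc k) = trans (+-cong (diag-* a _ k) (diag-* a _ k)) (sym (distribˡ a _ _))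

  diag-0 : ∀ {c} → (∀ i j → c i j ≈ 0#) → ∀ k → diag c k ≈ 0#
  diag-0 e zero    = e 0 0
  diag-0 e (suc k) = trans (+-cong (diag-0 (λ i j → e (suc i) j) k) (diag-0 (λ i j → e i (suc j)) k)) (+-identityʳ 0#)

  dom₂-cong : ∀ {C M c d} → (∀ i j → c i j ≈ d i j) → Dom₂ C M c → Dom₂ C M d
  dom₂-cong e p = dom₂ λ i j → ∣∣≤-cong (e i j) (bound₂ p i j)

  dom₂-+ : ∀ {C D M c d} → Dom₂ C M c → Dom₂ D M d → Dom₂ (C + D) M (λ i j → c i j + d i j)
  dom₂-+ p q = dom₂ λ i j → ≤-respʳ (sym (distribʳ _ _ _)) (∣+∣≤ (bound₂ p i j) (bound₂ q i j))

  dom₂-* : ∀ {C M c a A} → ∣ a ∣ ≤ A → Dom₂ C M c → Dom₂ (A * C) M (λ i j → a * c i j)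
  dom₂-* p q = dom₂ λ i j → ≤-respʳ (sym (*-assoc _ _ _)) (∣*∣≤ p (bound₂ q i j))

  dom-row : ∀ {C M c} → Dom₂ C M c → ∀ i → Dom (C * ι M ^ i) M (c i)
  dom-row p i = dom λ j → ≤-respʳ (sym (*-assoc _ _ _)) (bound₂ p i j)

  dom-rows : ∀ {C M c} → Dom₂ C M c → Dom (C * expBound M) M (λ i → egf (c i))
  dom-rows {C} {M} p = dom λ i → ≤-respʳ (solve 3 (λ a b c → a :* b :* c := a :* c :* b) refl _ _ _)
    (egf-bound (dom-row p i))

  -- The binomial weights on the k-th diagonal add up to 2ᵏ, which doubles the rate. The induction
  -- has to vary C, because the two shifted arrays are dominated with C M in its place.
  dom-diag : ∀ {C M c} → Dom₂ C M c → Dom C (M ℕ.+ M) (diag c)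
  dom-diag p = dom (go p)
    where
    go : ∀ {C M c} → Dom₂ C M c → ∀ k → ∣ diag c k ∣ ≤ C * ι (M ℕ.+ M) ^ k
    go p zero = ≤-respʳ (*-congˡ (*-identityʳ 1#)) (bound₂ p 0 0)
    go {C} {M} p (suc k) = ≤-respʳ e (∣+∣≤
      (go {C * ι M} {M} (dom₂ λ i j → ≤-respʳ (solve 4 (λ a b c d → a :* ((b :* c) :* d) := a :* b :* (c :* d)) refl _ _ _ _) (bound₂ p (suc i) j)) k)
      (go {C * ι M} {M} (dom₂ λ i j → ≤-respʳ (solve 4 (λ a b c d → a :* (c :* (b :* d)) := a :* b :* (c :* d)) refl _ _ _ _) (bound₂ p i (suc j))) k))
      where
      e : C * ι M * ι (M ℕ.+ M) ^ k + C * ι M * ι (M ℕ.+ M) ^ k ≈ C * ι (M ℕ.+ M) ^ suc k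
      e = trans (solve 3 (λ C m p → C :* m :* p :+ C :* m :* p := C :* ((m :+ m) :* p)) refl _ _ _)
            (*-congˡ (*-congʳ (sym (ι-+ M M))))

  -- `χ n` is the indicator of the indices below n, and `δ p` below is the Kronecker delta.
  -- Recursion on both arguments makes them follow index shifts by computation.
  χ : ℕ → Seq
  χ zero    k       = 0#
  χ (suc n) zero    = 1#
  χ (suc n) (suc k) = χ n k

  δ : ℕ → Seq
  δ zero    zero    = 1#
  δ zero    (suc k) = 0#
  δ (suc p) zero    = 0#
  δ (suc p) (suc k) = δ p k

  χ-suc : ∀ n → χ (suc n) ≐ λ k → χ n k + δ n k
  χ-suc zero    zero    = sym (+-identityˡ 1#)
  χ-suc zero    (suc k) = sym (+-identityˡ 0#)
  χ-suc (suc n) zero    = sym (+-identityʳ 1#)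
  χ-suc (suc n) (suc k) = χ-suc n k

  δ-* : ∀ p (f : Seq) k → δ p k * f k ≈ δ p k * f p
  δ-* zero    f zero    = refl
  δ-* zero    f (suc k) = trans (zeroˡ _) (sym (zeroˡ _))
  δ-* (suc p) f zero    = trans (zeroˡ _) (sym (zeroˡ _))
  δ-* (suc p) f (suc k) = δ-* p (f ∘ suc) k

  χ≤1 : ∀ n k → χ n k ≤ 1#
  χ≤1 zero    k       = 0≤1
  χ≤1 (suc n) zero    = ≤-refl
  χ≤1 (suc n) (suc k) = χ≤1 n k

  χ-nonneg : ∀ n k → 0# ≤ χ n k
  χ-nonneg zero    k       = ≤-refl
  χ-nonneg (suc n) zero    = 0≤1
  χ-nonneg (suc n) (suc k) = χ-nonneg n k

  1-χ-nonneg : ∀ n k → 0# ≤ 1# - χ n k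
  1-χ-nonneg n k = 0≤y-x (χ≤1 n k)

  1-χ≤1 : ∀ n k → 1# - χ n k ≤ 1#
  1-χ≤1 n k = ≤-from (χ-nonneg n k) (solve 1 (λ x → x := con ℤ.1ℤ :- (con ℤ.1ℤ :- x)) refl _)

  1≤2^ : ∀ k → 1# ≤ 2# ^ k
  1≤2^ zero    = ≤-refl
  1≤2^ (suc k) = ≤-respˡ (*-identityˡ 1#) (*-mono-≤ 0≤1 (≤+nonneg 0≤1) 0≤1 (1≤2^ k))

  2^-nonneg : ∀ k → 0# ≤ 2# ^ k
  2^-nonneg k = ^-nonneg k 0≤2

  -- An index k ≥ n has 1 ≤ 2ᵏ / 2ⁿ. Seen this way, cutting off below n gains the factor 2⁻ⁿ at the
  -- price of a doubled growth rate.
  1-χ≤half^ : ∀ n k → 1# - χ n k ≤ half ^ n * 2# ^ k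
  1-χ≤half^ zero    k       = ≤-trans (1-χ≤1 0 k) (≤-respʳ (sym (*-identityˡ _)) (1≤2^ k))
  1-χ≤half^ (suc n) zero    = ≤-respˡ (sym (-‿inverseʳ 1#)) (*-nonneg (half^-nonneg (suc n)) 0≤1)
  1-χ≤half^ (suc n) (suc k) = ≤-respʳ (begin-equality
    half ^ n * 2# ^ k                  ≈⟨ *-identityˡ _ ⟨
    1# * (half ^ n * 2# ^ k)           ≈⟨ *-congʳ (⁻¹-inverseʳ 2# (pos⇒≉0 0<2)) ⟨
    2# * half * (half ^ n * 2# ^ k)    ≈⟨ solve 4 (λ a b c d → a :* b :* (c :* d) := b :* c :* (a :* d)) refl _ _ _ _ ⟩
    half ^ suc n * 2# ^ suc k          ∎) (1-χ≤half^ n k)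
    where open ≤-Reasoning

  partial-δ : ∀ p n → partial n (δ p) ≈ χ n p * invFact p
  partial-δ p zero    = sym (zeroˡ _)
  partial-δ p (suc n) = trans (+-cong (partial-δ p n) (trans (δ-* p invFact n) (*-congʳ (δ-sym p n))))
      (trans (sym (distribʳ _ _ _)) (*-congʳ (sym (χ-suc n p))))
    where
    δ-sym : ∀ p n → δ p n ≈ δ n p
    δ-sym zero    zero    = refl
    δ-sym zero    (suc n) = refl
    δ-sym (suc p) zero    = refl
    δ-sym (suc p) (suc n) = δ-sym p n

  dom-δ : ∀ p → Dom 1# 1 (δ p)
  dom-δ p = dom λ k → ∣nonneg∣ (δ-nonneg p k) (≤-trans (δ≤1 p k) (≤-reflexive (sym (trans (*-identityˡ _) (trans (^-cong k (+-identityʳ 1#)) (1^ k))))))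
    where
    1^ : ∀ k → 1# ^ k ≈ 1#
    1^ zero    = refl
    1^ (suc k) = trans (*-identityˡ _) (1^ k)
    δ-nonneg : ∀ p k → 0# ≤ δ p k
    δ-nonneg zero    zero    = 0≤1
    δ-nonneg zero    (suc k) = ≤-refl
    δ-nonneg (suc p) zero    = ≤-refl
    δ-nonneg (suc p) (suc k) = δ-nonneg p k
    δ≤1 : ∀ p k → δ p k ≤ 1#
    δ≤1 zero    zero    = ≤-refl
    δ≤1 zero    (suc k) = 0≤1
    δ≤1 (suc p) zero    = 0≤1
    δ≤1 (suc p) (suc k) = δ≤1 p k

  tame-δ : ∀ p → Tame (δ p)
  tame-δ p = 1# , 1 , dom-δ p

  egf-δ : ∀ p → egf (δ p) ≈ invFact p
  egf-δ p = egf-limit (dom-δ p) (*-nonneg (2^-nonneg p) (invFact-nonneg p)) λ n →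
    ∣-∣-sym (∣∣≤-cong (trans (solve 2 (λ c f → (con ℤ.1ℤ :- c) :* f := f :- c :* f) refl _ _) (+-congˡ (-‿cong (sym (partial-δ p n)))))
      (≤-respʳ (solve 3 (λ h t f → h :* t :* f := t :* f :* h) refl _ _ _)
        (∣*∣≤ (∣nonneg∣ (1-χ-nonneg n p) (1-χ≤half^ n p)) (∣nonneg∣ (invFact-nonneg p) ≤-refl))))

  private
    -- The binomial coefficient "p + q over p", written with inverse factorials because these are
    -- the values of the series of `δ p` and `δ q`.
    choose : ℕ → ℕ → Carrier
    choose p q = ι ((p ℕ.+ q) !) * (invFact p * invFact q)

    choose-0ʳ : ∀ p → choose p 0 ≈ 1#
    choose-0ʳ p = trans (*-cong (reflexive (≡.cong (λ n → ι (n !)) (ℕ.+-identityʳ p)))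
      (trans (*-congˡ invFact-0) (*-identityʳ _))) (fact*invFact p)

    choose-0ˡ : ∀ q → choose 0 q ≈ 1#
    choose-0ˡ q = trans (*-congˡ (trans (*-congʳ invFact-0) (*-identityˡ _))) (fact*invFact q)

    -- Over the common factor (p + q + 1)! / ((p + 1)! (q + 1)!) the two summands carry p + 1 and q
    -- + 1, whose sum is the missing factor p + q + 2.
    pascal : ∀ p q → choose p (suc q) + choose (suc p) q ≈ choose (suc p) (suc q)
    pascal p q = begin-equality
      ι ((p ℕ.+ suc q) !) * (invFact p * invFact (suc q)) + ι (suc (p ℕ.+ q) !) * (invFact (suc p) * invFact q)
        ≈⟨ +-cong (*-cong (reflexive (≡.cong (λ n → ι (n !)) (ℕ.+-suc p q))) (*-congʳ (sym (invFact-suc p))))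
                  (*-congˡ (*-congˡ (sym (invFact-suc q)))) ⟩
      N * (ι (suc p) * invFact (suc p) * invFact (suc q)) + N * (invFact (suc p) * (ι (suc q) * invFact (suc q)))
        ≈⟨ solve 5 (λ N a x b y → N :* (a :* x :* y) :+ N :* (x :* (b :* y)) := (a :+ b) :* N :* (x :* y)) refl N (ι (suc p)) (invFact (suc p)) (ι (suc q)) (invFact (suc q)) ⟩
      (ι (suc p) + ι (suc q)) * N * (invFact (suc p) * invFact (suc q))
        ≈⟨ *-congʳ (trans (*-congʳ (sym (ι-+ (suc p) (suc q)))) (trans
             (reflexive (≡.cong (λ n → ι (suc n) * N) (ℕ.+-suc p q))) (trans (sym (ι-* (suc (suc (p ℕ.+ q))) (suc (p ℕ.+ q) !)))
             (reflexive (≡.cong (λ n → ι (suc n !)) (≡.sym (ℕ.+-suc p q))))))) ⟩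
      choose (suc p) (suc q) ∎
      where
      open ≤-Reasoning
      N = ι (suc (p ℕ.+ q) !)

    -- An array with a single entry 1 at (p, q) meets only the diagonal p + q, with its binomial
    -- weight. The induction on all three indices is Pascal's rule.
    diag-δ : ∀ p q k → diag (λ i j → δ p i * δ q j) k ≈ choose p q * δ (p ℕ.+ q) k
    diag-δ zero zero zero = trans (*-identityʳ 1#) (sym (trans (*-identityʳ _) (choose-0ˡ 0)))
    diag-δ zero zero (suc k) = trans (+-cong (diag-0 (λ i j → zeroˡ _) k) (diag-0 (λ i j → zeroʳ _) k)) (trans (+-identityʳ 0#) (sym (zeroʳ _)))
    diag-δ zero (suc q) zero = trans (zeroʳ _) (sym (zeroʳ _))
    diag-δ zero (suc q) (suc k) = trans (+-cong (diag-0 (λ i j → zeroˡ _) k) (diag-δ 0 q k))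
      (trans (+-identityˡ _) (*-congʳ (trans (choose-0ˡ q) (sym (choose-0ˡ (suc q))))))
    diag-δ (suc p) zero zero = trans (zeroˡ _) (sym (zeroʳ _))
    diag-δ (suc p) zero (suc k) = trans (+-cong (diag-δ p 0 k) (diag-0 (λ i j → zeroʳ _) k))
      (trans (+-identityʳ _) (*-congʳ (trans (choose-0ʳ p) (sym (choose-0ʳ (suc p))))))
    diag-δ (suc p) (suc q) zero = trans (zeroˡ _) (sym (zeroʳ _))
    diag-δ (suc p) (suc q) (suc k) = trans
      (+-cong (diag-δ p (suc q) k)
              (trans (diag-δ (suc p) q k) (*-congˡ (reflexive (≡.cong (λ n → δ n k) (≡.sym (ℕ.+-suc p q)))))))
      (trans (sym (distribʳ _ _ _)) (*-congʳ (pascal p q)))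

    Exchange : Array → Set
    Exchange c = double c ≈ egf (diag c)

    -- Both sides are 1 / (p! q!): on the diagonal side the binomial coefficient cancels the factor
    -- 1 / (p + q)!.
    exchange-δ : ∀ p q → Exchange (λ i j → δ p i * δ q j)
    exchange-δ p q = begin-equality
      egf (λ i → egf λ j → δ p i * δ q j)  ≈⟨ egf-cong (tame-cong (λ i → sym (e i)) (tame-* (invFact q) (tame-δ p))) e ⟩
      egf (λ i → invFact q * δ p i)        ≈⟨ egf-* _ (tame-δ p) ⟩
      invFact q * egf (δ p)                ≈⟨ *-congˡ (egf-δ p) ⟩
      invFact q * invFact p                ≈⟨ *-comm _ _ ⟩
      invFact p * invFact q                ≈⟨ *-identityˡ _ ⟨
      1# * (invFact p * invFact q)         ≈⟨ *-congʳ (fact*invFact (p ℕ.+ q)) ⟨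
      ι ((p ℕ.+ q) !) * invFact (p ℕ.+ q) * (invFact p * invFact q)
        ≈⟨ solve 3 (λ a b c → a :* b :* c := a :* c :* b) refl _ _ _ ⟩
      choose p q * invFact (p ℕ.+ q)       ≈⟨ *-congˡ (egf-δ (p ℕ.+ q)) ⟨
      choose p q * egf (δ (p ℕ.+ q))       ≈⟨ egf-* _ (tame-δ (p ℕ.+ q)) ⟨
      egf (λ k → choose p q * δ (p ℕ.+ q) k)
        ≈⟨ egf-cong (tame-* _ (tame-δ (p ℕ.+ q))) (λ k → sym (diag-δ p q k)) ⟩
      egf (diag (λ i j → δ p i * δ q j))   ∎
      where
      open ≤-Reasoning
      e : ∀ i → egf (λ j → δ p i * δ q j) ≈ invFact q * δ p i
      e i = trans (egf-* _ (tame-δ q)) (trans (*-congˡ (egf-δ q)) (*-comm _ _))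

    Tame₂ : Array → Set
    Tame₂ c = ∃ λ C → ∃ λ M → Dom₂ C M c

    tame-row : ∀ {c} → Tame₂ c → ∀ i → Tame (c i)
    tame-row (C , M , p) i = _ , _ , dom-row p i

    tame-rows : ∀ {c} → Tame₂ c → Tame (λ i → egf (c i))
    tame-rows (C , M , p) = _ , _ , dom-rows p

    tame-diag : ∀ {c} → Tame₂ c → Tame (diag c)
    tame-diag (C , M , p) = _ , _ , dom-diag p

  double-cong : ∀ {C M c d} → Dom₂ C M c → (∀ i j → c i j ≈ d i j) → double c ≈ double d
  double-cong p e = egf-cong (_ , _ , dom-rows p) λ i → egf-cong (_ , _ , dom-row p i) (e i)

  private
    exchange-cong : ∀ {c d} → Tame₂ c → (∀ i j → c i j ≈ d i j) → Exchange c → Exchange d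
    exchange-cong t@(_ , _ , p) e x = trans (sym (double-cong p e)) (trans x (egf-cong (tame-diag t) (diag-cong e)))

    exchange-+ : ∀ {c d} → Tame₂ c → Tame₂ d → Exchange c → Exchange d → Exchange (λ i j → c i j + d i j)
    exchange-+ {c} {d} t u x y = begin-equality
      egf (λ i → egf λ j → c i j + d i j)
        ≈⟨ egf-cong (tame-cong (λ i → sym (e i)) (tame-+ (tame-rows t) (tame-rows u))) e ⟩
      egf (λ i → egf (c i) + egf (d i))   ≈⟨ egf-+ (tame-rows t) (tame-rows u) ⟩
      double c + double d                 ≈⟨ +-cong x y ⟩
      egf (diag c) + egf (diag d)         ≈⟨ egf-+ (tame-diag t) (tame-diag u) ⟨
      egf (λ k → diag c k + diag d k)     ≈⟨ egf-cong (tame-+ (tame-diag t) (tame-diag u)) (λ k → sym (diag-+ c d k)) ⟩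
      egf (diag (λ i j → c i j + d i j))  ∎
      where
      open ≤-Reasoning
      e : ∀ i → egf (λ j → c i j + d i j) ≈ egf (c i) + egf (d i)
      e i = egf-+ (tame-row t i) (tame-row u i)

    exchange-* : ∀ {c} a → Tame₂ c → Exchange c → Exchange (λ i j → a * c i j)
    exchange-* {c} a t x = begin-equality
      egf (λ i → egf λ j → a * c i j)
        ≈⟨ egf-cong (tame-cong (λ i → sym (e i)) (tame-* a (tame-rows t))) e ⟩
      egf (λ i → a * egf (c i))    ≈⟨ egf-* a (tame-rows t) ⟩
      a * double c                 ≈⟨ *-congˡ x ⟩
      a * egf (diag c)             ≈⟨ egf-* a (tame-diag t) ⟨
      egf (λ k → a * diag c k)     ≈⟨ egf-cong (tame-* a (tame-diag t)) (λ k → sym (diag-* a c k)) ⟩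
      egf (diag (λ i j → a * c i j)) ∎
      where
      open ≤-Reasoning
      e : ∀ i → egf (λ j → a * c i j) ≈ a * egf (c i)
      e i = egf-* a (tame-row t i)

    tame₂-damp : ∀ {c} {f : Array} → (∀ i j → ∣ f i j ∣ ≤ 1#) → Tame₂ c → Tame₂ (λ i j → f i j * c i j)
    tame₂-damp q (C , M , p) = C , M , dom₂ λ i j → ≤-respʳ (*-identityˡ _) (∣*∣≤ (q i j) (bound₂ p i j))

    ∣χ∣ : ∀ n k → ∣ χ n k ∣ ≤ 1#
    ∣χ∣ n k = ∣nonneg∣ (χ-nonneg n k) (χ≤1 n k)

    ∣δ∣ : ∀ n k → ∣ δ n k ∣ ≤ 1#
    ∣δ∣ zero    zero    = ∣nonneg∣ 0≤1 ≤-refl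
    ∣δ∣ zero    (suc k) = ∣0∣≤ 0≤1
    ∣δ∣ (suc p) zero    = ∣0∣≤ 0≤1
    ∣δ∣ (suc p) (suc k) = ∣δ∣ p k

    ∣*∣≤1 : ∀ {x y} → ∣ x ∣ ≤ 1# → ∣ y ∣ ≤ 1# → ∣ x * y ∣ ≤ 1#
    ∣*∣≤1 p q = ≤-respʳ (*-identityˡ 1#) (∣*∣≤ p q)

    exchange-0 : ∀ {c} → (∀ i j → c i j ≈ 0#) → Exchange c
    exchange-0 {c} e = trans
      (trans (sym (double-cong {0#} {0} (dom₂ λ i j → ∣0∣≤ (≤-reflexive (sym (zeroˡ _)))) (λ i j → sym (e i j))))
        (trans (egf-cong (tame-cong (λ i → sym egf-0) tame-0) (λ i → egf-0)) egf-0))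
      (trans (sym egf-0) (egf-cong tame-0 (λ k → sym (diag-0 e k))))

    -- The entries of row p are added one column at a time, each being a multiple of a single-entry
    -- array. `exchange-box` then adds rows in the same way.
    exchange-row : ∀ {c} → Tame₂ c → ∀ p n → Exchange (λ i j → δ p i * χ n j * c i j)
    exchange-row t p zero = exchange-0 λ i j → trans (*-congʳ (zeroʳ _)) (zeroˡ _)
    exchange-row {c} t p (suc q) = exchange-cong
      (tame₂-cong′ e (tame₂-damp (λ i j → ∣*∣≤1 (∣δ∣ p i) (∣χ∣ (suc q) j)) t)) (λ i j → sym (e i j))
      (exchange-+ (tame₂-damp (λ i j → ∣*∣≤1 (∣δ∣ p i) (∣χ∣ q j)) t)
                  (tame₂-δ p q) (exchange-row t p q)
                  (exchange-* (c p q) (1# , 1 , tδ p q) (exchange-δ p q)))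
      where
      tδ : ∀ p q → Dom₂ 1# 1 (λ i j → δ p i * δ q j)
      tδ p q = dom₂ λ i j → ≤-respʳ (trans (*-cong (*-identityˡ _) (*-identityˡ _)) (sym (*-identityˡ _)))
                 (∣*∣≤ (bound (dom-δ p) i) (bound (dom-δ q) j))
      tame₂-δ : ∀ p q → Tame₂ (λ i j → c p q * (δ p i * δ q j))
      tame₂-δ p q = _ , _ , dom₂-* ≤-refl (tδ p q)
      tame₂-cong′ : ∀ {c d} → (∀ i j → c i j ≈ d i j) → Tame₂ c → Tame₂ d
      tame₂-cong′ e (C , M , p) = C , M , dom₂-cong e p
      e : ∀ i j → δ p i * χ (suc q) j * c i j ≈ δ p i * χ q j * c i j + c p q * (δ p i * δ q j)
      e i j = begin-equality
        δ p i * χ (suc q) j * c i j                        ≈⟨ *-congʳ (*-congˡ (χ-suc q j)) ⟩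
        δ p i * (χ q j + δ q j) * c i j                    ≈⟨ solve 4 (λ a b d c → a :* (b :+ d) :* c := a :* b :* c :+ d :* (a :* c)) refl _ _ _ _ ⟩
        δ p i * χ q j * c i j + δ q j * (δ p i * c i j)    ≈⟨ +-congˡ (*-congˡ (δ-* p (λ i → c i j) i)) ⟩
        δ p i * χ q j * c i j + δ q j * (δ p i * c p j)    ≈⟨ +-congˡ (solve 3 (λ a b c → a :* (b :* c) := b :* (a :* c)) refl _ _ _) ⟩
        δ p i * χ q j * c i j + δ p i * (δ q j * c p j)    ≈⟨ +-congˡ (*-congˡ (δ-* q (c p) j)) ⟩
        δ p i * χ q j * c i j + δ p i * (δ q j * c p q)    ≈⟨ +-congˡ (solve 3 (λ a b c → b :* (a :* c) := c :* (b :* a)) refl _ _ _) ⟩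
        δ p i * χ q j * c i j + c p q * (δ p i * δ q j)    ∎
        where open ≤-Reasoning

    exchange-box : ∀ {c} → Tame₂ c → ∀ m n → Exchange (λ i j → χ m i * χ n j * c i j)
    exchange-box t zero n = exchange-0 λ i j → trans (*-congʳ (zeroˡ _)) (zeroˡ _)
    exchange-box {c} t (suc m) n = exchange-cong
      (_ , _ , dom₂-+ (proj₂ (proj₂ (tame₂-damp (λ i j → ∣*∣≤1 (∣χ∣ m i) (∣χ∣ n j)) t)))
                      (proj₂ (proj₂ (tame₂-damp (λ i j → ∣*∣≤1 (∣δ∣ m i) (∣χ∣ n j)) t))))
      (λ i j → trans (solve 4 (λ a b x c → a :* x :* c :+ b :* x :* c := (a :+ b) :* x :* c) refl _ _ _ _)
                 (*-congʳ (*-congʳ (sym (χ-suc m i)))))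
      (exchange-+ (tame₂-damp (λ i j → ∣*∣≤1 (∣χ∣ m i) (∣χ∣ n j)) t)
                  (tame₂-damp (λ i j → ∣*∣≤1 (∣δ∣ m i) (∣χ∣ n j)) t)
                  (exchange-box t m n) (exchange-row t m n))

  -- Both sides agree on finitely supported arrays, and cutting the array off outside
  -- [0, n)² changes either side by O(2⁻ⁿ), as seen by doubling the growth rate M.
  fubini : ∀ {C M c} → Dom₂ C M c → double c ≈ egf (diag c)
  fubini {C} {M} {c} p = ≈-limit ((1# + 1#) * C * expBound M′ * expBound M′ + (1# + 1#) * C * expBound (M′ ℕ.+ M′)) λ n →
    ≤-respʳ (sym (distribʳ _ _ _)) (∣∣≤-cong (e n) (∣-∣≤ (near₁ n) (near₂ n)))
    where
    M′ = M ℕ.+ M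
    t : Tame₂ c
    t = C , M , p
    cut rest : ℕ → Array
    cut n i j  = χ n i * χ n j * c i j
    rest n i j = (1# - χ n i * χ n j) * c i j
    t-cut : ∀ n → Tame₂ (cut n)
    t-cut n = tame₂-damp (λ i j → ∣*∣≤1 (∣χ∣ n i) (∣χ∣ n j)) t
    -- For a and b in [0, 1] one has 1 - a b ≤ (1 - a) + (1 - b), because (1 - a)(1 - b) ≥ 0. Each
    -- of the two terms is then bounded as a one-dimensional tail.
    factor≤ : ∀ n i j → 1# - χ n i * χ n j ≤ half ^ n * ((1# + 1#) * (2# ^ i * 2# ^ j))
    factor≤ n i j = begin
      1# - χ n i * χ n j
        ≤⟨ ≤-from (*-nonneg (1-χ-nonneg n i) (1-χ-nonneg n j))
             (solve 2 (λ a b → (con ℤ.1ℤ :- a) :* (con ℤ.1ℤ :- b) := (con ℤ.1ℤ :- a) :+ (con ℤ.1ℤ :- b) :- (con ℤ.1ℤ :- a :* b)) refl _ _) ⟩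
      (1# - χ n i) + (1# - χ n j)                    ≤⟨ +-mono-≤ (1-χ≤half^ n i) (1-χ≤half^ n j) ⟩
      half ^ n * 2# ^ i + half ^ n * 2# ^ j
        ≤⟨ +-mono-≤ (*-monoˡ-≤ (half^-nonneg n) (≤-respˡ (*-identityʳ _) (*-monoˡ-≤ (2^-nonneg i) (1≤2^ j))))
                    (*-monoˡ-≤ (half^-nonneg n) (≤-respˡ (*-identityˡ _) (*-monoʳ-≤ (2^-nonneg j) (1≤2^ i)))) ⟩
      half ^ n * (2# ^ i * 2# ^ j) + half ^ n * (2# ^ i * 2# ^ j)
        ≈⟨ solve 2 (λ h q → h :* q :+ h :* q := h :* ((con ℤ.1ℤ :+ con ℤ.1ℤ) :* q)) refl _ _ ⟩
      half ^ n * ((1# + 1#) * (2# ^ i * 2# ^ j))     ∎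
      where open ≤-Reasoning
    doubled : ∀ i → 2# ^ i * ι M ^ i ≈ ι M′ ^ i
    doubled i = trans (sym (Exp.^-distrib-* 2# (ι M) i)) (^-cong i
      (trans (solve 1 (λ m → (con ℤ.1ℤ :+ con ℤ.1ℤ) :* m := m :+ m) refl (ι M)) (sym (ι-+ M M))))
    p-rest : ∀ n → Dom₂ (half ^ n * ((1# + 1#) * C)) M′ (rest n)
    p-rest n = dom₂ λ i j → ≤-respʳ
      (trans (solve 7 (λ h w a b C x y → h :* (w :* (a :* b)) :* (C :* (x :* y)) := h :* (w :* C) :* (a :* x :* (b :* y))) refl _ _ _ _ _ _ _)
        (*-congˡ (*-cong (doubled i) (doubled j))))
      (∣*∣≤ (∣nonneg∣ (0≤y-x (≤-respʳ (*-identityˡ 1#) (*-mono-≤ (χ-nonneg n i) (χ≤1 n i) (χ-nonneg n j) (χ≤1 n j)))) (factor≤ n i j)) (bound₂ p i j))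
    split : ∀ n i j → c i j ≈ cut n i j + rest n i j
    split n i j = solve 2 (λ x c → c := x :* c :+ (con ℤ.1ℤ :- x) :* c) refl (χ n i * χ n j) (c i j)
    t-rest : ∀ n → Tame₂ (rest n)
    t-rest n = _ , _ , p-rest n
    near₁ : ∀ n → ∣ double (rest n) ∣ ≤ (1# + 1#) * C * expBound M′ * expBound M′ * half ^ n
    near₁ n = ≤-respʳ (solve 4 (λ h C x y → h :* C :* x :* y := C :* x :* y :* h) refl _ _ _ _) (egf-bound (dom-rows (p-rest n)))
    near₂ : ∀ n → ∣ egf (diag (rest n)) ∣ ≤ (1# + 1#) * C * expBound (M′ ℕ.+ M′) * half ^ n
    near₂ n = ≤-respʳ (solve 3 (λ h C x → h :* C :* x := C :* x :* h) refl _ _ _) (egf-bound (dom-diag (p-rest n)))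
    e : ∀ n → double (rest n) - egf (diag (rest n)) ≈ double c - egf (diag c)
    e n = sym (begin-equality
      double c - egf (diag c)
        ≈⟨ +-cong (trans (double-cong p (split n)) (trans (egf-cong
              (tame-cong (λ i → sym (egf-+ (tame-row (t-cut n) i) (tame-row (t-rest n) i))) (tame-+ (tame-rows (t-cut n)) (tame-rows (t-rest n))))
              (λ i → egf-+ (tame-row (t-cut n) i) (tame-row (t-rest n) i))) (egf-+ (tame-rows (t-cut n)) (tame-rows (t-rest n)))))
           (-‿cong (trans (egf-cong (tame-diag t) (λ k → trans (diag-cong (split n) k) (diag-+ (cut n) (rest n) k)))
              (egf-+ (tame-diag (t-cut n)) (tame-diag (t-rest n))))) ⟩
      double (cut n) + double (rest n) - (egf (diag (cut n)) + egf (diag (rest n)))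
        ≈⟨ +-congʳ (+-congʳ (exchange-box t n n)) ⟩
      egf (diag (cut n)) + double (rest n) - (egf (diag (cut n)) + egf (diag (rest n)))
        ≈⟨ solve 3 (λ a b c → a :+ b :- (a :+ c) := b :- c) refl _ _ _ ⟩
      double (rest n) - egf (diag (rest n)) ∎)
      where open ≤-Reasoning

-- Entire functions of one variable: products, Taylor's formula, monotonicity.

module PowerSeries (em : ExcludedMiddle 0ℓ) (ℝ : CompleteOrderedField) where
  open CompleteOrderedField ℝ
  open Analysis em ℝ
  open OrderedField em ℝ
  open Series em ℝ
  open Fubini em ℝ

  -- The entire function with k-th derivative c k at 0. Hence `c ∘ suc` represents its derivative
  -- and `shift i c` its i-th derivative.
  value : Seq → Carrier → Carrier
  value c t = egf λ k → c k * t ^ k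

  shift : ℕ → Seq → Seq
  shift i c j = c (i ℕ.+ j)

  dom-power : ∀ {C M c t} T → ∣ t ∣ ≤ ι T → Dom C M c → Dom C (M ℕ.* T) (λ k → c k * t ^ k)
  dom-power {M = M} T p q = dom λ k → ≤-respʳ
    (trans (*-assoc _ _ _) (*-congˡ (trans (sym (Exp.^-distrib-* (ι M) (ι T) k)) (^-cong k (sym (ι-* M T))))))
    (∣*∣≤ (bound q k) (∣^∣≤ k p))

  magnitude : Carrier → ℕ
  magnitude t = proj₁ (archimedean ∣ t ∣)

  ∣∣≤magnitude : ∀ t → ∣ t ∣ ≤ ι (magnitude t)
  ∣∣≤magnitude t = proj₂ (archimedean ∣ t ∣)

  tame-power : ∀ {c} t → Tame c → Tame (λ k → c k * t ^ k)
  tame-power t (C , M , p) = _ , _ , dom-power (magnitude t) (∣∣≤magnitude t) p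

  dom-shift : ∀ {C M c} → Dom C M c → ∀ i → Dom (C * ι M ^ i) M (shift i c)
  dom-shift {M = M} p i = dom λ j → ≤-respʳ
    (trans (*-congˡ (Exp.^-homo-* (ι M) i j)) (sym (*-assoc _ _ _))) (bound p (i ℕ.+ j))

  value-bound : ∀ {C M c t} T → ∣ t ∣ ≤ ι T → Dom C M c → ∣ value c t ∣ ≤ C * expBound (M ℕ.* T)
  value-bound T p q = egf-bound (dom-power T p q)

  value-cong : ∀ {c d s t} → Tame c → c ≐ d → s ≈ t → value c s ≈ value d t
  value-cong {s = s} tc e f = egf-cong (tame-power s tc) λ k → *-cong (e k) (^-cong k f)

  value-congˡ : ∀ {c d} t → Tame c → c ≐ d → value c t ≈ value d t
  value-congˡ t tc e = value-cong tc e refl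

  value-congʳ : ∀ {c s t} → Tame c → s ≈ t → value c s ≈ value c t
  value-congʳ tc e = value-cong tc (λ _ → refl) e

  value-+ : ∀ {c d} t → Tame c → Tame d → value (λ k → c k + d k) t ≈ value c t + value d t
  value-+ t tc td = trans (egf-cong (tame-power t (tame-+ tc td)) λ k → distribʳ _ _ _)
    (egf-+ (tame-power t tc) (tame-power t td))

  value-* : ∀ a {c} t → Tame c → value (λ k → a * c k) t ≈ a * value c t
  value-* a t tc = trans (egf-cong (tame-power t (tame-* a tc)) λ k → *-assoc _ _ _) (egf-* a (tame-power t tc))

  value-nonneg : ∀ {c t} → Tame c → 0# ≤ t → (∀ k → 0# ≤ c k) → 0# ≤ value c t
  value-nonneg {t = t} tc p q = egf-nonneg (tame-power t tc) λ k → *-nonneg (q k) (^-nonneg k p)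

  0^ : ∀ {t} → t ≈ 0# → ∀ k → t ^ k ≈ δ 0 k
  0^ e zero    = refl
  0^ e (suc k) = trans (*-congʳ e) (zeroˡ _)

  value-0 : ∀ {c t} → Tame c → t ≈ 0# → value c t ≈ c 0
  value-0 {c} {t} tc e = begin-equality
    egf (λ k → c k * t ^ k)  ≈⟨ egf-cong (tame-power t tc) (λ k → trans (*-congˡ (0^ e k)) (trans (*-comm _ _) (trans (δ-* 0 c k) (*-comm _ _)))) ⟩
    egf (λ k → c 0 * δ 0 k)  ≈⟨ egf-* (c 0) (tame-δ 0) ⟩
    c 0 * egf (δ 0)          ≈⟨ *-congˡ (trans (egf-δ 0) invFact-0) ⟩
    c 0 * 1#                 ≈⟨ *-identityʳ _ ⟩
    c 0                      ∎
    where open ≤-Reasoning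

  -- Stated for a factorisation x = a t, so that an exponential with linear exponent becomes a
  -- function of t with coefficients aᵏ.
  exp-value : ∀ a t x → x ≈ a * t → exp x ≈ value (a ^_) t
  exp-value a t x e = lim-≈ λ ε 0<ε → let N , p = converges ε 0<ε in
      N , λ k N≤k → ≤-<-trans (≤-reflexive (∣∣-cong (+-congʳ (trans (sum≈partial k (x ^_)) (partial-cong k λ j → trans (^-cong j e) (Exp.^-distrib-* a t j)))))) (p k N≤k)
    where
    tame-^ : Tame (a ^_)
    tame-^ = 1# , magnitude a , dom λ k → ≤-respʳ (sym (*-identityˡ _)) (∣^∣≤ k (∣∣≤magnitude a))
    d = proj₂ (proj₂ (tame-power t tame-^))
    converges : ConvergesTo (λ n → partial n (λ k → a ^ k * t ^ k)) (value (a ^_) t)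
    converges = geometric⇒converges _ (*-nonneg (dom-nonneg d) (expBound-nonneg (magnitude a ℕ.* magnitude t))) (egf-approx d)
    sum≈partial : ∀ n (c : Seq) → sum {n} (λ k → c (toℕ k) * invFact (toℕ k)) ≈ partial n c
    sum≈partial zero    c = refl
    sum≈partial (suc n) c = trans (Sum.sum-init-last {n} (λ k → c (toℕ k) * invFact (toℕ k)))
      (+-cong (trans (Sum.sum-cong-≋ {n} λ i → reflexive (≡.cong (λ k → c k * invFact k) (Fin.toℕ-inject₁ i))) (sum≈partial n c))
        (reflexive (≡.cong (λ k → c k * invFact k) (Fin.toℕ-fromℕ n))))

  private
    dom₂-power : ∀ {C M c a b} T → ∣ a ∣ ≤ ι T → ∣ b ∣ ≤ ι T → Dom₂ C M c → Dom₂ C (M ℕ.* T) (λ i j → c i j * (a ^ i * b ^ j))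
    dom₂-power {M = M} T p q r = dom₂ λ i j → ≤-respʳ
      (trans (solve 5 (λ C m n s t → C :* (m :* n) :* (s :* t) := C :* (m :* s :* (n :* t))) refl _ _ _ _ _) (*-congˡ (*-cong (e i) (e j))))
      (∣*∣≤ (bound₂ r i j) (∣*∣≤ (∣^∣≤ i p) (∣^∣≤ j q)))
      where
      e : ∀ k → ι M ^ k * ι T ^ k ≈ ι (M ℕ.* T) ^ k
      e k = trans (sym (Exp.^-distrib-* (ι M) (ι T) k)) (^-cong k (sym (ι-* M T)))

    diag-power : ∀ c t k → diag (λ i j → c i j * (t ^ i * t ^ j)) k ≈ diag c k * t ^ k
    diag-power c t zero    = *-congˡ (*-identityʳ 1#)
    diag-power c t (suc k) = begin-equality
      diag (λ i j → c (suc i) j * (t * t ^ i * t ^ j)) k + diag (λ i j → c i (suc j) * (t ^ i * (t * t ^ j))) k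
        ≈⟨ +-cong (step λ i j → solve 4 (λ c t x y → c :* (t :* x :* y) := t :* (c :* (x :* y))) refl _ t _ _)
                  (step λ i j → solve 4 (λ c t x y → c :* (x :* (t :* y)) := t :* (c :* (x :* y))) refl _ t _ _) ⟩
      t * (diag (λ i j → c (suc i) j) k * t ^ k) + t * (diag (λ i j → c i (suc j)) k * t ^ k)
        ≈⟨ solve 4 (λ t p x y → t :* (x :* p) :+ t :* (y :* p) := (x :+ y) :* (t :* p)) refl t (t ^ k) _ _ ⟩
      (diag (λ i j → c (suc i) j) k + diag (λ i j → c i (suc j)) k) * t ^ suc k ∎
      where
      open ≤-Reasoning
      step : ∀ {d c′} → (∀ i j → d i j ≈ t * (c′ i j * (t ^ i * t ^ j))) → diag d k ≈ t * (diag c′ k * t ^ k)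
      step e = trans (diag-cong e k) (trans (diag-* t _ k) (*-congˡ (diag-power _ t k)))

    -- The binomial theorem: c depends on i + j only, hence is constant along the diagonal.
    diag-binomial : ∀ c h s k → diag (λ i j → c (i ℕ.+ j) * (h ^ i * s ^ j)) k ≈ c k * (h + s) ^ k
    diag-binomial c h s zero    = *-congˡ (*-identityʳ 1#)
    diag-binomial c h s (suc k) = begin-equality
      diag (λ i j → c (suc i ℕ.+ j) * (h * h ^ i * s ^ j)) k + diag (λ i j → c (i ℕ.+ suc j) * (h ^ i * (s * s ^ j))) k
        ≈⟨ +-cong (step h λ i j → solve 4 (λ c t x y → c :* (t :* x :* y) := t :* (c :* (x :* y))) refl _ h _ _)
                  (step s λ i j → trans (*-congʳ (reflexive (≡.cong c (ℕ.+-suc i j))))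
                    (solve 4 (λ c t x y → c :* (x :* (t :* y)) := t :* (c :* (x :* y))) refl _ s _ _)) ⟩
      h * (c (suc k) * (h + s) ^ k) + s * (c (suc k) * (h + s) ^ k)
        ≈⟨ solve 4 (λ h s c p → h :* (c :* p) :+ s :* (c :* p) := c :* ((h :+ s) :* p)) refl h s _ _ ⟩
      c (suc k) * (h + s) ^ suc k ∎
      where
      open ≤-Reasoning
      step : ∀ {d} a → (∀ i j → d i j ≈ a * (c (suc (i ℕ.+ j)) * (h ^ i * s ^ j))) → diag d k ≈ a * (c (suc k) * (h + s) ^ k)
      step a e = trans (diag-cong e k) (trans (diag-* a _ k) (*-congˡ (diag-binomial (c ∘ suc) h s k)))

    -- The factor aⁱ moves into the inner series, which leaves a double exponential series for
    -- `fubini`. One natural T above |a| and |b| dominates both variables.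
    nested : ∀ {C M c} a b → Dom₂ C M c →
             value (λ i → value (c i) b) a ≈ egf (diag λ i j → c i j * (a ^ i * b ^ j))
    nested {C} {M} {c} a b p = trans
      (egf-cong (tame-power a (C * expBound (M ℕ.* T) , M , dom λ i → ≤-respʳ (solve 3 (λ C m x → C :* m :* x := C :* x :* m) refl _ _ _)
                  (value-bound T q (dom-row p i))))
        (λ i → trans (*-comm _ _) (trans (sym (egf-* (a ^ i) (tame-power b (_ , _ , dom-row p i))))
          (egf-cong (tame-* (a ^ i) (tame-power b (_ , _ , dom-row p i)))
            (λ j → solve 3 (λ a c b → a :* (c :* b) := c :* (a :* b)) refl (a ^ i) (c i j) (b ^ j))))))
      (fubini (dom₂-power T r q p))
      where
      T = magnitude a ℕ.⊔ magnitude b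
      r : ∣ a ∣ ≤ ι T
      r = ≤-trans (∣∣≤magnitude a) (ι-mono (ℕ.m≤m⊔n (magnitude a) (magnitude b)))
      q : ∣ b ∣ ≤ ι T
      q = ≤-trans (∣∣≤magnitude b) (ι-mono (ℕ.m≤n⊔m (magnitude a) (magnitude b)))

  value-diag : ∀ {C M c} t → Dom₂ C M c → value (diag c) t ≈ value (λ i → value (c i) t) t
  value-diag {c = c} t p = sym (trans (nested t t p)
    (egf-cong (tame-cong (λ k → sym (diag-power c t k)) (tame-power t (_ , _ , dom-diag p))) (diag-power c t)))

  -- Taylor expansion at s: the i-th derivative at s is the inner series, and the array c (i + j) hⁱ
  -- sʲ sums along diagonals to c k (h + s)ᵏ.
  value-shift : ∀ {c} h s → Tame c → value c (h + s) ≈ value (λ i → value (shift i c) s) h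
  value-shift {c} h s tc@(C , M , p) = sym (trans
    (nested {C} {M} {λ i j → c (i ℕ.+ j)} h s (dom₂ λ i j → ≤-respʳ (*-assoc _ _ _) (bound (dom-shift p i) j)))
    (egf-cong (tame-cong (λ k → sym (diag-binomial c h s k)) (tame-power (h + s) tc)) (diag-binomial c h s)))

  -- Binomial convolution. Its entry at `suc k` unfolds to the Leibniz rule, the sum of the entries
  -- at k of (c ∘ suc) ⊗ d and c ⊗ (d ∘ suc).
  _⊗_ : Seq → Seq → Seq
  c ⊗ d = diag λ i j → c i * d j

  dom₂-outer : ∀ {C D M N c d} → Dom C M c → Dom D N d → Dom₂ (C * D) (M ℕ.+ N) (λ i j → c i * d j)
  dom₂-outer {M = M} {N} p q = dom₂ λ i j → ≤-respʳ (solve 4 (λ C m D n → C :* m :* (D :* n) := C :* D :* (m :* n)) refl _ _ _ _)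
    (∣*∣≤ (bound (dom-weaken ≤-refl (ℕ.m≤m+n M N) p) i) (bound (dom-weaken ≤-refl (ℕ.m≤n+m N M) q) j))

  value-⊗ : ∀ {c d} t → Tame c → Tame d → value (c ⊗ d) t ≈ value c t * value d t
  value-⊗ {c} {d} t tc@(_ , _ , p) td@(_ , _ , q) = begin-equality
    value (c ⊗ d) t                           ≈⟨ value-diag t (dom₂-outer p q) ⟩
    value (λ i → value (λ j → c i * d j) t) t ≈⟨ value-congˡ t (tame-cong (λ i → sym (e i)) (tame-* (value d t) tc)) e ⟩
    value (λ i → value d t * c i) t           ≈⟨ value-* (value d t) t tc ⟩
    value d t * value c t                     ≈⟨ *-comm _ _ ⟩
    value c t * value d t                     ∎
    where
    open ≤-Reasoning
    e : ∀ i → value (λ j → c i * d j) t ≈ value d t * c i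
    e i = trans (value-* (c i) t td) (*-comm _ _)

  private
    egf-cut : ∀ {c} → Tame c → ∀ m → Tame (λ k → χ m k * c k) × egf (λ k → χ m k * c k) ≈ partial m c
    egf-cut tc zero = tame-cong (λ k → sym (zeroˡ _)) tame-0 ,
      trans (sym (egf-cong tame-0 λ k → sym (zeroˡ _))) egf-0
    egf-cut {c} tc (suc m) = tame-cong (λ k → sym (e k)) tame′ ,
      trans (sym (egf-cong tame′ λ k → sym (e k)))
        (trans (egf-+ (proj₁ ih) (tame-* (c m) (tame-δ m)))
          (+-cong (proj₂ ih) (trans (egf-* (c m) (tame-δ m)) (*-congˡ (egf-δ m)))))
      where
      ih = egf-cut tc m
      tame′ = tame-+ (proj₁ ih) (tame-* (c m) (tame-δ m))
      e : ∀ k → χ (suc m) k * c k ≈ χ m k * c k + c m * δ m k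
      e k = trans (*-congʳ (χ-suc m k)) (trans (distribʳ _ _ _) (+-congˡ (trans (δ-* m c k) (*-comm _ _))))

    -- For k ≥ m one factors yᵏ = yᵐ yᵏ⁻ᵐ with yᵏ⁻ᵐ ≤ Hᵏ, the last step by 1 ≤ H. Unlike the bound
    -- with 2⁻ᵐ, this keeps the power of y that a Taylor remainder must show.
    tail-power : ∀ {y} H → 1 ℕ.≤ H → 0# ≤ y → y ≤ ι H → ∀ m k → (1# - χ m k) * y ^ k ≤ y ^ m * ι H ^ k
    tail-power H 1≤H p q zero k = *-mono-≤ (1-χ-nonneg 0 k) (1-χ≤1 0 k) (^-nonneg k p) (^-mono k p q)
    tail-power H 1≤H p q (suc m) zero = ≤-respˡ (trans (sym (zeroˡ _)) (*-congʳ (sym (-‿inverseʳ 1#))))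
      (*-nonneg (^-nonneg (suc m) p) 0≤1)
    tail-power {y} H 1≤H p q (suc m) (suc k) = begin
      (1# - χ m k) * (y * y ^ k)        ≈⟨ solve 3 (λ a b c → a :* (b :* c) := b :* (a :* c)) refl _ _ _ ⟩
      y * ((1# - χ m k) * y ^ k)        ≤⟨ *-monoˡ-≤ p (tail-power H 1≤H p q m k) ⟩
      y * (y ^ m * ι H ^ k)             ≈⟨ trans (sym (*-assoc _ _ _)) (sym (*-identityˡ _)) ⟩
      1# * (y ^ suc m * ι H ^ k)        ≤⟨ *-monoʳ-≤ (*-nonneg (^-nonneg (suc m) p) (^-nonneg k (ι-nonneg H))) (≤-respˡ (+-identityʳ 1#) (ι-mono 1≤H)) ⟩
      ι H * (y ^ suc m * ι H ^ k)       ≈⟨ solve 3 (λ a b c → a :* (b :* c) := b :* (a :* c)) refl _ _ _ ⟩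
      y ^ suc m * ι H ^ suc k           ∎
      where open ≤-Reasoning

  -- The remainder is the series without its first m terms. `tail-power` extracts |h|ᵐ from all of
  -- them and leaves a sequence of rate M H, so the general bound of a series applies.
  taylor : ∀ {C M c h} H → 1 ℕ.≤ H → ∣ h ∣ ≤ ι H → Dom C M c → ∀ m →
           ∣ value c h - partial m (λ k → c k * h ^ k) ∣ ≤ C * expBound (M ℕ.* H) * ∣ h ∣ ^ m
  taylor {C} {M} {c} {h} H 1≤H p q m = ∣∣≤-cong e (≤-respʳ (solve 3 (λ a b c → a :* b :* c := b :* c :* a) refl _ _ _) (egf-bound domTail))
    where
    d : Seq
    d k = c k * h ^ k
    td : Tame d
    td = tame-power h (_ , _ , q)
    domTail : Dom (∣ h ∣ ^ m * C) (M ℕ.* H) (λ k → (1# - χ m k) * d k)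
    domTail = dom λ k → begin
      ∣ (1# - χ m k) * (c k * h ^ k) ∣
        ≤⟨ ∣*∣≤ (∣nonneg∣ (1-χ-nonneg m k) ≤-refl) (∣*∣≤ (bound q k) (∣^∣≤ k ≤-refl)) ⟩
      (1# - χ m k) * (C * ι M ^ k * ∣ h ∣ ^ k)
        ≈⟨ solve 4 (λ x C m y → x :* (C :* m :* y) := C :* m :* (x :* y)) refl _ _ _ _ ⟩
      C * ι M ^ k * ((1# - χ m k) * ∣ h ∣ ^ k)
        ≤⟨ *-monoˡ-≤ (*-nonneg (dom-nonneg q) (^-nonneg k (ι-nonneg M))) (tail-power H 1≤H (0≤∣x∣ h) p m k) ⟩
      C * ι M ^ k * (∣ h ∣ ^ m * ι H ^ k)
        ≈⟨ solve 4 (λ C m h k → C :* m :* (h :* k) := h :* C :* (m :* k)) refl _ _ _ _ ⟩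
      ∣ h ∣ ^ m * C * (ι M ^ k * ι H ^ k)
        ≈⟨ *-congˡ (trans (sym (Exp.^-distrib-* (ι M) (ι H) k)) (^-cong k (sym (ι-* M H)))) ⟩
      ∣ h ∣ ^ m * C * ι (M ℕ.* H) ^ k ∎
      where open ≤-Reasoning
    tTail : Tame (λ k → (1# - χ m k) * d k)
    tTail = _ , _ , domTail
    e : egf (λ k → (1# - χ m k) * d k) ≈ value c h - partial m d
    e = begin-equality
      egf (λ k → (1# - χ m k) * d k)
        ≈⟨ solve 2 (λ x y → x := y :+ x :- y) refl _ _ ⟩
      partial m d + egf (λ k → (1# - χ m k) * d k) - partial m d
        ≈⟨ +-congʳ (+-congʳ (sym (proj₂ (egf-cut td m)))) ⟩
      egf (λ k → χ m k * d k) + egf (λ k → (1# - χ m k) * d k) - partial m d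
        ≈⟨ +-congʳ (sym (egf-+ (proj₁ (egf-cut td m)) tTail)) ⟩
      egf (λ k → χ m k * d k + (1# - χ m k) * d k) - partial m d
        ≈⟨ +-congʳ (sym (egf-cong td λ k → solve 2 (λ x d → d := x :* d :+ (con ℤ.1ℤ :- x) :* d) refl _ _)) ⟩
      value c h - partial m d ∎
      where open ≤-Reasoning

  -- Expand at s first: the derivatives at s are dominated uniformly for |s| ≤ T, so `taylor` with m
  -- = 2 gives one constant A for all s and h in range. Both signs of h are used by the integral.
  taylor₂ : ∀ {c} → Tame c → ∀ T → 1 ℕ.≤ T → ∃ λ A → 0# ≤ A × (∀ s h → ∣ s ∣ ≤ ι T → ∣ h ∣ ≤ ι T →
            ∣ value c (h + s) - (value c s + h * value (c ∘ suc) s) ∣ ≤ A * h ^ 2)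
  taylor₂ {c} tc@(C , M , p) T 1≤T = A , *-nonneg (*-nonneg (dom-nonneg p) (expBound-nonneg (M ℕ.* T))) (expBound-nonneg (M ℕ.* T)) , near
    where
    A = C * expBound (M ℕ.* T) * expBound (M ℕ.* T)
    near : ∀ s h → ∣ s ∣ ≤ ι T → ∣ h ∣ ≤ ι T →
           ∣ value c (h + s) - (value c s + h * value (c ∘ suc) s) ∣ ≤ A * h ^ 2
    near s h ∣s∣≤T ∣h∣≤T = ≤-respʳ (*-congˡ ∣h∣²) (∣∣≤-cong (+-cong (sym (value-shift h s tc)) (-‿cong two)) (taylor T 1≤T ∣h∣≤T domE 2))
      where
      e : Seq
      e i = value (shift i c) s
      domE : Dom (C * expBound (M ℕ.* T)) M e
      domE = dom λ i → ≤-respʳ (solve 3 (λ a b c → a :* b :* c := a :* c :* b) refl _ _ _) (value-bound T ∣s∣≤T (dom-shift p i))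
      ∣h∣² : ∣ h ∣ ^ 2 ≈ h ^ 2
      ∣h∣² with ≤-total 0# h
      ... | inj₁ q = ^-cong 2 (≤-antisym (∣nonneg∣ q ≤-refl) (x≤∣x∣ h))
      ... | inj₂ q = trans (^-cong 2 (≤-antisym (∣∣-lub (≤-trans q (≤-respˡ R.-0#≈0# (neg-antimono q))) ≤-refl) (-x≤∣x∣ h)))
                       (solve 1 (λ h → (:- h) :^ 2 := h :^ 2) refl h)
      two : partial 2 (λ k → e k * h ^ k) ≈ value c s + h * value (c ∘ suc) s
      two = trans (+-congʳ (+-congˡ (*-congˡ invFact-0)))
        (trans (+-congˡ (*-congˡ (trans (sym (trans (*-congʳ (+-identityʳ 1#)) (*-identityˡ _))) (trans (invFact-suc 0) invFact-0))))
          (solve 3 (λ x y h → con ℤ.0ℤ :+ x :* con ℤ.1ℤ :* con ℤ.1ℤ :+ y :* (h :* con ℤ.1ℤ) :* con ℤ.1ℤ := x :+ h :* y) refl _ _ h))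

  -- Bisection: an interval of length h loses at most A h², so 2ⁿ pieces lose at most A h² / 2ⁿ.
  derivative-nonneg⇒≤ : ∀ {c t} → Tame c → 0# ≤ t → (∀ s → 0# ≤ s → s ≤ t → 0# ≤ value (c ∘ suc) s) → c 0 ≤ value c t
  derivative-nonneg⇒≤ {c} {t} tc 0≤t p = ≤-limit (A * t ^ 2) λ n → ≤-respˡ (value-0 tc refl)
      (≤-trans (bisect n 0# t ≤-refl 0≤t (≤-reflexive (+-identityʳ t)))
        (≤-reflexive (+-cong (value-congʳ tc (+-identityʳ t)) refl)))
    where
    T = suc (magnitude t)
    t≤T : ∣ t ∣ ≤ ι T
    t≤T = ≤-trans (∣∣≤magnitude t) (ι-mono (ℕ.n≤1+n (magnitude t)))
    inRange : ∀ {x} → 0# ≤ x → x ≤ t → ∣ x ∣ ≤ ι T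
    inRange q r = ∣nonneg∣ q (≤-trans r (≤-trans (x≤∣x∣ t) t≤T))
    A   = proj₁ (taylor₂ tc T (s≤s z≤n))
    est = proj₂ (proj₂ (taylor₂ tc T (s≤s z≤n)))
    bisect : ∀ n s h → 0# ≤ s → 0# ≤ h → h + s ≤ t → value c s ≤ value c (h + s) + A * h ^ 2 * half ^ n
    bisect zero s h 0≤s 0≤h h+s≤t = ≤-trans (≤+nonneg (*-nonneg 0≤h (p s 0≤s s≤t)))
        (≤-respʳ (+-congˡ (sym (*-identityʳ _))) (∣-∣-upper (∣-∣-sym (est s h (inRange 0≤s s≤t) (inRange 0≤h h≤t)))))
      where
      s≤t : s ≤ t
      s≤t = ≤-trans (≤-respʳ (+-comm s h) (≤+nonneg 0≤h)) h+s≤t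
      h≤t : h ≤ t
      h≤t = ≤-trans (≤+nonneg 0≤s) h+s≤t
    bisect (suc n) s h 0≤s 0≤h h+s≤t = ≤-trans (bisect n s g 0≤s 0≤g (≤-trans (≤-respʳ g+gs≈ (≤-respˡ (+-identityˡ _) (+-mono-≤ 0≤g ≤-refl))) h+s≤t))
        (≤-trans (+-mono-≤ (bisect n (g + s) g (+-nonneg 0≤g 0≤s) 0≤g (≤-respˡ (sym g+gs≈) h+s≤t)) ≤-refl)
          (≤-reflexive (trans (+-congʳ (+-congʳ (value-congʳ tc g+gs≈))) sumErr)))
      where
      g = half * h
      0≤g = *-nonneg 0≤half 0≤h
      g+gs≈ : g + (g + s) ≈ h + s
      g+gs≈ = trans (sym (+-assoc _ _ _)) (+-congʳ (half-* h))
      sumErr : value c (h + s) + A * g ^ 2 * half ^ n + A * g ^ 2 * half ^ n ≈ value c (h + s) + A * h ^ 2 * half ^ suc n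
      sumErr = trans (solve 5 (λ v A f h p → v :+ A :* (f :* h) :^ 2 :* p :+ A :* (f :* h) :^ 2 :* p
                                 := v :+ A :* h :^ 2 :* (f :* (f :* p) :+ f :* (f :* p))) refl _ A half h (half ^ n))
                 (+-congˡ (*-congˡ (half-* _)))

  -- At h = 2⁻ⁿ the expansion to order m reads 0 ≤ hᵐ (c m / m! + A h). Divide by hᵐ and let n grow.
  first-coefficient-nonneg : ∀ {c} → Tame c → ∀ m → (∀ t → 0# ≤ t → 0# ≤ value c t) → (∀ k → k ℕ.< m → c k ≈ 0#) → 0# ≤ c m
  first-coefficient-nonneg {c} (C , M , p) m q z = ≤-respʳ c≈ (*-nonneg (ι-nonneg (m !)) leading)
    where
    A = C * expBound (M ℕ.* 1)
    c≈ : ι (m !) * (c m * invFact m) ≈ c m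
    c≈ = trans (solve 3 (λ a b c → a :* (b :* c) := b :* (a :* c)) refl _ _ _) (trans (*-congˡ (fact*invFact m)) (*-identityʳ _))
    partial≈0 : ∀ h n → n ℕ.≤ m → partial n (λ k → c k * h ^ k) ≈ 0#
    partial≈0 h zero    _ = refl
    partial≈0 h (suc n) n<m = trans (+-cong (partial≈0 h n (ℕ.<⇒≤ n<m)) (trans (*-congʳ (trans (*-congʳ (z n n<m)) (zeroˡ _))) (zeroˡ _))) (+-identityʳ 0#)
    leading : 0# ≤ c m * invFact m
    leading = ≤-limit A λ n → *-cancel-pos (^-pos m (^-pos n 0<half)) (at n)
      where
      at : ∀ n → 0# ≤ (half ^ n) ^ m * (c m * invFact m + A * half ^ n)
      at n = ≤-trans (q h 0≤h) (≤-trans (∣-∣-upper (taylor 1 (s≤s z≤n) h≤1 p (suc m))) (≤-reflexive (begin-equality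
          partial m _ + c m * h ^ m * invFact m + A * ∣ h ∣ ^ suc m
            ≈⟨ +-cong (+-congʳ (partial≈0 h m ℕ.≤-refl)) (*-congˡ (^-cong (suc m) (≤-antisym (∣nonneg∣ 0≤h ≤-refl) (x≤∣x∣ h)))) ⟩
          0# + c m * h ^ m * invFact m + A * (h * h ^ m)
            ≈⟨ solve 5 (λ c p f A h → con ℤ.0ℤ :+ c :* p :* f :+ A :* (h :* p) := p :* (c :* f :+ A :* h)) refl (c m) (h ^ m) (invFact m) A h ⟩
          h ^ m * (c m * invFact m + A * h) ∎)))
        where
        open ≤-Reasoning
        h = half ^ n
        0≤h = half^-nonneg n
        h≤1 : ∣ h ∣ ≤ ι 1
        h≤1 = ∣nonneg∣ 0≤h (≤-trans (half^-antimono {0} {n} z≤n) (≤-reflexive (sym (+-identityʳ 1#))))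

-- The Riemann integral of an entire function.

module Integral (em : ExcludedMiddle 0ℓ) (ℝ : CompleteOrderedField) where
  open CompleteOrderedField ℝ
  open Analysis em ℝ
  open OrderedField em ℝ
  open Series em ℝ
  open PowerSeries em ℝ

  antiderivative : Seq → Seq
  antiderivative c zero    = 0#
  antiderivative c (suc k) = c k

  -- The rate becomes M + 1 because the index moves by one: with rate 0 the coefficient c 0, now at
  -- index 1, would be bounded by 0.
  dom-antiderivative : ∀ {C M c} → Dom C M c → Dom C (suc M) (antiderivative c)
  dom-antiderivative {C} {M} p = dom λ where
    zero    → ∣0∣≤ (*-nonneg (dom-nonneg p) 0≤1)
    (suc k) → ≤-trans (bound (dom-weaken ≤-refl (ℕ.n≤1+n M) p) k)
      (*-monoˡ-≤ (dom-nonneg p) (≤-respˡ (*-identityˡ _)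
        (*-monoʳ-≤ (^-nonneg k (ι-nonneg (suc M))) (≤+nonneg (ι-nonneg M)))))

  tame-antiderivative : ∀ {c} → Tame c → Tame (antiderivative c)
  tame-antiderivative (C , M , p) = C , suc M , dom-antiderivative p

  module _ {t} (0≤t : 0# ≤ t) where
    private
      mesh : ℕ → Carrier
      mesh n = t * ι (suc n) ⁻¹

      mesh-nonneg : ∀ n → 0# ≤ mesh n
      mesh-nonneg n = *-nonneg 0≤t (⁻¹-nonneg (ι-pos n))

      ι*mesh : ∀ n → ι (suc n) * mesh n ≈ t
      ι*mesh n = trans (solve 3 (λ a t b → a :* (t :* b) := t :* (a :* b)) refl _ t _)
        (trans (*-congˡ (⁻¹-inverseʳ _ (pos⇒≉0 (ι-pos n)))) (*-identityʳ t))

      uniform : ℕ → TaggedPartition 0# t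
      uniform n = record
        { pieces    = suc n
        ; point     = λ i → ι (toℕ i) * mesh n
        ; tag       = λ i → ι (toℕ i) * mesh n
        ; point-0   = zeroˡ _
        ; point-n   = trans (reflexive (≡.cong (λ k → ι k * mesh n) (Fin.toℕ-fromℕ (suc n)))) (ι*mesh n)
        ; left≤tag  = λ i → ≤-reflexive (reflexive (≡.cong (λ k → ι k * mesh n) (Fin.toℕ-inject₁ i)))
        ; tag≤right = λ i → *-monoʳ-≤ (mesh-nonneg n) (ι-mono (ℕ.n≤1+n (toℕ i)))
        }

      length-uniform : ∀ n i → TaggedPartition.length (uniform n) i ≈ mesh n
      length-uniform n i = trans (+-congˡ (-‿cong (reflexive (≡.cong (λ k → ι k * mesh n) (Fin.toℕ-inject₁ i)))))
        (solve 2 (λ k h → (con ℤ.1ℤ :+ k) :* h :- k :* h := h) refl _ _)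

      fine : ∀ {δ} → 0# < δ → ∃ λ N → ∀ n → N ℕ.≤ n → mesh n < δ
      fine {δ} 0<δ = N , λ n N≤n → ≰⇒> λ δ≤mesh → <⇒≱ 0<δ (≤-from (0≤y-x (too-small n N≤n δ≤mesh))
          (solve 2 (λ t d → t :- (t :+ d) := con ℤ.0ℤ :- d) refl t δ))
        where
        -- The added 1 gives (n + 1) δ ≥ t + δ for n ≥ N, so a mesh of at least δ would force t + δ
        -- ≤ t.
        N = proj₁ (archimedean (t * δ ⁻¹ + 1#))
        too-small : ∀ n → N ℕ.≤ n → δ ≤ mesh n → t + δ ≤ t
        too-small n N≤n q = begin
          t + δ                     ≈⟨ +-cong (sym (trans (*-assoc _ _ _) (trans (*-congˡ (⁻¹-inverseˡ δ (pos⇒≉0 0<δ))) (*-identityʳ t)))) (sym (*-identityˡ δ)) ⟩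
          t * δ ⁻¹ * δ + 1# * δ     ≈⟨ distribʳ _ _ _ ⟨
          (t * δ ⁻¹ + 1#) * δ       ≤⟨ *-monoʳ-≤ (<⇒≤ 0<δ) (≤-trans (proj₂ (archimedean (t * δ ⁻¹ + 1#))) (ι-mono (ℕ.≤-trans N≤n (ℕ.n≤1+n n)))) ⟩
          ι (suc n) * δ             ≤⟨ *-monoˡ-≤ (ι-nonneg (suc n)) q ⟩
          ι (suc n) * mesh n        ≈⟨ ι*mesh n ⟩
          t                         ∎
          where open ≤-Reasoning

    -- The definition determines its value only if tagged partitions of every fineness exist. The
    -- uniform ones serve, and one of them is fine enough for both candidates.
    integral-unique : ∀ {g l l′} → HasIntegral 0# t g l → HasIntegral 0# t g l′ → l ≈ l′
    integral-unique {g} {l} {l′} p q = ≈-limit 2# near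
      where
      near : ∀ n → ∣ l - l′ ∣ ≤ 2# * half ^ n
      near n = ≤-respʳ (solve 1 (λ e → e :+ e := (con ℤ.1ℤ :+ con ℤ.1ℤ) :* e) refl (half ^ n))
        (∣∣-triangle (∣-∣-sym (<⇒≤ (proj₂ (proj₂ pδ) (uniform N) (λ i → ≤-<-trans (≤-reflexive (length-uniform N i)) (proj₂ Np N (ℕ.m≤m⊔n _ _))))))
                     (<⇒≤ (proj₂ (proj₂ qδ) (uniform N) (λ i → ≤-<-trans (≤-reflexive (length-uniform N i)) (proj₂ Nq N (ℕ.m≤n⊔m _ _))))))
        where
        pδ = p (half ^ n) (^-pos n 0<half)
        qδ = q (half ^ n) (^-pos n 0<half)
        Np = fine (proj₁ (proj₂ pδ))
        Nq = fine (proj₁ (proj₂ qδ))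
        N  = proj₁ Np ℕ.⊔ proj₁ Nq

    private
      telescope : ∀ n (F : Fin (suc n) → Carrier) → sum {n} (λ i → F (Fin.suc i) - F (inject₁ i)) ≈ F (fromℕ n) - F Fin.zero
      telescope zero    F = sym (-‿inverseʳ _)
      telescope (suc n) F = trans (+-congˡ (telescope n (F ∘ Fin.suc)))
        (solve 3 (λ a b c → b :- a :+ (c :- b) := c :- a) refl _ _ _)

      sum-bound : ∀ n {f g : Fin n → Carrier} → (∀ i → ∣ f i ∣ ≤ g i) → ∣ sum f ∣ ≤ sum g
      sum-bound zero    p = ∣0∣
      sum-bound (suc n) p = ∣+∣≤ (p Fin.zero) (sum-bound n (p ∘ Fin.suc))

      sum-- : ∀ n (f g : Fin n → Carrier) → sum (λ i → f i - g i) ≈ sum f - sum g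
      sum-- zero    f g = sym (-‿inverseʳ 0#)
      sum-- (suc n) f g = trans (+-congˡ (sum-- n (f ∘ Fin.suc) (g ∘ Fin.suc)))
        (solve 4 (λ a b x y → a :- b :+ (x :- y) := a :+ x :- (b :+ y)) refl _ _ _ _)

      monotone-above : ∀ n (F : Fin (suc n) → Carrier) → (∀ i → F (inject₁ i) ≤ F (Fin.suc i)) → ∀ i → F Fin.zero ≤ F i
      monotone-above n       F p Fin.zero    = ≤-refl
      monotone-above (suc n) F p (Fin.suc i) = ≤-trans (p Fin.zero) (monotone-above n (F ∘ Fin.suc) (λ i → p (Fin.suc i)) i)

      monotone-below : ∀ n (F : Fin (suc n) → Carrier) → (∀ i → F (inject₁ i) ≤ F (Fin.suc i)) → ∀ i → F i ≤ F (fromℕ n)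
      monotone-below zero    F p Fin.zero    = ≤-refl
      monotone-below (suc n) F p Fin.zero    = ≤-trans (p Fin.zero) (monotone-below n (F ∘ Fin.suc) (λ i → p (Fin.suc i)) Fin.zero)
      monotone-below (suc n) F p (Fin.suc i) = monotone-below n (F ∘ Fin.suc) (λ i → p (Fin.suc i)) i

    -- On each piece, expand the antiderivative F at the tag towards both end points, so with one
    -- increment ≤ 0 and one ≥ 0. The linear terms combine to g(tag) · length, with an error of at
    -- most 2A length² ≤ 2A η length. The increments of F telescope, and the errors add up to at
    -- most 2A η t.
    hasIntegral-antiderivative : ∀ {c g} → Tame c → (∀ s → 0# ≤ s → s ≤ t → g s ≈ value c s) →
                                 HasIntegral 0# t g (value (antiderivative c) t)
    hasIntegral-antiderivative {c} {g} tc g≈ ε 0<ε = η , 0<η , close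
      where
      F : Carrier → Carrier
      F = value (antiderivative c)
      tF = tame-antiderivative tc
      T = suc (magnitude t)
      t≤T : t ≤ ι T
      t≤T = ≤-trans (x≤∣x∣ t) (≤-trans (∣∣≤magnitude t) (ι-mono (ℕ.n≤1+n (magnitude t))))
      A   = proj₁ (taylor₂ tF T (s≤s z≤n))
      0≤A = proj₁ (proj₂ (taylor₂ tF T (s≤s z≤n)))
      est = proj₂ (proj₂ (taylor₂ tF T (s≤s z≤n)))
      -- The summand 1 keeps N positive and makes the total error 2A t ε / N strictly less than ε.
      N = (A + A) * t + 1#
      0<N : 0# < N
      0<N = <-≤-trans 0<1 (≤-respʳ (+-comm 1# _) (≤+nonneg (*-nonneg (+-nonneg 0≤A 0≤A) 0≤t)))
      η = ε * N ⁻¹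
      0<η = *-pos 0<ε (⁻¹-pos 0<N)
      close : ∀ (π : TaggedPartition 0# t) → let open TaggedPartition π in
              (∀ i → length i < η) → ∣ riemannSum g - F t ∣ < ε
      close π short = ≤-<-trans (∣∣≤-cong total (≤-trans (sum-bound pieces piece) (≤-reflexive sumUp))) final
        where
        open TaggedPartition π
        step : ∀ i → point (inject₁ i) ≤ point (Fin.suc i)
        step i = ≤-trans (left≤tag i) (tag≤right i)
        0≤point : ∀ i → 0# ≤ point i
        0≤point i = ≤-respˡ point-0 (monotone-above pieces point step i)
        point≤t : ∀ i → point i ≤ t
        point≤t i = ≤-respʳ point-n (monotone-below pieces point step i)
        0≤length : ∀ i → 0# ≤ length i
        0≤length i = 0≤y-x (step i)
        piece : ∀ i → ∣ g (tag i) * length i - (F (point (Fin.suc i)) - F (point (inject₁ i))) ∣ ≤ (A + A) * η * length i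
        piece i = ≤-trans (∣∣≤-cong e (∣-∣≤ (half-piece a 0≤a a≤len a≤t) (half-piece′ b 0≤b b≤len b≤t)))
            (≤-trans (≤-reflexive (solve 2 (λ A l → A :* (l :* l) :+ A :* (l :* l) := (A :+ A) :* l :* l) refl A (length i)))
              (*-monoʳ-≤ (0≤length i) (*-monoˡ-≤ (+-nonneg 0≤A 0≤A) (<⇒≤ (short i)))))
          where
          r = point (Fin.suc i)
          l = point (inject₁ i)
          s = tag i
          a = l - s
          b = r - s
          0≤s = ≤-trans (0≤point (inject₁ i)) (left≤tag i)
          s≤t = ≤-trans (tag≤right i) (point≤t (Fin.suc i))
          0≤a : a ≤ 0#
          0≤a = ≤-from (0≤y-x (left≤tag i)) (solve 2 (λ l s → s :- l := con ℤ.0ℤ :- (l :- s)) refl l s)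
          0≤b : 0# ≤ b
          0≤b = 0≤y-x (tag≤right i)
          a≤len : - a ≤ length i
          a≤len = ≤-from 0≤b (solve 3 (λ l s r → r :- s := r :- l :- :- (l :- s)) refl l s r)
          b≤len : b ≤ length i
          b≤len = ≤-from (0≤y-x (left≤tag i)) (solve 3 (λ l s r → s :- l := r :- l :- (r :- s)) refl l s r)
          ∣s∣≤T : ∣ s ∣ ≤ ι T
          ∣s∣≤T = ∣nonneg∣ 0≤s (≤-trans s≤t t≤T)
          len≤T : length i ≤ ι T
          len≤T = ≤-trans (≤-from (+-nonneg (0≤y-x (point≤t (Fin.suc i))) (0≤point (inject₁ i)))
                    (solve 3 (λ t r l → t :- r :+ l := t :- (r :- l)) refl t r l)) t≤T
          a≤t : ∣ a ∣ ≤ ι T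
          a≤t = ∣∣-lub (≤-trans 0≤a (ι-nonneg T)) (≤-trans a≤len len≤T)
          b≤t : ∣ b ∣ ≤ ι T
          b≤t = ∣nonneg∣ 0≤b (≤-trans b≤len len≤T)
          square≤ : ∀ {h} → 0# ≤ h → h ≤ length i → h ^ 2 ≤ length i * length i
          square≤ p q = ≤-respˡ (solve 1 (λ h → h :* h := h :^ 2) refl _) (*-mono-≤ p q p q)
          half-piece : ∀ h → h ≤ 0# → - h ≤ length i → ∣ h ∣ ≤ ι T →
                       ∣ F (h + s) - (F s + h * value c s) ∣ ≤ A * (length i * length i)
          half-piece h p q r = ≤-trans (est s h ∣s∣≤T r) (*-monoˡ-≤ 0≤A
            (≤-respˡ (solve 1 (λ h → (:- h) :^ 2 := h :^ 2) refl h) (square≤ (≤-respˡ R.-0#≈0# (neg-antimono p)) q)))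
          half-piece′ : ∀ h → 0# ≤ h → h ≤ length i → ∣ h ∣ ≤ ι T →
                        ∣ F (h + s) - (F s + h * value c s) ∣ ≤ A * (length i * length i)
          half-piece′ h p q r = ≤-trans (est s h ∣s∣≤T r) (*-monoˡ-≤ 0≤A (square≤ p q))
          back : ∀ x → F (x - s + s) ≈ F x
          back x = value-congʳ tF (solve 2 (λ x s → x :- s :+ s := x) refl x s)
          e : F (a + s) - (F s + a * value c s) - (F (b + s) - (F s + b * value c s)) ≈ g s * length i - (F r - F l)
          e = begin-equality
            F (a + s) - (F s + a * value c s) - (F (b + s) - (F s + b * value c s))
              ≈⟨ +-cong (+-cong (back l) (-‿cong (+-congˡ (*-congˡ (sym (g≈ s 0≤s s≤t))))))
                        (-‿cong (+-cong (back r) (-‿cong (+-congˡ (*-congˡ (sym (g≈ s 0≤s s≤t))))))) ⟩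
            F l - (F s + a * g s) - (F r - (F s + b * g s))
              ≈⟨ solve 7 (λ fl fs fr l r s g → fl :- (fs :+ (l :- s) :* g) :- (fr :- (fs :+ (r :- s) :* g)) := g :* (r :- l) :- (fr :- fl))
                   refl (F l) (F s) (F r) l r s (g s) ⟩
            g s * length i - (F r - F l) ∎
            where open ≤-Reasoning
        total : sum (λ i → g (tag i) * length i - (F (point (Fin.suc i)) - F (point (inject₁ i)))) ≈ riemannSum g - F t
        total = trans (sum-- pieces (λ i → g (tag i) * length i) _) (+-congˡ (-‿cong (trans (telescope pieces (F ∘ point))
          (trans (+-cong (value-congʳ tF point-n) (-‿cong (value-0 tF point-0))) (solve 1 (λ x → x :- con ℤ.0ℤ := x) refl _)))))
        sumUp : sum (λ i → (A + A) * η * length i) ≈ (A + A) * η * t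
        sumUp = trans (sym (Sum.*-distribˡ-sum _ length)) (*-congˡ (trans (telescope pieces point)
          (trans (+-cong point-n (-‿cong point-0)) (solve 1 (λ x → x :- con ℤ.0ℤ := x) refl _))))
        final : (A + A) * η * t < ε
        final = ≰⇒> λ ε≤ → <⇒≱ 0<η (≤-from (0≤y-x ε≤) (trans (+-congˡ (-‿cong ε≈))
          (solve 3 (λ d A t → A :* d :* t :- d :* (A :* t :+ con ℤ.1ℤ) := con ℤ.0ℤ :- d) refl η (A + A) t)))
          where
          ε≈ : ε ≈ η * N
          ε≈ = sym (trans (*-assoc _ _ _) (trans (*-congˡ (⁻¹-inverseˡ N (pos⇒≉0 0<N))) (*-identityʳ ε)))

    ∫-value : ∀ {c g} → Tame c → (∀ s → 0# ≤ s → s ≤ t → g s ≈ value c s) → ∫ 0# t g ≈ value (antiderivative c) t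
    ∫-value {c} {g} tc g≈ = integral-unique {g} (the-satisfies (HasIntegral 0# t g) (_ , p)) p
      where p = hasIntegral-antiderivative tc g≈

-- Entire families of functions of time.

module Curves (em : ExcludedMiddle 0ℓ) (ℝ : CompleteOrderedField) where
  open CompleteOrderedField ℝ
  open Analysis em ℝ
  open OrderedField em ℝ
  open Series em ℝ
  open Fubini em ℝ
  open PowerSeries em ℝ
  open Integral em ℝ

  -- A function of time with values in A → ℝ, given by its Taylor coefficients
  -- (without the factorials), which grow at most geometrically, uniformly in A.
  record Curve (A : Set) : Set where
    field
      coef      : A → Seq
      size      : Carrier
      rate      : ℕ
      dominated : ∀ x → Dom size rate (coef x)

    tame : ∀ x → Tame (coef x)
    tame x = size , rate , dominated x

  open Curve public

  module _ {A : Set} where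
    infixl 6 _⊕_
    infixl 7 _⊛_

    at : Curve A → Carrier → A → Carrier
    at F s x = value (coef F x) s

    _⊕_ : Curve A → Curve A → Curve A
    F ⊕ G = record
      { coef      = λ x k → coef F x k + coef G x k
      ; size      = size F + size G
      ; rate      = rate F ℕ.+ rate G
      ; dominated = λ x → proj₂ (proj₂ (tame-+ (tame F x) (tame G x)))
      }

    scale : Carrier → Curve A → Curve A
    scale a F = record
      { coef      = λ x k → a * coef F x k
      ; size      = ∣ a ∣ * size F
      ; rate      = rate F
      ; dominated = λ x → dom-* ≤-refl (dominated F x)
      }

    _⊛_ : Curve A → Curve A → Curve A
    F ⊛ G = record
      { coef      = λ x → coef F x ⊗ coef G x
      ; size      = size F * size G
      ; rate      = (rate F ℕ.+ rate G) ℕ.+ (rate F ℕ.+ rate G)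
      ; dominated = λ x → dom-diag (dom₂-outer (dominated F x) (dominated G x))
      }

    ∂ : Curve A → Curve A
    ∂ F = record
      { coef      = λ x k → coef F x (suc k)
      ; size      = size F * ι (rate F) ^ 1
      ; rate      = rate F
      ; dominated = λ x → dom-shift (dominated F x) 1
      }

    integrate : Curve A → Curve A
    integrate F = record
      { coef      = λ x → antiderivative (coef F x)
      ; size      = size F
      ; rate      = suc (rate F)
      ; dominated = λ x → dom-antiderivative (dominated F x)
      }

    expCurve : Carrier → Curve A
    expCurve a = record
      { coef      = λ _ → a ^_
      ; size      = 1#
      ; rate      = magnitude a
      ; dominated = λ _ → dom λ k → ≤-respʳ (sym (*-identityˡ _)) (∣^∣≤ k (∣∣≤magnitude a))
      }

    -- The curve s ↦ F (t - s).
    reflect : Carrier → Curve A → Curve A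
    reflect t F = record
      { coef      = λ x k → (- 1#) ^ k * value (shift k (coef F x)) t
      ; size      = size F * expBound (rate F ℕ.* magnitude t)
      ; rate      = rate F
      ; dominated = λ x → dom λ k → ≤-respʳ
          (trans (*-cong (1^ k) (solve 3 (λ a b c → a :* b :* c := a :* c :* b) refl _ _ _)) (*-identityˡ _))
          (∣*∣≤ (∣^∣≤ k ∣-1∣) (value-bound (magnitude t) (∣∣≤magnitude t) (dom-shift (dominated F x) k)))
      }
      where
      ∣-1∣ : ∣ - 1# ∣ ≤ 1#
      ∣-1∣ = ∣neg∣≤ (∣nonneg∣ 0≤1 ≤-refl)
      1^ : ∀ k → 1# ^ k ≈ 1#
      1^ zero    = refl
      1^ (suc k) = trans (*-identityˡ _) (1^ k)

    module _ (F G : Curve A) (s : Carrier) (x : A) where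
      at-⊕ : at (F ⊕ G) s x ≈ at F s x + at G s x
      at-⊕ = value-+ s (tame F x) (tame G x)

      at-⊛ : at (F ⊛ G) s x ≈ at F s x * at G s x
      at-⊛ = value-⊗ s (tame F x) (tame G x)

    module _ (F : Curve A) where
      at-scale : ∀ a s x → at (scale a F) s x ≈ a * at F s x
      at-scale a s x = value-* a s (tame F x)

      at-cong : ∀ {s s′} x → s ≈ s′ → at F s x ≈ at F s′ x
      at-cong x = value-congʳ (tame F x)

      at-0 : ∀ {s} x → s ≈ 0# → at F s x ≈ coef F x 0
      at-0 x = value-0 (tame F x)

      at-coef-0 : ∀ x → coef F x 0 ≈ at F 0# x
      at-coef-0 x = sym (at-0 x refl)

      at-bounded : ∀ s → ∃ λ b → ∀ x → ∣ at F s x ∣ ≤ b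
      at-bounded s = _ , λ x → value-bound (magnitude s) (∣∣≤magnitude s) (dominated F x)

      -- Taylor expansion of F at t with increment -s; the signs in `reflect` come from the powers
      -- of -s.
      at-reflect : ∀ t s x → at (reflect t F) s x ≈ at F (t - s) x
      at-reflect t s x = sym (begin-equality
        value (coef F x) (t - s)                                      ≈⟨ at-cong x (+-comm t (- s)) ⟩
        value (coef F x) (- s + t)                                    ≈⟨ value-shift (- s) t (tame F x) ⟩
        egf (λ k → value (shift k (coef F x)) t * (- s) ^ k)          ≈⟨ egf-cong (tame-cong (λ k → sym (e k)) (tame-power s (tame (reflect t F) x))) e ⟩
        value (coef (reflect t F) x) s                                ∎)
        where
        open ≤-Reasoning
        e : ∀ k → value (shift k (coef F x)) t * (- s) ^ k ≈ coef (reflect t F) x k * s ^ k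
        e k = trans (*-congˡ (trans (^-cong k (solve 1 (λ s → :- s := (:- con ℤ.1ℤ) :* s) refl s)) (Exp.^-distrib-* (- 1#) s k)))
          (solve 3 (λ v m s → v :* (m :* s) := m :* v :* s) refl _ _ _)

      curve-mono : ∀ {t} x → 0# ≤ t → (∀ s → 0# ≤ s → s ≤ t → 0# ≤ at (∂ F) s x) → at F 0# x ≤ at F t x
      curve-mono x 0≤t p = ≤-respˡ (at-coef-0 x) (derivative-nonneg⇒≤ (tame F x) 0≤t p)

      curve-constant : ∀ t x → (∀ k → coef F x (suc k) ≈ 0#) → at F t x ≈ coef F x 0
      curve-constant t x z = begin-equality
        egf (λ k → coef F x k * t ^ k)  ≈⟨ egf-cong (tame-power t (tame F x)) e ⟩
        egf (λ k → coef F x 0 * δ 0 k)  ≈⟨ egf-* (coef F x 0) (tame-δ 0) ⟩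
        coef F x 0 * egf (δ 0)          ≈⟨ *-congˡ (trans (egf-δ 0) invFact-0) ⟩
        coef F x 0 * 1#                 ≈⟨ *-identityʳ _ ⟩
        coef F x 0                      ∎
        where
        open ≤-Reasoning
        e : ∀ k → coef F x k * t ^ k ≈ coef F x 0 * δ 0 k
        e zero    = refl
        e (suc k) = trans (*-congʳ (z k)) (trans (zeroˡ _) (sym (zeroʳ _)))

      at-integrate-0 : ∀ {s} x → s ≈ 0# → at (integrate F) s x ≈ 0#
      at-integrate-0 x e = value-0 (tame (integrate F) x) e

    at-∂-reflect : ∀ F t s x → at (∂ (reflect t F)) s x ≈ - at (∂ F) (t - s) x
    at-∂-reflect F t s x = trans (egf-cong (tame-power s (tame (∂ (reflect t F)) x)) (λ k → *-congʳ (*-assoc (- 1#) _ _)))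
      (trans (at-scale (reflect t (∂ F)) (- 1#) s x) (trans (*-congˡ (at-reflect (∂ F) t s x)) (R.-1*x≈-x _)))

    -- By the recursion of `diag`, the coefficients of `∂ (F ⊛ G)` are those of `∂ F ⊛ G ⊕ F ⊛ ∂ G`
    -- by computation.
    at-∂⊛ : ∀ F G s x → at (∂ (F ⊛ G)) s x ≈ at (∂ F) s x * at G s x + at F s x * at (∂ G) s x
    at-∂⊛ F G s x = trans (at-⊕ (∂ F ⊛ G) (F ⊛ ∂ G) s x) (+-cong (at-⊛ (∂ F) G s x) (at-⊛ F (∂ G) s x))

    derivative-0⇒constant : ∀ F {t} x → 0# ≤ t → (∀ s → 0# ≤ s → s ≤ t → at (∂ F) s x ≈ 0#) → at F t x ≈ at F 0# x
    derivative-0⇒constant F {t} x 0≤t z = ≤-antisym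
      (≤-from (0≤y-x (curve-mono (scale (- 1#) F) x 0≤t λ s p q → ≤-reflexive (sym (trans (at-scale (∂ F) (- 1#) s x) (trans (*-congˡ (z s p q)) (zeroʳ _))))))
        (trans (+-cong (at-scale F (- 1#) t x) (-‿cong (at-scale F (- 1#) 0# x)))
          (solve 2 (λ a b → (:- con ℤ.1ℤ) :* a :- (:- con ℤ.1ℤ) :* b := b :- a) refl _ _)))
      (curve-mono F x 0≤t λ s p q → ≤-reflexive (sym (z s p q)))

    at-expCurve : ∀ a t x {y} → y ≈ a * t → exp y ≈ at (expCurve a) t x
    at-expCurve a t x e = exp-value a t _ e

    at-∂-expCurve : ∀ a s x → at (∂ (expCurve a)) s x ≈ a * at (expCurve a) s x
    at-∂-expCurve a s x = at-scale (expCurve a) a s x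

    -- In the Taylor expansion at t the k-th derivative is aᵏ times the value at t, since aᵏ⁺ʲ = aᵏ
    -- aʲ.
    expCurve-+ : ∀ a s t x → at (expCurve a) (s + t) x ≈ at (expCurve a) s x * at (expCurve a) t x
    expCurve-+ a s t x = trans (value-shift s t (tame E x)) (trans
        (value-congˡ s (tame-cong (λ k → sym (e k)) (tame-* (at E t x) (tame E x))) e)
        (trans (at-scale E (at E t x) s x) (*-comm _ _)))
      where
      E = expCurve a
      e : ∀ k → value (λ j → a ^ (k ℕ.+ j)) t ≈ at E t x * a ^ k
      e k = trans (value-congˡ t (tame-shift k) (λ j → Exp.^-homo-* a k j)) (trans (at-scale E (a ^ k) t x) (*-comm _ _))
        where
        tame-shift : ∀ k → Tame (shift k (a ^_))
        tame-shift k = _ , _ , dom-shift (dominated E x) k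

    -- By the functional equation the value is the square of the value at s / 2.
    expCurve-nonneg : ∀ a s x → 0# ≤ at (expCurve a) s x
    expCurve-nonneg a s x = ≤-respʳ (trans (solve 1 (λ e → e :^ 2 := e :* e) refl _)
        (trans (sym (expCurve-+ a (half * s) (half * s) x)) (at-cong (expCurve a) x (half-* s))))
      (square-nonneg (at (expCurve a) (half * s) x))

-- The Laplacian on bounded functions and its exponential Q.

module HeatCurves (em : ExcludedMiddle 0ℓ) (ℝ : CompleteOrderedField) (G : WeightedGraph ℝ) where
  open CompleteOrderedField ℝ
  open WeightedGraph G
  open GradientForms ℝ G
  open OrderedField em ℝ
  open Series em ℝ
  open Fubini em ℝ
  open PowerSeries em ℝ
  open Curves em ℝ

  module _ {A : Set} where
    ∑-cong : ∀ (xs : List A) {f g} → (∀ y → y ∈ xs → f y ≈ g y) → ∑ xs f ≈ ∑ xs g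
    ∑-cong []       e = refl
    ∑-cong (x ∷ xs) e = +-cong (e x (here ≡.refl)) (∑-cong xs λ y → e y ∘ there)

    ∑-+ : ∀ (xs : List A) f g → ∑ xs (λ y → f y + g y) ≈ ∑ xs f + ∑ xs g
    ∑-+ []       f g = sym (+-identityʳ 0#)
    ∑-+ (x ∷ xs) f g = trans (+-congˡ (∑-+ xs f g))
      (solve 4 (λ a b x y → a :+ b :+ (x :+ y) := a :+ x :+ (b :+ y)) refl _ _ _ _)

    ∑-* : ∀ (xs : List A) a f → ∑ xs (λ y → a * f y) ≈ a * ∑ xs f
    ∑-* []       a f = sym (zeroʳ a)
    ∑-* (x ∷ xs) a f = trans (+-congˡ (∑-* xs a f)) (sym (distribˡ _ _ _))

    ∑-mono : ∀ (xs : List A) {f g} → (∀ y → f y ≤ g y) → ∑ xs f ≤ ∑ xs g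
    ∑-mono []       p = ≤-refl
    ∑-mono (x ∷ xs) p = +-mono-≤ (p x) (∑-mono xs p)

    ∣∑∣≤ : ∀ (xs : List A) {f g} → (∀ y → ∣ f y ∣ ≤ g y) → ∣ ∑ xs f ∣ ≤ ∑ xs g
    ∣∑∣≤ []       p = ∣0∣
    ∣∑∣≤ (x ∷ xs) p = ∣+∣≤ (p x) (∣∑∣≤ xs p)

    tame-∑ : ∀ (xs : List A) {c : A → Seq} → (∀ y → Tame (c y)) → Tame (λ k → ∑ xs λ y → c y k)
    tame-∑ []       t = tame-0
    tame-∑ (x ∷ xs) t = tame-+ (t x) (tame-∑ xs t)

    value-∑ : ∀ (xs : List A) {c : A → Seq} s → (∀ y → Tame (c y)) →
              value (λ k → ∑ xs λ y → c y k) s ≈ ∑ xs λ y → value (c y) s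
    value-∑ [] s t = trans (value-congˡ s tame-0 (λ k → sym (zeroˡ 0#))) (trans (value-* 0# s tame-0) (zeroˡ _))
    value-∑ (x ∷ xs) s t = trans (value-+ s (t x) (tame-∑ xs t)) (+-congˡ (value-∑ xs s t))

  infix 4 _≗_
  _≗_ : Function → Function → Set
  f ≗ g = ∀ x → f x ≈ g x

  -- A natural upper bound of m / μ. The operator norm of Δ on bounded functions is then at most 2 ·
  -- `degree`, which can serve as the rate of a curve.
  degree : ℕ
  degree = proj₁ (archimedean (proj₁ Dμ-finite))

  μ⁻¹-nonneg : ∀ x → 0# ≤ μ x ⁻¹
  μ⁻¹-nonneg x = ⁻¹-nonneg (μ-positive x)

  m/μ≤degree : ∀ x → μ x ⁻¹ * m x ≤ ι degree
  m/μ≤degree x = ≤-respˡ (*-comm _ _) (≤-trans (proj₂ Dμ-finite x) (proj₂ (archimedean (proj₁ Dμ-finite))))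

  Δ-local : ∀ {f g} x → f x ≈ g x → (∀ y → y ∈ neighbours x → f y ≈ g y) → Δ f x ≈ Δ g x
  Δ-local x e es = *-congˡ (∑-cong (neighbours x) λ y y∈ → *-congˡ (+-cong (es y y∈) (-‿cong e)))

  Δ-cong : ∀ {f g} → f ≗ g → Δ f ≗ Δ g
  Δ-cong e x = Δ-local x (e x) λ y _ → e y

  Δ-+ : ∀ f g x → Δ (λ y → f y + g y) x ≈ Δ f x + Δ g x
  Δ-+ f g x = trans (*-congˡ (trans (∑-cong (neighbours x) (λ y _ →
      solve 5 (λ w a b c d → w :* (a :+ b :- (c :+ d)) := w :* (a :- c) :+ w :* (b :- d)) refl (ω x y) (f y) (g y) (f x) (g x)))
    (∑-+ (neighbours x) _ _))) (distribˡ _ _ _)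

  Δ-* : ∀ a f x → Δ (λ y → a * f y) x ≈ a * Δ f x
  Δ-* a f x = trans (*-congˡ (trans (∑-cong (neighbours x) (λ y _ →
      solve 4 (λ w a b c → w :* (a :* b :- a :* c) := a :* (w :* (b :- c))) refl (ω x y) a (f y) (f x)))
    (∑-* (neighbours x) a _))) (solve 3 (λ m a s → m :* (a :* s) := a :* (m :* s)) refl _ _ _)

  Δ-bound : ∀ {f b} → (∀ x → ∣ f x ∣ ≤ b) → ∀ x → ∣ Δ f x ∣ ≤ b * ι (degree ℕ.+ degree)
  Δ-bound {f} {b} p x = begin
    ∣ Δ f x ∣
      ≤⟨ ∣*∣ˡ≤ (μ⁻¹-nonneg x) (∣∑∣≤ (neighbours x) λ y → ∣*∣≤ (∣nonneg∣ (ω-nonneg x y) ≤-refl) (∣-∣≤ (p y) (p x))) ⟩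
    μ x ⁻¹ * ∑ (neighbours x) (λ y → ω x y * (b + b))
      ≈⟨ *-congˡ (trans (∑-cong (neighbours x) (λ y _ → *-comm _ _)) (∑-* (neighbours x) (b + b) (ω x))) ⟩
    μ x ⁻¹ * ((b + b) * m x)       ≈⟨ solve 3 (λ u b m → u :* ((b :+ b) :* m) := b :* (u :* m :+ u :* m)) refl _ b _ ⟩
    b * (μ x ⁻¹ * m x + μ x ⁻¹ * m x)
      ≤⟨ *-monoˡ-≤ (0≤-bound (p x)) (+-mono-≤ (m/μ≤degree x) (m/μ≤degree x)) ⟩
    b * (ι degree + ι degree)      ≈⟨ *-congˡ (sym (ι-+ degree degree)) ⟩
    b * ι (degree ℕ.+ degree)      ∎
    where open ≤-Reasoning

  Δ̂ : Curve V → Curve V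
  Δ̂ F = record
    { coef      = λ x k → Δ (λ y → coef F y k) x
    ; size      = size F * ι (degree ℕ.+ degree)
    ; rate      = rate F
    ; dominated = λ x → dom λ k → ≤-respʳ (solve 3 (λ a b c → a :* b :* c := a :* c :* b) refl _ _ _)
        (Δ-bound (λ y → bound (dominated F y) k) x)
    }

  at-Δ̂ : ∀ F s x → at (Δ̂ F) s x ≈ Δ (at F s) x
  at-Δ̂ F s x = trans (value-* (μ x ⁻¹) s (tame-∑ (neighbours x) t)) (*-congˡ (trans (value-∑ (neighbours x) s t)
      (∑-cong (neighbours x) λ y _ → trans (value-* (ω x y) s (t′ y)) (*-congˡ (e y)))))
    where
    t′ : ∀ y → Tame (λ k → coef F y k - coef F x k)
    t′ y = tame-cong (λ k → +-congˡ (R.-1*x≈-x _)) (tame-+ (tame F y) (tame-* (- 1#) (tame F x)))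
    t : ∀ y → Tame (λ k → ω x y * (coef F y k - coef F x k))
    t y = tame-* (ω x y) (t′ y)
    e : ∀ y → value (λ k → coef F y k - coef F x k) s ≈ at F s y - at F s x
    e y = trans (value-congˡ s (t′ y) (λ k → +-congˡ (sym (R.-1*x≈-x _))))
      (trans (value-+ s (tame F y) (tame-* (- 1#) (tame F x)))
        (+-congˡ (trans (value-* (- 1#) s (tame F x)) (R.-1*x≈-x _))))

  -- Peeling off the innermost Δ makes the shifted coefficients of `orbit f` those of `orbit (Δ f)`
  -- by computation; likewise in the derivative of `heat`.
  Δ^ : ℕ → Function → Function
  Δ^ zero    f = f
  Δ^ (suc k) f = Δ^ k (Δ f)

  Δ^-cong : ∀ k {f g} → f ≗ g → Δ^ k f ≗ Δ^ k g
  Δ^-cong zero    e = e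
  Δ^-cong (suc k) e = Δ^-cong k (Δ-cong e)

  Δ^-+ : ∀ k f g x → Δ^ k (λ y → f y + g y) x ≈ Δ^ k f x + Δ^ k g x
  Δ^-+ zero    f g x = refl
  Δ^-+ (suc k) f g x = trans (Δ^-cong k (Δ-+ f g) x) (Δ^-+ k (Δ f) (Δ g) x)

  Δ^-* : ∀ k a f x → Δ^ k (λ y → a * f y) x ≈ a * Δ^ k f x
  Δ^-* zero    a f x = refl
  Δ^-* (suc k) a f x = trans (Δ^-cong k (Δ-* a f) x) (Δ^-* k a (Δ f) x)

  Δ^-bound : ∀ k {f b} → (∀ x → ∣ f x ∣ ≤ b) → ∀ x → ∣ Δ^ k f x ∣ ≤ b * ι (degree ℕ.+ degree) ^ k
  Δ^-bound zero    p x = ≤-respʳ (sym (*-identityʳ _)) (p x)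
  Δ^-bound (suc k) p x = ≤-respʳ (*-assoc _ _ _) (Δ^-bound k (Δ-bound p) x)

  orbit : ∀ f → Bounded f → Curve V
  orbit f (b , p) = record
    { coef      = λ x k → Δ^ k f x
    ; size      = b
    ; rate      = degree ℕ.+ degree
    ; dominated = λ x → dom λ k → Δ^-bound k p x
    }

  Q : Carrier → Function → Function
  Q t f x = value (λ k → Δ^ k f x) t

  Q-cong : ∀ t {f g} → Bounded f → f ≗ g → Q t f ≗ Q t g
  Q-cong t bf e x = value-congˡ t (tame (orbit _ bf) x) λ k → Δ^-cong k e x

  bounded-+ : ∀ {f g} → Bounded f → Bounded g → Bounded (λ x → f x + g x)
  bounded-+ (a , p) (b , q) = a + b , λ x → ∣+∣≤ (p x) (q x)

  bounded-* : ∀ a {f} → Bounded f → Bounded (λ x → a * f x)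
  bounded-* a (b , p) = ∣ a ∣ * b , λ x → ∣*∣≤ ≤-refl (p x)

  bounded-⊙ : ∀ {f g} → Bounded f → Bounded g → Bounded (f ⊙ g)
  bounded-⊙ (a , p) (b , q) = a * b , λ x → ∣*∣≤ (p x) (q x)

  bounded-cong : ∀ {f g} → f ≗ g → Bounded f → Bounded g
  bounded-cong e (b , p) = b , λ x → ∣∣≤-cong (e x) (p x)

  bounded-Δ : ∀ {f} → Bounded f → Bounded (Δ f)
  bounded-Δ (b , p) = _ , Δ-bound p

  bounded-const : ∀ a → Bounded (λ _ → a)
  bounded-const a = ∣ a ∣ , λ _ → ≤-refl

  bounded-Q : ∀ t {f} → Bounded f → Bounded (Q t f)
  bounded-Q t bf = at-bounded (orbit _ bf) t

  Q-+ : ∀ t {f g} → Bounded f → Bounded g → ∀ x → Q t (λ y → f y + g y) x ≈ Q t f x + Q t g x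
  Q-+ t bf bg x = trans (value-congˡ t (tame (orbit _ (bounded-+ bf bg)) x) λ k → Δ^-+ k _ _ x)
    (at-⊕ (orbit _ bf) (orbit _ bg) t x)

  Q-* : ∀ t a {f} → Bounded f → ∀ x → Q t (λ y → a * f y) x ≈ a * Q t f x
  Q-* t a bf x = trans (value-congˡ t (tame (orbit _ (bounded-* a bf)) x) λ k → Δ^-* k a _ x)
    (at-scale (orbit _ bf) a t x)

  Q-Δ : ∀ t {f} → Bounded f → ∀ x → Q t (Δ f) x ≈ Δ (Q t f) x
  Q-Δ t {f} bf x = trans (value-congˡ t (tame (orbit _ (bounded-Δ bf)) x) λ k → Δ^-Δ k x) (at-Δ̂ (orbit _ bf) t x)
    where
    Δ^-Δ : ∀ k {f} → Δ^ k (Δ f) ≗ Δ (Δ^ k f)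
    Δ^-Δ zero    x = refl
    Δ^-Δ (suc k) x = Δ^-Δ k x

  -- Δ annihilates constants, so only the zeroth coefficient survives. This conservation of mass is
  -- what Jensen's inequality rests on.
  Q-1 : ∀ t a x → Q t (λ _ → a) x ≈ a
  Q-1 t a x = curve-constant (orbit _ (bounded-const a)) t x λ k → trans (Δ^-cong k (Δ-const a) x) (Δ^-0 k x)
    where
    Δ-const : ∀ b y → Δ (λ _ → b) y ≈ 0#
    Δ-const b y = trans (*-congˡ (trans (∑-cong (neighbours y) (λ z _ → trans (*-comm _ _) (*-congʳ (-‿inverseʳ b))))
      (trans (∑-* (neighbours y) 0# (ω y)) (zeroˡ _)))) (zeroʳ _)
    Δ^-0 : ∀ k x → Δ^ k (λ _ → 0#) x ≈ 0#
    Δ^-0 zero    x = refl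
    Δ^-0 (suc k) x = trans (Δ^-cong k (Δ-const 0#) x) (Δ^-0 k x)

  private
    -- Δ + D preserves nonnegativity, and e^{tΔ} = e^{-tD} e^{t(Δ + D)}.
    D : Carrier
    D = ι degree

    L : Function → Function
    L f x = Δ f x + D * f x

    L^ : ℕ → Function → Function
    L^ zero    f = f
    L^ (suc k) f = L^ k (L f)

    -- The only negative contribution to Δ f x is -(m x / μ x) f x, and D f x outweighs it.
    L-nonneg : ∀ {f} → (∀ x → 0# ≤ f x) → ∀ x → 0# ≤ L f x
    L-nonneg {f} p x = begin
      0#                                                       ≤⟨ *-nonneg (0≤y-x (m/μ≤degree x)) (p x) ⟩
      (D - μ x ⁻¹ * m x) * f x                                 ≈⟨ solve 4 (λ D u m f → (D :- u :* m) :* f := u :* (:- f :* m) :+ D :* f) refl D (μ x ⁻¹) (m x) (f x) ⟩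
      μ x ⁻¹ * (- f x * m x) + D * f x                         ≈⟨ +-congʳ (*-congˡ (sym (∑-* (neighbours x) (- f x) (ω x)))) ⟩
      μ x ⁻¹ * ∑ (neighbours x) (λ y → - f x * ω x y) + D * f x
        ≤⟨ +-mono-≤ (*-monoˡ-≤ (μ⁻¹-nonneg x) (∑-mono (neighbours x) λ y →
             ≤-from (*-nonneg (ω-nonneg x y) (p y)) (solve 3 (λ w a b → w :* a := w :* (a :- b) :- (:- b) :* w) refl (ω x y) (f y) (f x)))) ≤-refl ⟩
      L f x ∎
      where open ≤-Reasoning

    L^-nonneg : ∀ k {f} → (∀ x → 0# ≤ f x) → ∀ x → 0# ≤ L^ k f x
    L^-nonneg zero    p = p
    L^-nonneg (suc k) p = L^-nonneg k (L-nonneg p)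

    L^-bound : ∀ k {f b} → (∀ x → ∣ f x ∣ ≤ b) → ∀ x → ∣ L^ k f x ∣ ≤ b * ι (degree ℕ.+ degree ℕ.+ degree) ^ k
    L^-bound zero    p x = ≤-respʳ (sym (*-identityʳ _)) (p x)
    L^-bound (suc k) {f} {b} p x = ≤-respʳ (*-assoc _ _ _) (L^-bound k L-bound x)
      where
      L-bound : ∀ y → ∣ L f y ∣ ≤ b * ι (degree ℕ.+ degree ℕ.+ degree)
      L-bound y = ≤-respʳ (trans (+-congˡ (*-comm _ _)) (trans (sym (distribˡ b _ _)) (*-congˡ (sym (ι-+ (degree ℕ.+ degree) degree)))))
        (∣+∣≤ (Δ-bound p y) (∣*∣ˡ≤ (ι-nonneg degree) (p y)))

    orbitL : ∀ f → Bounded f → Curve V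
    orbitL f (b , p) = record
      { coef      = λ x k → L^ k f x
      ; size      = b
      ; rate      = degree ℕ.+ degree ℕ.+ degree
      ; dominated = λ x → dom λ k → L^-bound k p x
      }

    -- The binomial expansion of Δᵏ = (-D + L)ᵏ. The scalar -D commutes with L, so the powers sort
    -- into a diagonal sum.
    factor : ∀ k f x → diag (λ i j → (- D) ^ i * L^ j f x) k ≈ Δ^ k f x
    factor zero    f x = *-identityˡ _
    factor (suc k) f x = begin-equality
      diag (λ i j → - D * (- D) ^ i * L^ j f x) k + diag (λ i j → (- D) ^ i * L^ j (L f) x) k
        ≈⟨ +-cong (trans (diag-cong (λ i j → *-assoc _ _ _) k) (trans (diag-* (- D) _ k) (*-congˡ (factor k f x)))) (factor k (L f) x) ⟩
      - D * Δ^ k f x + Δ^ k (L f) x                       ≈⟨ +-congˡ (trans (Δ^-+ k (Δ f) _ x) (+-congˡ (Δ^-* k D f x))) ⟩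
      - D * Δ^ k f x + (Δ^ k (Δ f) x + D * Δ^ k f x)      ≈⟨ solve 3 (λ D a b → (:- D) :* a :+ (b :+ D :* a) := b) refl D _ _ ⟩
      Δ^ k (Δ f) x                                        ∎
      where open ≤-Reasoning

  Q-nonneg : ∀ {t f} → 0# ≤ t → Bounded f → (∀ x → 0# ≤ f x) → ∀ x → 0# ≤ Q t f x
  Q-nonneg {t} {f} 0≤t bf p x = ≤-respʳ
    (trans (sym (at-⊛ (expCurve (- D)) (orbitL f bf) t x))
      (value-congˡ t (tame (expCurve (- D) ⊛ orbitL f bf) x) λ k → factor k f x))
    (*-nonneg (expCurve-nonneg (- D) t x) (value-nonneg (tame (orbitL f bf) x) 0≤t λ k → L^-nonneg k p x))

  -- The curve s ↦ Q s (F s).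
  heat : Curve V → Curve V
  heat F = record
    { coef      = λ x → diag (λ i j → Δ^ i (λ y → coef F y j) x)
    ; size      = size F
    ; rate      = (rate F ℕ.+ (degree ℕ.+ degree)) ℕ.+ (rate F ℕ.+ (degree ℕ.+ degree))
    ; dominated = λ x → dom-diag (heat-dom₂ x)
    }
    module Heat where
    heat-dom₂ : ∀ x → Dom₂ (size F) (rate F ℕ.+ (degree ℕ.+ degree)) (λ i j → Δ^ i (λ y → coef F y j) x)
    heat-dom₂ x = dom₂ λ i j → ≤-trans (Δ^-bound i (λ y → bound (dominated F y) j) x)
      (≤-trans (≤-reflexive (solve 3 (λ a b c → a :* b :* c := a :* (c :* b)) refl _ _ _))
        (*-monoˡ-≤ (dom-nonneg (dominated F x)) (*-mono-≤
          (^-nonneg i (ι-nonneg (degree ℕ.+ degree))) (^-mono i (ι-nonneg (degree ℕ.+ degree)) (ι-mono (ℕ.m≤n+m (degree ℕ.+ degree) (rate F))))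
          (^-nonneg j (ι-nonneg (rate F))) (^-mono j (ι-nonneg (rate F)) (ι-mono (ℕ.m≤m+n (rate F) (degree ℕ.+ degree)))))))

  -- For fixed i the inner series in j is Δⁱ of the function F s, because Δ is a finite sum at each
  -- vertex. Collecting i and j along diagonals is `value-diag`.
  at-heat : ∀ F s x → at (heat F) s x ≈ Q s (at F s) x
  at-heat F s x = trans (value-diag s (Heat.heat-dom₂ F x))
      (sym (value-congˡ s (tame (orbit _ (at-bounded F s)) x) λ i → sym (inner i F x)))
    where
    inner : ∀ i F x → value (λ j → Δ^ i (λ y → coef F y j) x) s ≈ Δ^ i (at F s) x
    inner zero    F x = refl
    inner (suc i) F x = trans (inner i (Δ̂ F) x) (Δ^-cong i (at-Δ̂ F s) x)

  -- A second Leibniz rule read off from `diag`: the coefficients of `∂ (heat F)` are those of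
  -- `heat (Δ̂ F) ⊕ heat (∂ F)` by computation.
  at-∂-heat : ∀ F s x → at (∂ (heat F)) s x ≈ Q s (λ y → Δ (at F s) y + at (∂ F) s y) x
  at-∂-heat F s x = trans (at-⊕ (heat (Δ̂ F)) (heat (∂ F)) s x)
    (trans (+-cong (trans (at-heat (Δ̂ F) s x) (Q-cong s (at-bounded (Δ̂ F) s) (at-Δ̂ F s) x)) (at-heat (∂ F) s x))
      (sym (Q-+ s (bounded-Δ (at-bounded F s)) (at-bounded (∂ F) s) x)))

  Γ₁-cong : ∀ {f f′ g g′} → f ≗ f′ → g ≗ g′ → Γ₁ f g ≗ Γ₁ f′ g′
  Γ₁-cong e h x = *-congˡ (+-cong (+-cong (Δ-cong (λ y → *-cong (e y) (h y)) x)
    (-‿cong (*-cong (e x) (Δ-cong h x)))) (-‿cong (*-cong (h x) (Δ-cong e x))))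

  bounded-Γ₁ : ∀ {f g} → Bounded f → Bounded g → Bounded (Γ₁ f g)
  bounded-Γ₁ bf bg = bounded-* half (bounded-- (bounded-- (bounded-Δ (bounded-⊙ bf bg)) (bounded-⊙ bf (bounded-Δ bg))) (bounded-⊙ bg (bounded-Δ bf)))
    where
    bounded-- : ∀ {f g} → Bounded f → Bounded g → Bounded (λ x → f x - g x)
    bounded-- (a , p) (b , q) = a + b , λ x → ∣-∣≤ (p x) (q x)

  Γ̂ : Curve V → Curve V → Curve V
  Γ̂ F G = scale half (Δ̂ (F ⊛ G) ⊕ scale (- 1#) (F ⊛ Δ̂ G) ⊕ scale (- 1#) (G ⊛ Δ̂ F))

  private
    at-minus : ∀ (F : Curve V) s x → at (scale (- 1#) F) s x ≈ - at F s x
    at-minus F s x = trans (at-scale F (- 1#) s x) (R.-1*x≈-x _)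

    at-⊛Δ̂ : ∀ F G s x → at (F ⊛ Δ̂ G) s x ≈ at F s x * Δ (at G s) x
    at-⊛Δ̂ F G s x = trans (at-⊛ F (Δ̂ G) s x) (*-congˡ (at-Δ̂ G s x))

    at-Δ̂⊛ : ∀ F G s x → at (Δ̂ (F ⊛ G)) s x ≈ Δ (at F s ⊙ at G s) x
    at-Δ̂⊛ F G s x = trans (at-Δ̂ (F ⊛ G) s x) (Δ-cong (at-⊛ F G s) x)

  at-Γ̂ : ∀ F G s x → at (Γ̂ F G) s x ≈ Γ₁ (at F s) (at G s) x
  at-Γ̂ F G s x = trans (at-scale (Δ̂ (F ⊛ G) ⊕ scale (- 1#) (F ⊛ Δ̂ G) ⊕ scale (- 1#) (G ⊛ Δ̂ F)) half s x) (*-congˡ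
    (trans (at-⊕ (Δ̂ (F ⊛ G) ⊕ scale (- 1#) (F ⊛ Δ̂ G)) (scale (- 1#) (G ⊛ Δ̂ F)) s x)
      (+-cong (trans (at-⊕ (Δ̂ (F ⊛ G)) (scale (- 1#) (F ⊛ Δ̂ G)) s x)
        (+-cong (at-Δ̂⊛ F G s x) (trans (at-minus (F ⊛ Δ̂ G) s x) (-‿cong (at-⊛Δ̂ F G s x)))))
        (trans (at-minus (G ⊛ Δ̂ F) s x) (-‿cong (at-⊛Δ̂ G F s x))))))

  -- The product rule for the bilinear form: each ⊛ splits by the recursion of `diag`, and the six
  -- resulting terms regroup into two gradient forms.
  at-∂-Γ̂ : ∀ F G s x → at (∂ (Γ̂ F G)) s x ≈ Γ₁ (at (∂ F) s) (at G s) x + Γ₁ (at F s) (at (∂ G) s) x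
  at-∂-Γ̂ F G s x = begin-equality
    at (∂ (Γ̂ F G)) s x
      ≈⟨ at-scale (Δ̂ (∂ F ⊛ G ⊕ F ⊛ ∂ G) ⊕ scale (- 1#) (∂ F ⊛ Δ̂ G ⊕ F ⊛ Δ̂ (∂ G)) ⊕ scale (- 1#) (∂ G ⊛ Δ̂ F ⊕ G ⊛ Δ̂ (∂ F))) half s x ⟩
    half * at (Δ̂ (∂ F ⊛ G ⊕ F ⊛ ∂ G) ⊕ scale (- 1#) (∂ F ⊛ Δ̂ G ⊕ F ⊛ Δ̂ (∂ G)) ⊕ scale (- 1#) (∂ G ⊛ Δ̂ F ⊕ G ⊛ Δ̂ (∂ F))) s x
      ≈⟨ *-congˡ (trans (at-⊕ (Δ̂ (∂ F ⊛ G ⊕ F ⊛ ∂ G) ⊕ scale (- 1#) (∂ F ⊛ Δ̂ G ⊕ F ⊛ Δ̂ (∂ G))) (scale (- 1#) (∂ G ⊛ Δ̂ F ⊕ G ⊛ Δ̂ (∂ F))) s x)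
          (+-cong (trans (at-⊕ (Δ̂ (∂ F ⊛ G ⊕ F ⊛ ∂ G)) (scale (- 1#) (∂ F ⊛ Δ̂ G ⊕ F ⊛ Δ̂ (∂ G))) s x)
              (+-cong e₁ (trans (at-minus (∂ F ⊛ Δ̂ G ⊕ F ⊛ Δ̂ (∂ G)) s x) (-‿cong (trans (at-⊕ (∂ F ⊛ Δ̂ G) (F ⊛ Δ̂ (∂ G)) s x) (+-cong (at-⊛Δ̂ (∂ F) G s x) (at-⊛Δ̂ F (∂ G) s x)))))))
            (trans (at-minus (∂ G ⊛ Δ̂ F ⊕ G ⊛ Δ̂ (∂ F)) s x) (-‿cong (trans (at-⊕ (∂ G ⊛ Δ̂ F) (G ⊛ Δ̂ (∂ F)) s x) (+-cong (at-⊛Δ̂ (∂ G) F s x) (at-⊛Δ̂ G (∂ F) s x))))))) ⟩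
    half * (Δ (f′ ⊙ g) x + Δ (f ⊙ g′) x - (f′ x * Δ g x + f x * Δ g′ x) - (g′ x * Δ f x + g x * Δ f′ x))
      ≈⟨ solve 7 (λ h a b c d e k → h :* (a :+ b :- (c :+ d) :- (e :+ k)) := h :* (a :- c :- k) :+ h :* (b :- d :- e)) refl half _ _ _ _ _ _ ⟩
    Γ₁ f′ g x + Γ₁ f g′ x ∎
    where
    open ≤-Reasoning
    f  = at F s
    g  = at G s
    f′ = at (∂ F) s
    g′ = at (∂ G) s
    e₁ : at (Δ̂ (∂ F ⊛ G ⊕ F ⊛ ∂ G)) s x ≈ Δ (f′ ⊙ g) x + Δ (f ⊙ g′) x
    e₁ = trans (at-Δ̂ (∂ F ⊛ G ⊕ F ⊛ ∂ G) s x) (trans (Δ-cong (λ y → trans (at-⊕ (∂ F ⊛ G) (F ⊛ ∂ G) s y)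
      (+-cong (at-⊛ (∂ F) G s y) (at-⊛ F (∂ G) s y))) x) (Δ-+ (f′ ⊙ g) (f ⊙ g′) x))

  expand : List V → List V
  expand xs = xs ++ concatMap neighbours xs

  ball : ℕ → V → List V
  ball zero    x = x ∷ []
  ball (suc k) x = expand (ball k x)

  ball-mono : ∀ {j k} x → j ℕ.≤′ k → ball j x ⊆ ball k x
  ball-mono x (ℕ.≤′-reflexive ≡.refl) y∈ = y∈
  ball-mono x (ℕ.≤′-step p)           y∈ = ∈-++⁺ˡ (ball-mono x p y∈)

  neighbour∈expand : ∀ {x y} xs → x ∈ xs → y ∈ neighbours x → y ∈ expand xs
  neighbour∈expand xs x∈ y∈ = ∈-++⁺ʳ xs (∈-concatMap⁺ neighbours (Any.map (λ { ≡.refl → y∈ }) x∈))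

  Δ-expand : ∀ {f g} xs → (∀ y → y ∈ expand xs → f y ≈ g y) → ∀ y → y ∈ xs → Δ f y ≈ Δ g y
  Δ-expand xs e y y∈ = Δ-local y (e y (∈-++⁺ˡ y∈)) λ z z∈ → e z (neighbour∈expand xs y∈ z∈)

  Δ^-local : ∀ k {f g} x → (∀ y → y ∈ ball k x → f y ≈ g y) → Δ^ k f x ≈ Δ^ k g x
  Δ^-local zero    x e = e x (here ≡.refl)
  Δ^-local (suc k) x e = Δ^-local k x (Δ-expand (ball k x) e)

-- Jensen's inequality, Γ-calculus and the four coefficient functions.

module Curvature (em : ExcludedMiddle 0ℓ) (ℝ : CompleteOrderedField) (G : WeightedGraph ℝ) where
  open CompleteOrderedField ℝ
  open Analysis em ℝ
  open WeightedGraph G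
  open GradientForms ℝ G
  open Coefficients em ℝ
  open OrderedField em ℝ
  open Series em ℝ
  open Fubini em ℝ
  open PowerSeries em ℝ
  open Curves em ℝ
  open HeatCurves em ℝ G

  Q-mono : ∀ {t f g} → 0# ≤ t → Bounded f → Bounded g → (∀ x → f x ≤ g x) → ∀ x → Q t f x ≤ Q t g x
  Q-mono {t} {f} {g} 0≤t bf bg p x = ≤-from (Q-nonneg 0≤t (bounded-+ bg (bounded-* (- 1#) bf)) (λ y → ≤-respʳ (+-congˡ (sym (R.-1*x≈-x _))) (0≤y-x (p y))) x)
    (trans (Q-+ t bg (bounded-* (- 1#) bf) x) (+-congˡ (trans (Q-* t (- 1#) bf x) (R.-1*x≈-x _))))

  -- With a = Q t f x fixed, apply the positive operator to (f - a)² and evaluate at x. As constants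
  -- are preserved, the result is Q t (f²) x - a².
  Q-jensen : ∀ {t f} → 0# ≤ t → Bounded f → ∀ x → Q t f x ^ 2 ≤ Q t (f ⊙ f) x
  Q-jensen {t} {f} 0≤t bf x = ≤-from (Q-nonneg 0≤t (bounded-+ (bounded-+ bff (bounded-* b bf)) (bounded-const (a ^ 2)))
      (λ y → ≤-respʳ (solve 2 (λ a f → (f :- a) :^ 2 := f :* f :+ (:- (a :+ a)) :* f :+ a :^ 2) refl a (f y)) (square-nonneg (f y - a))) x)
    (trans (Q-+ t (bounded-+ bff (bounded-* b bf)) (bounded-const (a ^ 2)) x)
      (trans (+-cong (trans (Q-+ t bff (bounded-* b bf) x) (+-congˡ (Q-* t b bf x))) (Q-1 t (a ^ 2) x))
        (solve 2 (λ s a → s :+ (:- (a :+ a)) :* a :+ a :^ 2 := s :- a :^ 2) refl _ a)))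
    where
    a = Q t f x
    b = - (a + a)
    bff = bounded-⊙ bf bf

  Q-0 : ∀ {f t} → Bounded f → t ≈ 0# → Q t f ≗ f
  Q-0 bf e x = at-0 (orbit _ bf) x e

  Q-congᵗ : ∀ {f s t} → Bounded f → s ≈ t → Q s f ≗ Q t f
  Q-congᵗ bf e x = at-cong (orbit _ bf) x e

  Γ₁-sym : ∀ f g x → Γ₁ f g x ≈ Γ₁ g f x
  Γ₁-sym f g x = *-congˡ (trans (+-congʳ (+-congʳ (Δ-cong (λ y → *-comm _ _) x)))
    (solve 3 (λ a b c → a :- b :- c := a :- c :- b) refl _ _ _))

  Γ₁-*ˡ : ∀ a f g x → Γ₁ (λ y → a * f y) g x ≈ a * Γ₁ f g x
  Γ₁-*ˡ a f g x = trans (*-congˡ (+-cong (+-congʳ (trans (Δ-cong (λ y → *-assoc _ _ _) x) (Δ-* a _ x))) (-‿cong (*-congˡ (Δ-* a f x)))))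
    (solve 7 (λ h a u f dg g df → h :* (a :* u :- a :* f :* dg :- g :* (a :* df)) := a :* (h :* (u :- f :* dg :- g :* df))) refl half a _ _ _ _ _)

  Γ₁-*ʳ : ∀ a f g x → Γ₁ f (λ y → a * g y) x ≈ a * Γ₁ f g x
  Γ₁-*ʳ a f g x = trans (Γ₁-sym f _ x) (trans (Γ₁-*ˡ a g f x) (*-congˡ (Γ₁-sym g f x)))

  2*half* : ∀ x → 2# * (half * x) ≈ x
  2*half* x = trans (solve 2 (λ h x → (con ℤ.1ℤ :+ con ℤ.1ℤ) :* (h :* x) := h :* x :+ h :* x) refl half x) (half-* x)

  Δ-⊙ : ∀ f g x → Δ (f ⊙ g) x ≈ 2# * Γ₁ f g x + f x * Δ g x + g x * Δ f x
  Δ-⊙ f g x = sym (trans (+-congʳ (+-congʳ (2*half* _))) (solve 3 (λ a b c → a :- b :- c :+ b :+ c := a) refl _ _ _))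

  ΔΓ : ∀ f x → Δ (Γ f) x ≈ 2# * Γ₂ f x + 2# * Γ₁ f (Δ f) x
  ΔΓ f x = sym (trans (+-cong (2*half* _) refl) (trans (+-congʳ (+-congˡ (-‿cong (Γ₁-sym (Δ f) f x))))
    (solve 2 (λ a b → a :- b :- b :+ (con ℤ.1ℤ :+ con ℤ.1ℤ) :* b := a) refl _ _)))

  bounded-Γ : ∀ {f} → Bounded f → Bounded (Γ f)
  bounded-Γ bf = bounded-Γ₁ bf bf

  -- The curves (e^{2Kt} - 1) / K and (e^{2Kt} - 1 - 2Kt) / K², given by their Taylor
  -- coefficients, which make sense for K = 0 too.
  expᶜ αᶜ βᶜ : Carrier → Curve V
  expᶜ K = expCurve (2# * K)
  αᶜ K   = integrate (scale 2# (expᶜ K))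
  βᶜ K   = integrate (scale 2# (αᶜ K))

  module _ (K : Carrier) (t : Carrier) (x : V) where
    private
      invFact-1 : invFact 1 ≈ 1#
      invFact-1 = trans (sym (trans (*-congʳ (+-identityʳ 1#)) (*-identityˡ _))) (trans (invFact-suc 0) invFact-0)

      2*invFact-2 : 2# * invFact 2 ≈ 1#
      2*invFact-2 = trans (*-congʳ (+-congˡ (sym (+-identityʳ 1#)))) (trans (invFact-suc 1) invFact-1)

      monomial : ∀ {c} a m → (∀ k → c k * t ^ k ≈ a * δ m k) → value c t ≈ a * invFact m
      monomial {c} a m e = trans (sym (egf-cong (tame-* a (tame-δ m)) (λ k → sym (e k))))
        (trans (egf-* a (tame-δ m)) (*-congˡ (egf-δ m)))

      0-term : ∀ {a b c} → a ≈ 0# → a * b ≈ c * 0#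
      0-term e = trans (*-congʳ e) (trans (zeroˡ _) (sym (zeroʳ _)))

      exp0-suc : ∀ {K} k → K ≈ 0# → 2# * (2# * K) ^ suc k ≈ 0#
      exp0-suc k e = trans (*-congˡ (trans (*-congʳ (trans (*-congˡ e) (zeroʳ 2#))) (zeroˡ _))) (zeroʳ 2#)

    αᶜ-0 : K ≈ 0# → at (αᶜ K) t x ≈ 2# * t
    αᶜ-0 K≈0 = trans (monomial (2# * t) 1 λ where
        zero          → 0-term refl
        (suc zero)    → solve 1 (λ t → (con ℤ.1ℤ :+ con ℤ.1ℤ) :* con ℤ.1ℤ :* (t :* con ℤ.1ℤ) := (con ℤ.1ℤ :+ con ℤ.1ℤ) :* t :* con ℤ.1ℤ) refl t
        (suc (suc k)) → 0-term (exp0-suc k K≈0))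
      (trans (*-congˡ invFact-1) (*-identityʳ _))

    βᶜ-0 : K ≈ 0# → at (βᶜ K) t x ≈ 2# * t ^ 2
    -- Two integrations of twice the curve give the coefficient 2 · 2 at index 2, which the
    -- exponential series divides by 2!.
    βᶜ-0 K≈0 = trans (monomial (2# * 2# * t ^ 2) 2 λ where
        zero                → 0-term refl
        (suc zero)          → 0-term (zeroʳ 2#)
        (suc (suc zero))    → solve 1 (λ t → (con ℤ.1ℤ :+ con ℤ.1ℤ) :* ((con ℤ.1ℤ :+ con ℤ.1ℤ) :* con ℤ.1ℤ) :* (t :* (t :* con ℤ.1ℤ))
                                := (con ℤ.1ℤ :+ con ℤ.1ℤ) :* (con ℤ.1ℤ :+ con ℤ.1ℤ) :* (t :* (t :* con ℤ.1ℤ)) :* con ℤ.1ℤ) refl t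
        (suc (suc (suc k))) → 0-term (trans (*-congˡ (exp0-suc k K≈0)) (zeroʳ 2#)))
      (trans (solve 3 (λ a t f → a :* a :* t :* f := a :* t :* (a :* f)) refl 2# (t ^ 2) (invFact 2)) (trans (*-congˡ 2*invFact-2) (*-identityʳ _)))

    -- The derivative of K α is 2K e^{2Ks}, the same as that of the exponential, so their difference
    -- keeps its initial value -1. No division by K occurs.
    K*αᶜ : 0# ≤ t → K * at (αᶜ K) t x ≈ at (expᶜ K) t x - 1#
    K*αᶜ 0≤t = begin-equality
      K * at (αᶜ K) t x
        ≈⟨ solve 2 (λ a e → a := a :+ (:- con ℤ.1ℤ) :* e :+ e) refl _ (at (expᶜ K) t x) ⟩
      K * at (αᶜ K) t x + - 1# * at (expᶜ K) t x + at (expᶜ K) t x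
        ≈⟨ +-congʳ (trans (sym (at-F t)) (trans (derivative-0⇒constant F x 0≤t z) (trans (at-F 0#)
             (+-cong (*-congˡ (at-integrate-0 (scale 2# (expᶜ K)) x refl)) (*-congˡ (at-0 (expᶜ K) x refl)))))) ⟩
      K * 0# + - 1# * 1# + at (expᶜ K) t x
        ≈⟨ solve 2 (λ K e → K :* con ℤ.0ℤ :+ (:- con ℤ.1ℤ) :* con ℤ.1ℤ :+ e := e :- con ℤ.1ℤ) refl K _ ⟩
      at (expᶜ K) t x - 1# ∎
      where
      open ≤-Reasoning
      F = scale K (αᶜ K) ⊕ scale (- 1#) (expᶜ K)
      at-F : ∀ s → at F s x ≈ K * at (αᶜ K) s x + - 1# * at (expᶜ K) s x
      at-F s = trans (at-⊕ (scale K (αᶜ K)) (scale (- 1#) (expᶜ K)) s x)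
        (+-cong (at-scale (αᶜ K) K s x) (at-scale (expᶜ K) (- 1#) s x))
      z : ∀ s → 0# ≤ s → s ≤ t → at (∂ F) s x ≈ 0#
      z s _ _ = trans (at-⊕ (scale K (scale 2# (expᶜ K))) (scale (- 1#) (∂ (expᶜ K))) s x)
        (trans (+-cong (trans (at-scale (scale 2# (expᶜ K)) K s x) (*-congˡ (at-scale (expᶜ K) 2# s x)))
                       (trans (at-scale (∂ (expᶜ K)) (- 1#) s x) (*-congˡ (at-∂-expCurve (2# * K) s x))))
          (solve 3 (λ K w e → K :* (w :* e) :+ (:- con ℤ.1ℤ) :* (w :* K :* e) := con ℤ.0ℤ) refl K 2# _))

  -- The curve `αᶜ 0#` stands for 2s. The combination K β + 2s - α has derivative 2 (K α + 1 -
  -- e^{2Ks}), which vanishes by `K*αᶜ`, and it starts at 0. Multiplying by K gives the formula.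
  K²*βᶜ : ∀ K {t} x → 0# ≤ t → K ^ 2 * at (βᶜ K) t x ≈ at (expᶜ K) t x - 1# - 2# * K * t
  K²*βᶜ K {t} x 0≤t = begin-equality
    K ^ 2 * at (βᶜ K) t x
      ≈⟨ solve 4 (λ K b a l → K :^ 2 :* b := K :* (K :* b :+ l :+ (:- con ℤ.1ℤ) :* a) :+ K :* a :- K :* l) refl K _ (at (αᶜ K) t x) (at (αᶜ 0#) t x) ⟩
    K * (K * at (βᶜ K) t x + at (αᶜ 0#) t x + - 1# * at (αᶜ K) t x) + K * at (αᶜ K) t x - K * at (αᶜ 0#) t x
      ≈⟨ +-cong (+-cong (*-congˡ (trans (sym (at-F t)) (trans (derivative-0⇒constant F x 0≤t z) (trans (at-F 0#)
           (+-cong (+-cong (*-congˡ (at-integrate-0 (scale 2# (αᶜ K)) x refl)) (at-integrate-0 (scale 2# (expᶜ 0#)) x refl))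
             (*-congˡ (at-integrate-0 (scale 2# (expᶜ K)) x refl))))))) (K*αᶜ K t x 0≤t)) (-‿cong (*-congˡ (αᶜ-0 0# t x refl))) ⟩
    K * (K * 0# + 0# + - 1# * 0#) + (at (expᶜ K) t x - 1#) - K * (2# * t)
      ≈⟨ solve 4 (λ K e w t → K :* (K :* con ℤ.0ℤ :+ con ℤ.0ℤ :+ (:- con ℤ.1ℤ) :* con ℤ.0ℤ) :+ (e :- con ℤ.1ℤ) :- K :* (w :* t) := e :- con ℤ.1ℤ :- w :* K :* t) refl K _ 2# t ⟩
    at (expᶜ K) t x - 1# - 2# * K * t ∎
    where
    open ≤-Reasoning
    F = scale K (βᶜ K) ⊕ αᶜ 0# ⊕ scale (- 1#) (αᶜ K)
    at-F : ∀ s → at F s x ≈ K * at (βᶜ K) s x + at (αᶜ 0#) s x + - 1# * at (αᶜ K) s x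
    at-F s = trans (at-⊕ (scale K (βᶜ K) ⊕ αᶜ 0#) (scale (- 1#) (αᶜ K)) s x)
      (+-cong (trans (at-⊕ (scale K (βᶜ K)) (αᶜ 0#) s x) (+-congʳ (at-scale (βᶜ K) K s x))) (at-scale (αᶜ K) (- 1#) s x))
    z : ∀ s → 0# ≤ s → s ≤ t → at (∂ F) s x ≈ 0#
    z s 0≤s _ = trans (at-⊕ (scale K (scale 2# (αᶜ K)) ⊕ scale 2# (expᶜ 0#)) (scale (- 1#) (scale 2# (expᶜ K))) s x)
      (trans (+-cong (trans (at-⊕ (scale K (scale 2# (αᶜ K))) (scale 2# (expᶜ 0#)) s x)
               (+-cong (trans (at-scale (scale 2# (αᶜ K)) K s x) (trans (*-congˡ (at-scale (αᶜ K) 2# s x)) (solve 3 (λ K w a → K :* (w :* a) := w :* (K :* a)) refl K 2# _)))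
                 (at-scale (expᶜ 0#) 2# s x)))
               (trans (at-scale (scale 2# (expᶜ K)) (- 1#) s x) (*-congˡ (at-scale (expᶜ K) 2# s x))))
        (trans (+-congʳ (+-cong (*-congˡ (K*αᶜ K s x 0≤s)) (*-congˡ (exp0 s 0≤s))))
          (solve 2 (λ w e → w :* (e :- con ℤ.1ℤ) :+ w :* con ℤ.1ℤ :+ (:- con ℤ.1ℤ) :* (w :* e) := con ℤ.0ℤ) refl 2# _)))
      where
      exp0 : ∀ s → 0# ≤ s → at (expᶜ 0#) s x ≈ 1#
      exp0 s 0≤s = trans (solve 1 (λ e → e := e :- con ℤ.1ℤ :+ con ℤ.1ℤ) refl _)
        (trans (+-congʳ (trans (sym (K*αᶜ 0# s x 0≤s)) (zeroˡ _))) (+-identityˡ 1#))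

  exp-expᶜ : ∀ K t x {y} → y ≈ 2# * K * t → exp y ≈ at (expᶜ K) t x
  exp-expᶜ K t x e = at-expCurve (2# * K) t x e

  expᶜ-nonneg : ∀ K t x → 0# ≤ at (expᶜ K) t x
  expᶜ-nonneg K = expCurve-nonneg (2# * K)

  αᶜ-nonneg : ∀ K {t} x → 0# ≤ t → 0# ≤ at (αᶜ K) t x
  αᶜ-nonneg K {t} x 0≤t = ≤-respˡ (at-integrate-0 (scale 2# (expᶜ K)) x refl)
    (curve-mono (αᶜ K) x 0≤t λ s _ _ → ≤-respʳ (sym (at-scale (expᶜ K) 2# s x)) (*-nonneg 0≤2 (expᶜ-nonneg K s x)))

  private
    divide : ∀ {K a b} → ¬ K ≈ 0# → K * a ≈ b → b / K ≈ a
    divide {K} {a} {b} K≉0 e = trans (*-congʳ (sym e)) (trans (solve 3 (λ K a i → K :* a :* i := K :* i :* a) refl K a (K ⁻¹))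
      (trans (*-congʳ (⁻¹-inverseʳ K K≉0)) (*-identityˡ a)))

    square≉0 : ∀ {K} → ¬ K ≈ 0# → ¬ K ^ 2 ≈ 0#
    square≉0 {K} K≉0 e = 0≉1 (sym (begin-equality
      1#                              ≈⟨ *-identityʳ 1# ⟨
      1# * 1#                         ≈⟨ *-cong (⁻¹-inverseʳ K K≉0) (⁻¹-inverseʳ K K≉0) ⟨
      K * K ⁻¹ * (K * K ⁻¹)           ≈⟨ solve 2 (λ K i → K :* i :* (K :* i) := K :^ 2 :* (i :* i)) refl K (K ⁻¹) ⟩
      K ^ 2 * (K ⁻¹ * K ⁻¹)           ≈⟨ trans (*-congʳ e) (zeroˡ _) ⟩
      0#                              ∎))
      where open ≤-Reasoning

    neg-≈0 : ∀ {K} → K ≈ 0# → - K ≈ 0#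
    neg-≈0 e = trans (-‿cong e) R.-0#≈0#

  module _ (K : Carrier) {t : Carrier} (x : V) (0≤t : 0# ≤ t) where
    α⁺≈ : α⁺ K t ≈ at (αᶜ K) t x
    α⁺≈ with em {K ≈ 0#}
    ... | yes K≈0 = sym (αᶜ-0 K t x K≈0)
    ... | no K≉0  = divide K≉0 (trans (K*αᶜ K t x 0≤t) (+-congʳ (sym (exp-expᶜ K t x refl))))

    β⁺≈ : β⁺ K t ≈ at (βᶜ K) t x
    β⁺≈ with em {K ≈ 0#}
    ... | yes K≈0 = sym (βᶜ-0 K t x K≈0)
    ... | no K≉0  = divide (square≉0 K≉0) (trans (K²*βᶜ K x 0≤t) (+-congʳ (+-congʳ (sym (exp-expᶜ K t x refl)))))

    private
      neg-exponent : - (2# * K * t) ≈ 2# * - K * t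
      neg-exponent = solve 3 (λ w K t → :- (w :* K :* t) := w :* (:- K) :* t) refl 2# K t

    α⁻≈ : α⁻ K t ≈ at (αᶜ (- K)) t x
    α⁻≈ with em {K ≈ 0#}
    ... | yes K≈0 = sym (αᶜ-0 (- K) t x (neg-≈0 K≈0))
    ... | no K≉0  = divide K≉0 (trans (solve 2 (λ K a → K :* a := :- ((:- K) :* a)) refl K _)
                      (trans (-‿cong (trans (K*αᶜ (- K) t x 0≤t) (+-congʳ (sym (exp-expᶜ (- K) t x neg-exponent)))))
                        (solve 1 (λ e → :- (e :- con ℤ.1ℤ) := con ℤ.1ℤ :- e) refl _)))

    β⁻≈ : β⁻ K t ≈ at (βᶜ (- K)) t x
    β⁻≈ with em {K ≈ 0#}
    ... | yes K≈0 = sym (βᶜ-0 (- K) t x (neg-≈0 K≈0))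
    ... | no K≉0  = divide (square≉0 K≉0) (trans (solve 2 (λ K a → K :^ 2 :* a := (:- K) :^ 2 :* a) refl K _)
                      (trans (K²*βᶜ (- K) x 0≤t) (trans (+-congʳ (+-congʳ (sym (exp-expᶜ (- K) t x neg-exponent))))
                        (solve 4 (λ e w K t → e :- con ℤ.1ℤ :- w :* (:- K) :* t := e :- con ℤ.1ℤ :+ w :* K :* t) refl _ 2# K t))))

-- From the curvature condition to the semigroup inequalities.

module Flow (em : ExcludedMiddle 0ℓ) (ℝ : CompleteOrderedField) (G : WeightedGraph ℝ) where
  open CompleteOrderedField ℝ
  open WeightedGraph G
  open GradientForms ℝ G
  open OrderedField em ℝ
  open Curves em ℝ
  open HeatCurves em ℝ G
  open Curvature em ℝ G

  module Backward {f : Function} (bf : Bounded f) (t : Carrier) where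
    t-0 : t - 0# ≈ t
    t-0 = trans (+-congˡ R.-0#≈0#) (+-identityʳ t)

    backward : Curve V
    backward = reflect t (orbit f bf)

    g : Carrier → Function
    g = at backward

    g≈ : ∀ s → g s ≗ Q (t - s) f
    g≈ s x = at-reflect (orbit f bf) t s x

    g-0 : g 0# ≗ Q t f
    g-0 x = trans (g≈ 0# x) (Q-congᵗ bf t-0 x)

    g-t : g t ≗ f
    g-t x = trans (g≈ t x) (Q-0 bf (-‿inverseʳ t) x)

    bounded-g : ∀ s → Bounded (g s)
    bounded-g = at-bounded backward

    g′≈-Q : ∀ s → at (∂ backward) s ≗ λ x → - Q (t - s) (Δ f) x
    g′≈-Q s x = at-∂-reflect (orbit f bf) t s x

    g′≈ : ∀ s → at (∂ backward) s ≗ λ x → - 1# * Δ (g s) x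
    g′≈ s x = trans (g′≈-Q s x) (trans (sym (R.-1*x≈-x _)) (*-congˡ (trans (Q-Δ (t - s) bf x) (Δ-cong (λ y → sym (g≈ s y)) x))))

    -- With g s = Q (t - s) f these are s ↦ Q s (Γ (g s)), Q s ((g s)²) and Q s ((Δ (g s))²). The
    -- first two interpolate between applying the semigroup before and after Γ or the square. In Ψ
    -- the factor is the time derivative of g, which is -Δ g; the sign disappears in the square.
    Φ Υ Ψ : Curve V
    Φ = heat (Γ̂ backward backward)
    Υ = heat (backward ⊛ backward)
    Ψ = heat (∂ backward ⊛ ∂ backward)

    at-Φ : ∀ s x → at Φ s x ≈ Q s (Γ (g s)) x
    at-Φ s x = trans (at-heat (Γ̂ backward backward) s x) (Q-cong s (at-bounded (Γ̂ backward backward) s) (at-Γ̂ backward backward s) x)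

    at-Υ : ∀ s x → at Υ s x ≈ Q s (g s ⊙ g s) x
    at-Υ s x = trans (at-heat (backward ⊛ backward) s x) (Q-cong s (at-bounded (backward ⊛ backward) s) (at-⊛ backward backward s) x)

    at-Ψ : ∀ s x → at Ψ s x ≈ Q s (at (∂ backward) s ⊙ at (∂ backward) s) x
    at-Ψ s x = trans (at-heat (∂ backward ⊛ ∂ backward) s x)
      (Q-cong s (at-bounded (∂ backward ⊛ ∂ backward) s) (at-⊛ (∂ backward) (∂ backward) s) x)

    Φ-0 : ∀ x → at Φ 0# x ≈ Γ (Q t f) x
    Φ-0 x = trans (at-Φ 0# x) (trans (Q-0 (bounded-Γ (bounded-g 0#)) refl x) (Γ₁-cong g-0 g-0 x))

    Φ-t : ∀ x → at Φ t x ≈ Q t (Γ f) x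
    Φ-t x = trans (at-Φ t x) (Q-cong t (bounded-Γ (bounded-g t)) (Γ₁-cong g-t g-t) x)

    Υ-0 : ∀ x → at Υ 0# x ≈ Q t f x ^ 2
    Υ-0 x = trans (at-Υ 0# x) (trans (Q-0 (bounded-⊙ (bounded-g 0#) (bounded-g 0#)) refl x)
      (trans (*-cong (g-0 x) (g-0 x)) (solve 1 (λ a → a :* a := a :^ 2) refl _)))

    Υ-t : ∀ x → at Υ t x ≈ Q t (f ⊙ f) x
    Υ-t x = trans (at-Υ t x) (Q-cong t (bounded-⊙ (bounded-g t) (bounded-g t)) (λ y → *-cong (g-t y) (g-t y)) x)

    -- As g' = -Δ g, the bracket in the derivative of `heat` is Δ Γ(g) - 2 Γ(g, Δ g), which is 2
    -- Γ₂(g) by definition.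
    at-∂Φ : ∀ s x → at (∂ Φ) s x ≈ Q s (λ y → 2# * Γ₂ (g s) y) x
    at-∂Φ s x = trans (at-∂-heat (Γ̂ backward backward) s x)
      (Q-cong s (bounded-+ (bounded-Δ (at-bounded (Γ̂ backward backward) s)) (at-bounded (∂ (Γ̂ backward backward)) s)) pointwise x)
      where
      pointwise : (λ y → Δ (at (Γ̂ backward backward) s) y + at (∂ (Γ̂ backward backward)) s y) ≗ λ y → 2# * Γ₂ (g s) y
      pointwise y = begin-equality
        Δ (at (Γ̂ backward backward) s) y + at (∂ (Γ̂ backward backward)) s y
          ≈⟨ +-cong (trans (Δ-cong (at-Γ̂ backward backward s) y) (ΔΓ (g s) y)) (trans (at-∂-Γ̂ backward backward s y)
               (+-cong (trans (Γ₁-cong (g′≈ s) (λ _ → refl) y) (trans (Γ₁-*ˡ (- 1#) (Δ (g s)) (g s) y) (*-congˡ (Γ₁-sym (Δ (g s)) (g s) y))))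
                       (trans (Γ₁-cong (λ _ → refl) (g′≈ s) y) (Γ₁-*ʳ (- 1#) (g s) (Δ (g s)) y)))) ⟩
        2# * Γ₂ (g s) y + 2# * Γ₁ (g s) (Δ (g s)) y + (- 1# * Γ₁ (g s) (Δ (g s)) y + - 1# * Γ₁ (g s) (Δ (g s)) y)
          ≈⟨ solve 2 (λ a b → a :+ (con ℤ.1ℤ :+ con ℤ.1ℤ) :* b :+ ((:- con ℤ.1ℤ) :* b :+ (:- con ℤ.1ℤ) :* b) := a) refl _ _ ⟩
        2# * Γ₂ (g s) y ∎
        where open ≤-Reasoning

    -- Here the bracket is Δ (g²) - 2 g Δ g, which is 2 Γ(g).
    at-∂Υ : ∀ s x → at (∂ Υ) s x ≈ 2# * at Φ s x
    at-∂Υ s x = trans (at-∂-heat (backward ⊛ backward) s x)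
      (trans (Q-cong s (bounded-+ (bounded-Δ (at-bounded (backward ⊛ backward) s)) (at-bounded (∂ (backward ⊛ backward)) s)) pointwise x)
        (trans (Q-* s 2# (bounded-Γ (bounded-g s)) x) (*-congˡ (sym (at-Φ s x)))))
      where
      pointwise : (λ y → Δ (at (backward ⊛ backward) s) y + at (∂ (backward ⊛ backward)) s y) ≗ λ y → 2# * Γ (g s) y
      pointwise y = trans (+-cong (trans (Δ-cong (at-⊛ backward backward s) y) (Δ-⊙ (g s) (g s) y))
          (trans (at-∂⊛ backward backward s y) (+-cong (*-congʳ (g′≈ s y)) (*-congˡ (g′≈ s y)))))
        (solve 3 (λ a g d → a :+ g :* d :+ g :* d :+ ((:- con ℤ.1ℤ) :* d :* g :+ g :* ((:- con ℤ.1ℤ) :* d)) := a) refl _ _ _)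

    -- Q s (Q (t - s) f) = Q t f, since its s-derivative vanishes.
    semigroup : ∀ {s} → 0# ≤ s → ∀ x → Q s (Q (t - s) f) x ≈ Q t f x
    semigroup {s} 0≤s x = begin-equality
      Q s (Q (t - s) f) x      ≈⟨ Q-cong s (bounded-g s) (g≈ s) x ⟨
      Q s (g s) x              ≈⟨ at-heat backward s x ⟨
      at (heat backward) s x   ≈⟨ derivative-0⇒constant (heat backward) x 0≤s (λ r _ _ → trans (at-∂-heat backward r x)
                                    (trans (Q-cong r (bounded-+ (bounded-Δ (bounded-g r)) (at-bounded (∂ backward) r))
                                             (λ y → trans (+-congˡ (trans (g′≈ r y) (R.-1*x≈-x _))) (-‿inverseʳ _)) x) (Q-1 r 0# x))) ⟩
      at (heat backward) 0# x  ≈⟨ trans (at-heat backward 0# x) (Q-0 (bounded-g 0#) refl x) ⟩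
      g 0# x                   ≈⟨ g-0 x ⟩
      Q t f x                  ∎
      where open ≤-Reasoning

    at-Ψ-Q : ∀ s x → at Ψ s x ≈ Q s (Q (t - s) (Δ f) ⊙ Q (t - s) (Δ f)) x
    at-Ψ-Q s x = trans (at-Ψ s x) (Q-cong s (bounded-⊙ (at-bounded (∂ backward) s) (at-bounded (∂ backward) s))
      (λ y → trans (*-cong (g′≈-Q s y) (g′≈-Q s y)) (solve 1 (λ a → (:- a) :* (:- a) := a :* a) refl _)) x)

  -- Jensen for Q s, followed by the semigroup law for Δ f. The bound does not involve s, so (P_t Δ
  -- f)² can be drawn out of time integrals.
  jensen-Ψ : ∀ {f} (bf : Bounded f) t {s} → 0# ≤ s → ∀ x → Q t (Δ f) x ^ 2 ≤ at (Backward.Ψ bf t) s x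
  jensen-Ψ {f} bf t {s} 0≤s x = ≤-respˡ (^-cong 2 (Backward.semigroup (bounded-Δ bf) t 0≤s x))
    (≤-respʳ (sym (Backward.at-Ψ-Q bf t s x)) (Q-jensen 0≤s (bounded-Q (t - s) (bounded-Δ bf)) x))

  module Forward {n K : Carrier} (0<n : 0# < n) (cd : CD n (- K)) {f : Function} (bf : Bounded f) {t : Carrier} (0≤t : 0# ≤ t) where
    open Backward bf t

    -- Twice the condition CD(n, -K) for the function g s, averaged by the order-preserving operator
    -- Q s.
    curvature : ∀ {s} x → 0# ≤ s → 2# * n ⁻¹ * at Ψ s x - 2# * K * at Φ s x ≤ at (∂ Φ) s x
    curvature {s} x 0≤s = begin
      2# * n ⁻¹ * at Ψ s x - 2# * K * at Φ s x
        ≈⟨ +-cong (*-congˡ (at-Ψ s x)) (trans (-‿cong (*-congˡ (at-Φ s x))) (R.-‿distribˡ-* _ _)) ⟩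
      2# * n ⁻¹ * Q s (g′ ⊙ g′) x + - (2# * K) * Q s (Γ (g s)) x
        ≈⟨ trans (Q-+ s (bounded-* _ bg′²) (bounded-* _ bΓ) x) (+-cong (Q-* s _ bg′² x) (Q-* s _ bΓ x)) ⟨
      Q s (λ y → 2# * n ⁻¹ * (g′ y * g′ y) + - (2# * K) * Γ (g s) y) x
        ≤⟨ Q-mono 0≤s (bounded-+ (bounded-* _ bg′²) (bounded-* _ bΓ)) (bounded-* 2# bΓ₂) pointwise x ⟩
      Q s (λ y → 2# * Γ₂ (g s) y) x
        ≈⟨ at-∂Φ s x ⟨
      at (∂ Φ) s x ∎
      where
      open ≤-Reasoning
      g′ = at (∂ backward) s
      bg′² : Bounded (g′ ⊙ g′)
      bg′² = bounded-⊙ (at-bounded (∂ backward) s) (at-bounded (∂ backward) s)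
      bΓ : Bounded (Γ (g s))
      bΓ = bounded-Γ (bounded-g s)
      bΓ₂ : Bounded (Γ₂ (g s))
      bΓ₂ = bounded-cong (λ y → solve 4 (λ h a b c → h :* (a :+ (:- con ℤ.1ℤ) :* b :+ (:- con ℤ.1ℤ) :* c) := h :* (a :- b :- c)) refl half _ _ _)
        (bounded-* half (bounded-+ (bounded-+ (bounded-Δ bΓ) (bounded-* (- 1#) (bounded-Γ₁ (bounded-g s) (bounded-Δ (bounded-g s)))))
          (bounded-* (- 1#) (bounded-Γ₁ (bounded-Δ (bounded-g s)) (bounded-g s)))))
      pointwise : ∀ y → 2# * n ⁻¹ * (g′ y * g′ y) + - (2# * K) * Γ (g s) y ≤ 2# * Γ₂ (g s) y
      pointwise y = ≤-respˡ (trans (solve 5 (λ w i d K G → w :* (i :* d :^ 2 :+ (:- K) :* G) := w :* i :* (((:- con ℤ.1ℤ) :* d) :* ((:- con ℤ.1ℤ) :* d)) :+ (:- (w :* K)) :* G)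
          refl 2# (n ⁻¹) (Δ (g s) y) K (Γ (g s) y)) (+-congʳ (*-congˡ (sym (*-cong (g′≈ s y) (g′≈ s y))))))
        (*-monoˡ-≤ 0≤2 (cd (g s) y))

    2/n-nonneg : 0# ≤ 2# * n ⁻¹
    2/n-nonneg = *-nonneg 0≤2 (⁻¹-nonneg 0<n)

    -- For E = e^{2Ks}, the curve E Φ - (2/n) ∫ E Ψ has derivative E (Φ' + 2K Φ - (2/n) Ψ),
    -- nonnegative by `curvature`.
    gradient-integral : ∀ x → Γ (Q t f) x ≤ at (expᶜ K) t x * Q t (Γ f) x - 2# * n ⁻¹ * at (integrate (expᶜ K ⊛ Ψ)) t x
    gradient-integral x = ≤-respˡ start (≤-respʳ end (curve-mono F x 0≤t nonneg))
      where
      E = expᶜ K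
      c = - (2# * n ⁻¹)
      F = E ⊛ Φ ⊕ scale c (integrate (E ⊛ Ψ))
      at-F : ∀ s → at F s x ≈ at E s x * at Φ s x + c * at (integrate (E ⊛ Ψ)) s x
      at-F s = trans (at-⊕ (E ⊛ Φ) (scale c (integrate (E ⊛ Ψ))) s x)
        (+-cong (at-⊛ E Φ s x) (at-scale (integrate (E ⊛ Ψ)) c s x))
      start : at F 0# x ≈ Γ (Q t f) x
      start = trans (at-F 0#) (trans (+-cong (*-cong (at-0 E x refl) (Φ-0 x)) (*-congˡ (at-integrate-0 (E ⊛ Ψ) x refl)))
        (trans (+-cong (*-identityˡ _) (zeroʳ _)) (+-identityʳ _)))
      end : at F t x ≈ at E t x * Q t (Γ f) x - 2# * n ⁻¹ * at (integrate (E ⊛ Ψ)) t x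
      end = trans (at-F t) (+-cong (*-congˡ (Φ-t x)) (sym (R.-‿distribˡ-* _ _)))
      nonneg : ∀ s → 0# ≤ s → s ≤ t → 0# ≤ at (∂ F) s x
      nonneg s 0≤s _ = ≤-respʳ (sym (begin-equality
          at (∂ F) s x
            ≈⟨ at-⊕ (∂ (E ⊛ Φ)) (scale c (E ⊛ Ψ)) s x ⟩
          at (∂ (E ⊛ Φ)) s x + at (scale c (E ⊛ Ψ)) s x
            ≈⟨ +-cong (trans (at-∂⊛ E Φ s x) (+-congʳ (*-congʳ (at-∂-expCurve (2# * K) s x))))
                 (trans (at-scale (E ⊛ Ψ) c s x) (*-congˡ (at-⊛ E Ψ s x))) ⟩
          2# * K * at E s x * at Φ s x + at E s x * at (∂ Φ) s x + c * (at E s x * at Ψ s x)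
            ≈⟨ solve 7 (λ w K i e φ φ′ ψ → w :* K :* e :* φ :+ e :* φ′ :+ (:- (w :* i)) :* (e :* ψ) := e :* (φ′ :- (w :* i :* ψ :- w :* K :* φ)))
                 refl 2# K (n ⁻¹) (at E s x) (at Φ s x) (at (∂ Φ) s x) (at Ψ s x) ⟩
          at E s x * (at (∂ Φ) s x - (2# * n ⁻¹ * at Ψ s x - 2# * K * at Φ s x)) ∎))
        (*-nonneg (expᶜ-nonneg K s x) (0≤y-x (curvature x 0≤s)))
        where open ≤-Reasoning

    -- The curve is α Φ - Υ - (c/n) β with c = (Q t (Δ f) x)². As α' = 2e^{2Ks} and β' = 2α, its
    -- derivative is α times the defect of `curvature`, plus (2/n) α (Ψ - c), plus 2Φ (e^{2Ks} - 1 -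
    -- K α). The last term is zero by the choice of α.
    variance-upper : ∀ x → Q t (f ⊙ f) x - Q t f x ^ 2 ≤
                           at (αᶜ K) t x * Q t (Γ f) x - at (βᶜ K) t x * n ⁻¹ * Q t (Δ f) x ^ 2
    variance-upper x = ≤-from (0≤y-x (≤-respˡ start (≤-respʳ end (curve-mono F x 0≤t nonneg))))
        (solve 4 (λ a b q y → a :- b :- q :- (:- y) := a :- b :- (q :- y)) refl _ _ _ _)
      where
      c = Q t (Δ f) x ^ 2
      d = - (n ⁻¹ * c)
      F = αᶜ K ⊛ Φ ⊕ scale (- 1#) Υ ⊕ scale d (βᶜ K)
      at-F : ∀ s → at F s x ≈ at (αᶜ K) s x * at Φ s x + - 1# * at Υ s x + d * at (βᶜ K) s x
      at-F s = trans (at-⊕ (αᶜ K ⊛ Φ ⊕ scale (- 1#) Υ) (scale d (βᶜ K)) s x)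
        (+-cong (trans (at-⊕ (αᶜ K ⊛ Φ) (scale (- 1#) Υ) s x) (+-cong (at-⊛ (αᶜ K) Φ s x) (at-scale Υ (- 1#) s x)))
          (at-scale (βᶜ K) d s x))
      start : at F 0# x ≈ - (Q t f x ^ 2)
      start = trans (at-F 0#) (trans (+-cong (+-cong (*-congʳ (at-integrate-0 (scale 2# (expᶜ K)) x refl)) (*-congˡ (Υ-0 x)))
          (*-congˡ (at-integrate-0 (scale 2# (αᶜ K)) x refl)))
        (solve 3 (λ φ y d → con ℤ.0ℤ :* φ :+ (:- con ℤ.1ℤ) :* y :+ d :* con ℤ.0ℤ := :- y) refl _ _ d))
      end : at F t x ≈ at (αᶜ K) t x * Q t (Γ f) x - at (βᶜ K) t x * n ⁻¹ * c - Q t (f ⊙ f) x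
      end = trans (at-F t) (trans (+-congʳ (+-cong (*-congˡ (Φ-t x)) (*-congˡ (Υ-t x))))
        (solve 5 (λ a y i c b → a :+ (:- con ℤ.1ℤ) :* y :+ (:- (i :* c)) :* b := a :- b :* i :* c :- y) refl _ _ (n ⁻¹) c _))
      nonneg : ∀ s → 0# ≤ s → s ≤ t → 0# ≤ at (∂ F) s x
      nonneg s 0≤s _ = ≤-respʳ (sym (begin-equality
          at (∂ F) s x
            ≈⟨ trans (at-⊕ (∂ (αᶜ K ⊛ Φ) ⊕ scale (- 1#) (∂ Υ)) (scale d (scale 2# (αᶜ K))) s x)
                 (+-cong (trans (at-⊕ (∂ (αᶜ K ⊛ Φ)) (scale (- 1#) (∂ Υ)) s x)
                   (+-cong (trans (at-∂⊛ (αᶜ K) Φ s x) (+-congʳ (*-congʳ (at-scale (expᶜ K) 2# s x))))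
                     (trans (at-scale (∂ Υ) (- 1#) s x) (*-congˡ (at-∂Υ s x)))))
                   (trans (at-scale (scale 2# (αᶜ K)) d s x) (*-congˡ (at-scale (αᶜ K) 2# s x)))) ⟩
          2# * e * φ + a * φ′ + - 1# * (2# * φ) + d * (2# * a)
            ≈⟨ solve 9 (λ w K i e φ φ′ ψ a c → w :* e :* φ :+ a :* φ′ :+ (:- con ℤ.1ℤ) :* (w :* φ) :+ (:- (i :* c)) :* (w :* a)
                 := a :* (φ′ :- (w :* i :* ψ :- w :* K :* φ)) :+ w :* i :* (a :* (ψ :- c)) :+ w :* φ :* (e :- con ℤ.1ℤ :- K :* a))
                 refl 2# K (n ⁻¹) e φ φ′ ψ a c ⟩
          a * (φ′ - (2# * n ⁻¹ * ψ - 2# * K * φ)) + 2# * n ⁻¹ * (a * (ψ - c)) + 2# * φ * (e - 1# - K * a)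
            ≈⟨ trans (+-congˡ (trans (*-congˡ (trans (+-congˡ (-‿cong (K*αᶜ K s x 0≤s))) (-‿inverseʳ _))) (zeroʳ _))) (+-identityʳ _) ⟩
          a * (φ′ - (2# * n ⁻¹ * ψ - 2# * K * φ)) + 2# * n ⁻¹ * (a * (ψ - c)) ∎))
        (+-nonneg (*-nonneg (αᶜ-nonneg K x 0≤s) (0≤y-x (curvature x 0≤s)))
          (*-nonneg 2/n-nonneg (*-nonneg (αᶜ-nonneg K x 0≤s) (0≤y-x (jensen-Ψ bf t 0≤s x)))))
        where
        open ≤-Reasoning
        e  = at (expᶜ K) s x
        a  = at (αᶜ K) s x
        φ  = at Φ s x
        φ′ = at (∂ Φ) s x
        ψ  = at Ψ s x

    variance-lower : ∀ x → at (αᶜ (- K)) t x * Γ (Q t f) x + at (βᶜ (- K)) t x * n ⁻¹ * Q t (Δ f) x ^ 2 ≤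
                           Q t (f ⊙ f) x - Q t f x ^ 2
    variance-lower x = ≤-from (0≤y-x (≤-respˡ start (≤-respʳ end (curve-mono F x 0≤t nonneg))))
        (solve 4 (λ q y u v → q :- (y :+ u :+ v) := q :- y :- (u :+ v)) refl _ _ _ _)
      where
      c = Q t (Δ f) x ^ 2
      d = n ⁻¹ * c
      A = reflect t (αᶜ (- K))
      B = reflect t (βᶜ (- K))
      F = Υ ⊕ A ⊛ Φ ⊕ scale d B
      at-F : ∀ s → at F s x ≈ at Υ s x + at (αᶜ (- K)) (t - s) x * at Φ s x + d * at (βᶜ (- K)) (t - s) x
      at-F s = trans (at-⊕ (Υ ⊕ A ⊛ Φ) (scale d B) s x)
        (+-cong (trans (at-⊕ Υ (A ⊛ Φ) s x) (+-congˡ (trans (at-⊛ A Φ s x) (*-congʳ (at-reflect (αᶜ (- K)) t s x)))))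
          (trans (at-scale B d s x) (*-congˡ (at-reflect (βᶜ (- K)) t s x))))
      start : at F 0# x ≈ Q t f x ^ 2 + at (αᶜ (- K)) t x * Γ (Q t f) x + at (βᶜ (- K)) t x * n ⁻¹ * c
      start = trans (at-F 0#) (+-cong (+-cong (Υ-0 x) (*-cong (at-cong (αᶜ (- K)) x t-0) (Φ-0 x)))
        (trans (*-congˡ (at-cong (βᶜ (- K)) x t-0)) (solve 3 (λ i c b → i :* c :* b := b :* i :* c) refl (n ⁻¹) c _)))
      end : at F t x ≈ Q t (f ⊙ f) x
      end = trans (at-F t) (trans (+-cong (+-cong (Υ-t x) (*-congʳ (at-integrate-0 (scale 2# (expᶜ (- K))) x (-‿inverseʳ t))))
          (*-congˡ (at-integrate-0 (scale 2# (αᶜ (- K))) x (-‿inverseʳ t))))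
        (solve 3 (λ q φ d → q :+ con ℤ.0ℤ :* φ :+ d :* con ℤ.0ℤ := q) refl _ _ d))
      nonneg : ∀ s → 0# ≤ s → s ≤ t → 0# ≤ at (∂ F) s x
      nonneg s 0≤s s≤t = ≤-respʳ (sym (begin-equality
          at (∂ F) s x
            ≈⟨ trans (at-⊕ (∂ Υ ⊕ ∂ (A ⊛ Φ)) (scale d (∂ B)) s x)
                 (+-cong (trans (at-⊕ (∂ Υ) (∂ (A ⊛ Φ)) s x)
                   (+-cong (at-∂Υ s x) (trans (at-∂⊛ A Φ s x) (+-cong
                     (*-congʳ (trans (at-∂-reflect (αᶜ (- K)) t s x) (-‿cong (at-scale (expᶜ (- K)) 2# (t - s) x))))
                     (*-congʳ (at-reflect (αᶜ (- K)) t s x))))))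
                   (trans (at-scale (∂ B) d s x) (*-congˡ (trans (at-∂-reflect (βᶜ (- K)) t s x) (-‿cong (at-scale (αᶜ (- K)) 2# (t - s) x)))))) ⟩
          2# * φ + (- (2# * e) * φ + a * φ′) + d * - (2# * a)
            ≈⟨ solve 9 (λ w K i e φ φ′ ψ a c → w :* φ :+ ((:- (w :* e)) :* φ :+ a :* φ′) :+ i :* c :* (:- (w :* a))
                 := a :* (φ′ :- (w :* i :* ψ :- w :* K :* φ)) :+ w :* i :* (a :* (ψ :- c)) :+ w :* φ :* ((:- K) :* a :- (e :- con ℤ.1ℤ)))
                 refl 2# K (n ⁻¹) e φ φ′ ψ a c ⟩
          a * (φ′ - (2# * n ⁻¹ * ψ - 2# * K * φ)) + 2# * n ⁻¹ * (a * (ψ - c)) + 2# * φ * (- K * a - (e - 1#))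
            ≈⟨ trans (+-congˡ (trans (*-congˡ (trans (+-congʳ (K*αᶜ (- K) (t - s) x 0≤t-s)) (-‿inverseʳ _))) (zeroʳ _))) (+-identityʳ _) ⟩
          a * (φ′ - (2# * n ⁻¹ * ψ - 2# * K * φ)) + 2# * n ⁻¹ * (a * (ψ - c)) ∎))
        (+-nonneg (*-nonneg (αᶜ-nonneg (- K) x 0≤t-s) (0≤y-x (curvature x 0≤s)))
          (*-nonneg 2/n-nonneg (*-nonneg (αᶜ-nonneg (- K) x 0≤t-s) (0≤y-x (jensen-Ψ bf t 0≤s x)))))
        where
        open ≤-Reasoning
        0≤t-s = 0≤y-x s≤t
        e  = at (expᶜ (- K)) (t - s) x
        a  = at (αᶜ (- K)) (t - s) x
        φ  = at Φ s x
        φ′ = at (∂ Φ) s x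
        ψ  = at Ψ s x

  -- α is the integral of 2e^{2Ks}, and Ψ is bounded below by the constant (Q t (Δ f) x)². Resting
  -- on Jensen alone, this passes from (1) to (2) for each t, f and x separately.
  integral-lower : ∀ K {f} (bf : Bounded f) {t} → 0# ≤ t → ∀ x →
                   at (αᶜ K) t x * Q t (Δ f) x ^ 2 ≤ 2# * at (integrate (expᶜ K ⊛ Backward.Ψ bf t)) t x
  integral-lower K {f} bf {t} 0≤t x = ≤-from (≤-respˡ start (curve-mono F x 0≤t nonneg))
      (trans (at-F t) (+-congˡ (trans (sym (R.-‿distribˡ-* _ _)) (-‿cong (*-comm _ _)))))
    where
    open Backward bf t using (Ψ)
    c = Q t (Δ f) x ^ 2
    E = expᶜ K
    F = scale 2# (integrate (E ⊛ Ψ)) ⊕ scale (- c) (αᶜ K)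
    at-F : ∀ s → at F s x ≈ 2# * at (integrate (E ⊛ Ψ)) s x + - c * at (αᶜ K) s x
    at-F s = trans (at-⊕ (scale 2# (integrate (E ⊛ Ψ))) (scale (- c) (αᶜ K)) s x)
      (+-cong (at-scale (integrate (E ⊛ Ψ)) 2# s x) (at-scale (αᶜ K) (- c) s x))
    start : at F 0# x ≈ 0#
    start = trans (at-F 0#) (trans (+-cong (*-congˡ (at-integrate-0 (E ⊛ Ψ) x refl)) (*-congˡ (at-integrate-0 (scale 2# E) x refl)))
      (trans (+-cong (zeroʳ _) (zeroʳ _)) (+-identityʳ 0#)))
    nonneg : ∀ s → 0# ≤ s → s ≤ t → 0# ≤ at (∂ F) s x
    nonneg s 0≤s _ = ≤-respʳ (sym (trans (at-⊕ (scale 2# (E ⊛ Ψ)) (scale (- c) (scale 2# E)) s x)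
        (trans (+-cong (trans (at-scale (E ⊛ Ψ) 2# s x) (*-congˡ (at-⊛ E Ψ s x)))
                       (trans (at-scale (scale 2# E) (- c) s x) (*-congˡ (at-scale E 2# s x))))
          (solve 4 (λ w e ψ c → w :* (e :* ψ) :+ (:- c) :* (w :* e) := w :* (e :* (ψ :- c))) refl 2# _ _ c))))
      (*-nonneg 0≤2 (*-nonneg (expᶜ-nonneg K s x) (0≤y-x (jensen-Ψ bf t 0≤s x))))

-- From the semigroup inequalities back to the curvature condition.

module Converse (em : ExcludedMiddle 0ℓ) (ℝ : CompleteOrderedField) (G : WeightedGraph ℝ) where
  open CompleteOrderedField ℝ
  open WeightedGraph G
  open GradientForms ℝ G
  open OrderedField em ℝ
  open PowerSeries em ℝ
  open Curves em ℝ
  open HeatCurves em ℝ G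
  open Curvature em ℝ G

  CDAt : Carrier → Carrier → Function → V → Set
  CDAt n K f x = n ⁻¹ * Δ f x ^ 2 + K * Γ f x ≤ Γ₂ f x

  private
    Γ₁-local : ∀ {f f′ g g′} xs → (∀ y → y ∈ expand xs → f y ≈ f′ y) → (∀ y → y ∈ expand xs → g y ≈ g′ y) →
               ∀ y → y ∈ xs → Γ₁ f g y ≈ Γ₁ f′ g′ y
    Γ₁-local xs e h y y∈ = *-congˡ (+-cong (+-cong (Δ-expand xs (λ z z∈ → *-cong (e z z∈) (h z z∈)) y y∈)
      (-‿cong (*-cong (e y (∈-++⁺ˡ y∈)) (Δ-expand xs h y y∈)))) (-‿cong (*-cong (h y (∈-++⁺ˡ y∈)) (Δ-expand xs e y y∈))))

  -- Agreement on the 2-ball gives agreement of Δ and Γ on the 1-ball, and Γ₂ at x applies one more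
  -- Δ or Γ to these.
  CDAt-local : ∀ {n K f g} x → (∀ y → y ∈ ball 2 x → f y ≈ g y) → CDAt n K f x → CDAt n K g x
  CDAt-local {n} {K} {f} {g} x e p = ≤-respˡ (+-cong (*-congˡ (^-cong 2 (eΔ x (∈-++⁺ˡ x∈)))) (*-congˡ (eΓ x (∈-++⁺ˡ x∈))))
    (≤-respʳ (*-congˡ (+-cong (+-cong (Δ-expand (ball 0 x) eΓ x x∈)
      (-‿cong (Γ₁-local (ball 0 x) e₁ eΔ x x∈))) (-‿cong (Γ₁-local (ball 0 x) eΔ e₁ x x∈)))) p)
    where
    x∈ : x ∈ ball 0 x
    x∈ = here ≡.refl
    e₁ : ∀ y → y ∈ ball 1 x → f y ≈ g y
    e₁ y y∈ = e y (∈-++⁺ˡ y∈)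
    eΔ : ∀ y → y ∈ ball 1 x → Δ f y ≈ Δ g y
    eΔ = Δ-expand (ball 1 x) e
    eΓ : ∀ y → y ∈ ball 1 x → Γ f y ≈ Γ g y
    eΓ = Γ₁-local (ball 1 x) e e

  -- Δ ignores constants, and in Γ₁ (f + a) g the additional terms a Δ g cancel.
  CDAt-translate : ∀ {n K f} a x → CDAt n K (λ y → f y + a) x → CDAt n K f x
  CDAt-translate {n} {K} {f} a x = λ p → ≤-respˡ (+-cong (*-congˡ (^-cong 2 (eΔ x))) (*-congˡ (eΓ x)))
    (≤-respʳ (*-congˡ (+-cong (+-cong (Δ-cong eΓ x) (-‿cong (trans (Γ₁-cong (λ _ → refl) eΔ x) (Γ₁-translateˡ (Δ f) x))))
      (-‿cong (trans (Γ₁-cong eΔ (λ _ → refl) x) (trans (Γ₁-sym (Δ f) h x) (trans (Γ₁-translateˡ (Δ f) x) (Γ₁-sym f (Δ f) x))))))) p)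
    where
    h : Function
    h y = f y + a
    eΔ : Δ h ≗ Δ f
    eΔ y = *-congˡ (∑-cong (neighbours y) λ z _ → *-congˡ (solve 3 (λ p q a → p :+ a :- (q :+ a) := p :- q) refl (f z) (f y) a))
    Γ₁-translateˡ : ∀ g → Γ₁ h g ≗ Γ₁ f g
    Γ₁-translateˡ g y = *-congˡ (trans (+-cong (+-cong
        (trans (Δ-cong (λ z → distribʳ (g z) (f z) a) y) (trans (Δ-+ (f ⊙ g) _ y) (+-congˡ (Δ-* a g y)))) refl) (-‿cong (*-congˡ (eΔ y))))
      (solve 6 (λ u a dg f g df → u :+ a :* dg :- (f :+ a) :* dg :- g :* df := u :- f :* dg :- g :* df) refl _ a _ (f y) (g y) _))
    eΓ : Γ h ≗ Γ f
    eΓ y = trans (Γ₁-translateˡ h y) (trans (Γ₁-sym f h y) (Γ₁-translateˡ f y))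

  -- Γ₂ at x only sees f on the ball of radius 2, up to an additive constant.
  CD-from-positive-bounded : ∀ {n K} → (∀ f → (∀ x → 0# < f x) → Bounded f → ∀ x → CDAt n K f x) → CD n K
  CD-from-positive-bounded {n} {K} p f x = CDAt-translate a x (CDAt-local x agree (p f̃ f̃-pos f̃-bounded x))
    where
    L = ball 2 x
    M = ∑ L λ y → ∣ f y ∣
    -- M bounds |f| at every vertex of the ball, so f + a ≥ 1 there.
    a = 1# + M
    f̃ : Function
    f̃ y = if does (em {y ∈ L}) then f y + a else 1#
    agree : ∀ y → y ∈ L → f̃ y ≈ f y + a
    agree y y∈ with em {y ∈ L}
    ... | yes _  = refl
    ... | no y∉  = ⊥-elim (y∉ y∈)
    ∑∣f∣-nonneg : ∀ xs → 0# ≤ ∑ xs λ y → ∣ f y ∣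
    ∑∣f∣-nonneg []       = ≤-refl
    ∑∣f∣-nonneg (y ∷ ys) = +-nonneg (0≤∣x∣ (f y)) (∑∣f∣-nonneg ys)
    0≤M : 0# ≤ M
    0≤M = ∑∣f∣-nonneg L
    ∣f∣≤M : ∀ {y} xs → y ∈ xs → ∣ f y ∣ ≤ ∑ xs λ y → ∣ f y ∣
    ∣f∣≤M (y ∷ ys) (here ≡.refl) = ≤+nonneg (∑∣f∣-nonneg ys)
    ∣f∣≤M (y ∷ ys) (there y∈) = ≤-trans (∣f∣≤M ys y∈) (≤-respʳ (+-comm _ _) (≤+nonneg (0≤∣x∣ (f y))))
    f̃-pos : ∀ y → 0# < f̃ y
    f̃-pos y with em {y ∈ L}
    ... | no _   = 0<1
    ... | yes y∈ = <-≤-trans 0<1 (≤-from (0≤y-x (≤-trans (-x≤∣x∣ (f y)) (∣f∣≤M L y∈)))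
                     (solve 2 (λ f M → M :- (:- f) := f :+ (con ℤ.1ℤ :+ M) :- con ℤ.1ℤ) refl (f y) M))
    f̃-bounded : Bounded f̃
    f̃-bounded = M + a , bnd
      where
      0≤a : 0# ≤ a
      0≤a = +-nonneg 0≤1 0≤M
      bnd : ∀ y → ∣ f̃ y ∣ ≤ M + a
      bnd y with em {y ∈ L}
      ... | yes y∈ = ∣+∣≤ (∣f∣≤M L y∈) (∣nonneg∣ 0≤a ≤-refl)
      ... | no _   = ∣nonneg∣ 0≤1 (≤-from (+-nonneg 0≤M 0≤M) (solve 1 (λ M → M :+ M := M :+ (con ℤ.1ℤ :+ M) :- con ℤ.1ℤ) refl M))

  module _ {n K : Carrier} {f : Function} (bf : Bounded f) (x : V) where
    private
      i = n ⁻¹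
      O = orbit f bf
      C = orbit (Δ f) (bounded-Δ bf)
      OΓ = orbit (Γ f) (bounded-Γ bf)
      O² = orbit (f ⊙ f) (bounded-⊙ bf bf)

      -- The defect in CD(n, -K) for f at x. It turns up, times 2 or 4, as the first coefficient of
      -- each inequality that is not already zero by algebra.
      gap : Carrier
      gap = Γ₂ f x - (i * Δ f x ^ 2 + - K * Γ f x)

      conclude : ∀ {c} m → c ≈ m * gap → 0# < m → 0# ≤ c → CDAt n (- K) f x
      conclude m e 0<m 0≤c = ≤-from (*-cancel-pos 0<m (≤-respʳ e 0≤c)) refl

      at-C² : ∀ t → at (C ⊛ C) t x ≈ Q t (Δ f) x ^ 2
      at-C² t = trans (at-⊛ C C t x) (solve 1 (λ a → a :* a := a :^ 2) refl _)

      two : ∀ {n} → Polynomial n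
      two = con ℤ.1ℤ :+ con ℤ.1ℤ

      Γ̂₀ : coef (Γ̂ O O) x 0 ≈ Γ f x
      Γ̂₀ = solve 3 (λ h u v → h :* (u :+ (:- con ℤ.1ℤ) :* v :+ (:- con ℤ.1ℤ) :* v) := h :* (u :- v :- v)) refl half _ _

      -- The time derivative of Γ (Q t f) at t = 0, where Q t f has derivative Δ f.
      Γ̂₁ : coef (Γ̂ O O) x 1 ≈ 2# * Γ₁ f (Δ f) x
      Γ̂₁ = trans (*-congˡ (+-congʳ (+-congʳ (trans (Δ-+ (Δ f ⊙ f) (f ⊙ Δ f) x)
             (+-cong (trans (Δ-cong (λ y → *-comm _ _) x) (Δ-⊙ f (Δ f) x)) (Δ-⊙ f (Δ f) x))))))
        (trans (solve 4 (λ h w u v → h :* (w :+ u :+ v :+ (w :+ u :+ v) :+ (:- con ℤ.1ℤ) :* (v :+ u) :+ (:- con ℤ.1ℤ) :* (v :+ u)) := h :* w :+ h :* w)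
            refl half (2# * Γ₁ f (Δ f) x) (f x * Δ (Δ f) x) (Δ f x * Δ f x))
          (half-* _))

      Δ²f² : Δ (Δ (f ⊙ f)) x ≈ 2# * Δ (Γ f) x + 2# * Δ (f ⊙ Δ f) x
      Δ²f² = trans (Δ-cong (λ y → trans (Δ-⊙ f f y) (solve 3 (λ w g u → w :* g :+ u :+ u := w :* g :+ (con ℤ.1ℤ :+ con ℤ.1ℤ) :* u) refl 2# _ _)) x)
        (trans (Δ-+ _ _ x) (+-cong (Δ-* 2# (Γ f) x) (Δ-* 2# (f ⊙ Δ f) x)))

    -- At t = 0 both sides equal Γ f. The derivative of their difference is 2K Γ f + Δ (Γ f) - 2 Γ₁
    -- f (Δ f) - (2/n)(Δ f)², which is twice `gap`.
    gradient⇒CD : (∀ t → 0# ≤ t → Γ (Q t f) x ≤ at (expᶜ K) t x * Q t (Γ f) x - at (αᶜ K) t x * n ⁻¹ * Q t (Δ f) x ^ 2) →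
                  CDAt n (- K) f x
    gradient⇒CD p = conclude 2# c₁ 0<2 (first-coefficient-nonneg (tame F x) 1 nonneg λ where zero _ → c₀ ; (suc _) (s≤s ()))
      where
      F = expᶜ K ⊛ OΓ ⊕ scale (- i) (αᶜ K ⊛ (C ⊛ C)) ⊕ scale (- 1#) (Γ̂ O O)
      nonneg : ∀ t → 0# ≤ t → 0# ≤ at F t x
      nonneg t 0≤t = ≤-respʳ (sym (trans (at-⊕ (expᶜ K ⊛ OΓ ⊕ scale (- i) (αᶜ K ⊛ (C ⊛ C))) (scale (- 1#) (Γ̂ O O)) t x)
          (trans (+-cong (trans (at-⊕ (expᶜ K ⊛ OΓ) (scale (- i) (αᶜ K ⊛ (C ⊛ C))) t x)
              (+-cong (at-⊛ (expᶜ K) OΓ t x) (trans (at-scale (αᶜ K ⊛ (C ⊛ C)) (- i) t x) (*-congˡ (trans (at-⊛ (αᶜ K) (C ⊛ C) t x) (*-congˡ (at-C² t)))))))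
              (trans (at-scale (Γ̂ O O) (- 1#) t x) (*-congˡ (at-Γ̂ O O t x))))
            (solve 5 (λ e i a c g → e :+ (:- i) :* (a :* c) :+ (:- con ℤ.1ℤ) :* g := e :- a :* i :* c :- g) refl _ i _ _ _))))
        (0≤y-x (p t 0≤t))
      c₀ : coef F x 0 ≈ 0#
      c₀ = trans (+-congˡ (*-congˡ Γ̂₀)) (solve 3 (λ G i c → con ℤ.1ℤ :* G :+ (:- i) :* (con ℤ.0ℤ :* c) :+ (:- con ℤ.1ℤ) :* G := con ℤ.0ℤ)
             refl (Γ f x) i (coef (C ⊛ C) x 0))
      c₁ : coef F x 1 ≈ 2# * gap
      c₁ = trans (+-cong (+-congʳ (+-congˡ (*-congˡ (ΔΓ f x)))) (*-congˡ Γ̂₁))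
        (solve 8 (λ w K G G₂ g i d c₁ → w :* K :* con ℤ.1ℤ :* G :+ con ℤ.1ℤ :* (w :* G₂ :+ w :* g)
                    :+ (:- i) :* (w :* con ℤ.1ℤ :* (d :* d) :+ con ℤ.0ℤ :* c₁) :+ (:- con ℤ.1ℤ) :* (w :* g)
                  := w :* (G₂ :- (i :* d :^ 2 :+ (:- K) :* G)))
          refl 2# K (Γ f x) (Γ₂ f x) (Γ₁ f (Δ f) x) i (Δ f x) (coef (C ⊛ C) x 1))

    -- To first order both sides are 2t Γ f. In second order 4Δ (Γ f) comes from the product α Q(Γ
    -- f), and Q (f²) - (Q f)² contributes 2Δ (Γ f) + 4 Γ₁ f (Δ f) on the other side. What remains
    -- is four times `gap`.
    variance-upper⇒CD : (∀ t → 0# ≤ t → Q t (f ⊙ f) x - Q t f x ^ 2 ≤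
                           at (αᶜ K) t x * Q t (Γ f) x - at (βᶜ K) t x * n ⁻¹ * Q t (Δ f) x ^ 2) →
                        CDAt n (- K) f x
    variance-upper⇒CD p = conclude (2# * 2#) c₂ (*-pos 0<2 0<2) (first-coefficient-nonneg (tame F x) 2 nonneg λ where
        zero _ → c₀ ; (suc zero) _ → c₁ ; (suc (suc _)) (s≤s (s≤s ())))
      where
      F = αᶜ K ⊛ OΓ ⊕ scale (- i) (βᶜ K ⊛ (C ⊛ C)) ⊕ scale (- 1#) O² ⊕ O ⊛ O
      nonneg : ∀ t → 0# ≤ t → 0# ≤ at F t x
      nonneg t 0≤t = ≤-respʳ (sym (trans (at-⊕ (αᶜ K ⊛ OΓ ⊕ scale (- i) (βᶜ K ⊛ (C ⊛ C)) ⊕ scale (- 1#) O²) (O ⊛ O) t x)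
          (trans (+-cong (trans (at-⊕ (αᶜ K ⊛ OΓ ⊕ scale (- i) (βᶜ K ⊛ (C ⊛ C))) (scale (- 1#) O²) t x)
              (+-cong (trans (at-⊕ (αᶜ K ⊛ OΓ) (scale (- i) (βᶜ K ⊛ (C ⊛ C))) t x)
                (+-cong (at-⊛ (αᶜ K) OΓ t x) (trans (at-scale (βᶜ K ⊛ (C ⊛ C)) (- i) t x) (*-congˡ (trans (at-⊛ (βᶜ K) (C ⊛ C) t x) (*-congˡ (at-C² t)))))))
                (at-scale O² (- 1#) t x))) (at-⊛ O O t x))
            (solve 6 (λ e i b c q u → e :+ (:- i) :* (b :* c) :+ (:- con ℤ.1ℤ) :* q :+ u :* u := e :- b :* i :* c :- (q :- u :^ 2)) refl _ i _ _ _ _))))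
        (0≤y-x (p t 0≤t))
      c₀ : coef F x 0 ≈ 0#
      c₀ = solve 4 (λ G i c f → con ℤ.0ℤ :* G :+ (:- i) :* (con ℤ.0ℤ :* c) :+ (:- con ℤ.1ℤ) :* (f :* f) :+ f :* f := con ℤ.0ℤ)
             refl (Γ f x) i (coef (C ⊛ C) x 0) (f x)
      c₁ : coef F x 1 ≈ 0#
      c₁ = trans (+-congʳ (+-congˡ (*-congˡ (Δ-⊙ f f x))))
        (solve 8 (λ w G G′ i c c′ f d → w :* con ℤ.1ℤ :* G :+ con ℤ.0ℤ :* G′ :+ (:- i) :* (w :* con ℤ.0ℤ :* c :+ con ℤ.0ℤ :* c′)
                    :+ (:- con ℤ.1ℤ) :* (w :* G :+ f :* d :+ f :* d) :+ (d :* f :+ f :* d) := con ℤ.0ℤ)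
          refl 2# (Γ f x) (Δ (Γ f) x) i (coef (C ⊛ C) x 0) (coef (C ⊛ C) x 1) (f x) (Δ f x))
      c₂ : coef F x 2 ≈ 2# * 2# * gap
      c₂ = trans (+-cong (+-cong (+-congʳ (+-cong (+-congˡ (*-congˡ (ΔΓ f x))) (+-congʳ (*-congˡ (ΔΓ f x)))))
             (*-congˡ (trans Δ²f² (+-cong (*-congˡ (ΔΓ f x)) (*-congˡ (Δ-⊙ f (Δ f) x)))))) refl)
        (solve 11 (λ K G G₂ g G″ i c₁ c₂ f d d′ →
            two :* (two :* K :* con ℤ.1ℤ) :* G :+ two :* con ℤ.1ℤ :* (two :* G₂ :+ two :* g)
              :+ (two :* con ℤ.1ℤ :* (two :* G₂ :+ two :* g) :+ con ℤ.0ℤ :* G″)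
            :+ (:- i) :* (two :* (two :* con ℤ.1ℤ) :* (d :* d) :+ two :* con ℤ.0ℤ :* c₁ :+ (two :* con ℤ.0ℤ :* c₁ :+ con ℤ.0ℤ :* c₂))
            :+ (:- con ℤ.1ℤ) :* (two :* (two :* G₂ :+ two :* g) :+ two :* (two :* g :+ f :* d′ :+ d :* d))
            :+ (d′ :* f :+ d :* d :+ (d :* d :+ f :* d′))
            := two :* two :* (G₂ :- (i :* d :^ 2 :+ (:- K) :* G)))
          refl K (Γ f x) (Γ₂ f x) (Γ₁ f (Δ f) x) (Δ (Δ (Γ f)) x) i (coef (C ⊛ C) x 1) (coef (C ⊛ C) x 2) (f x) (Δ f x) (Δ (Δ f) x))

    -- As before, but now Γ is taken after the semigroup: the product with α contributes 8 Γ₁ f (Δ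
    -- f), against 2Δ (Γ f) + 4 Γ₁ f (Δ f) from the variance. The sign of K is reversed twice, so
    -- the outcome is again four times `gap`.
    variance-lower⇒CD : (∀ t → 0# ≤ t → at (αᶜ (- K)) t x * Γ (Q t f) x + at (βᶜ (- K)) t x * n ⁻¹ * Q t (Δ f) x ^ 2 ≤
                           Q t (f ⊙ f) x - Q t f x ^ 2) →
                        CDAt n (- K) f x
    variance-lower⇒CD p = conclude (2# * 2#) c₂ (*-pos 0<2 0<2) (first-coefficient-nonneg (tame F x) 2 nonneg λ where
        zero _ → c₀ ; (suc zero) _ → c₁ ; (suc (suc _)) (s≤s (s≤s ())))
      where
      A = αᶜ (- K) ⊛ Γ̂ O O
      B = βᶜ (- K) ⊛ (C ⊛ C)
      F = O² ⊕ scale (- 1#) (O ⊛ O) ⊕ scale (- 1#) A ⊕ scale (- i) B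
      nonneg : ∀ t → 0# ≤ t → 0# ≤ at F t x
      nonneg t 0≤t = ≤-respʳ (sym (trans (at-⊕ (O² ⊕ scale (- 1#) (O ⊛ O) ⊕ scale (- 1#) A) (scale (- i) B) t x)
          (trans (+-cong (trans (at-⊕ (O² ⊕ scale (- 1#) (O ⊛ O)) (scale (- 1#) A) t x)
              (+-cong (trans (at-⊕ O² (scale (- 1#) (O ⊛ O)) t x) (+-congˡ (trans (at-scale (O ⊛ O) (- 1#) t x) (*-congˡ (at-⊛ O O t x)))))
                (trans (at-scale A (- 1#) t x) (*-congˡ (trans (at-⊛ (αᶜ (- K)) (Γ̂ O O) t x) (*-congˡ (at-Γ̂ O O t x)))))))
              (trans (at-scale B (- i) t x) (*-congˡ (trans (at-⊛ (βᶜ (- K)) (C ⊛ C) t x) (*-congˡ (at-C² t))))))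
            (solve 6 (λ q u a i b c → q :+ (:- con ℤ.1ℤ) :* (u :* u) :+ (:- con ℤ.1ℤ) :* a :+ (:- i) :* (b :* c) := q :- u :^ 2 :- (a :+ b :* i :* c)) refl _ _ _ i _ _))))
        (0≤y-x (p t 0≤t))
      γ₀ = coef (Γ̂ O O) x 0
      γ₂ = coef (Γ̂ O O) x 2
      c₀ : coef F x 0 ≈ 0#
      c₀ = solve 4 (λ G i c f → f :* f :+ (:- con ℤ.1ℤ) :* (f :* f) :+ (:- con ℤ.1ℤ) :* (con ℤ.0ℤ :* G) :+ (:- i) :* (con ℤ.0ℤ :* c) := con ℤ.0ℤ)
             refl γ₀ i (coef (C ⊛ C) x 0) (f x)
      c₁ : coef F x 1 ≈ 0#
      c₁ = trans (+-congʳ (+-cong (+-congʳ (Δ-⊙ f f x)) (*-congˡ (+-congʳ (*-congˡ Γ̂₀)))))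
        (solve 8 (λ w G G′ i c c′ f d → w :* G :+ f :* d :+ f :* d :+ (:- con ℤ.1ℤ) :* (d :* f :+ f :* d)
                    :+ (:- con ℤ.1ℤ) :* (w :* con ℤ.1ℤ :* G :+ con ℤ.0ℤ :* G′) :+ (:- i) :* (w :* con ℤ.0ℤ :* c :+ con ℤ.0ℤ :* c′) := con ℤ.0ℤ)
          refl 2# (Γ f x) (coef (Γ̂ O O) x 1) i (coef (C ⊛ C) x 0) (coef (C ⊛ C) x 1) (f x) (Δ f x))
      c₂ : coef F x 2 ≈ 2# * 2# * gap
      c₂ = trans (+-congʳ (+-cong (+-congʳ (trans Δ²f² (+-cong (*-congˡ (ΔΓ f x)) (*-congˡ (Δ-⊙ f (Δ f) x)))))
             (*-congˡ (+-cong (+-cong (*-congˡ Γ̂₀) (*-congˡ Γ̂₁)) (+-congʳ (*-congˡ Γ̂₁))))))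
        (solve 11 (λ K G G₂ g γ i c₁ c₂ f d d′ →
            two :* (two :* G₂ :+ two :* g) :+ two :* (two :* g :+ f :* d′ :+ d :* d)
            :+ (:- con ℤ.1ℤ) :* (d′ :* f :+ d :* d :+ (d :* d :+ f :* d′))
            :+ (:- con ℤ.1ℤ) :* (two :* (two :* (:- K) :* con ℤ.1ℤ) :* G :+ two :* con ℤ.1ℤ :* (two :* g) :+ (two :* con ℤ.1ℤ :* (two :* g) :+ con ℤ.0ℤ :* γ))
            :+ (:- i) :* (two :* (two :* con ℤ.1ℤ) :* (d :* d) :+ two :* con ℤ.0ℤ :* c₁ :+ (two :* con ℤ.0ℤ :* c₁ :+ con ℤ.0ℤ :* c₂))
            := two :* two :* (G₂ :- (i :* d :^ 2 :+ (:- K) :* G)))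
          refl K (Γ f x) (Γ₂ f x) (Γ₁ f (Δ f) x) γ₂ i (coef (C ⊛ C) x 1) (coef (C ⊛ C) x 2) (f x) (Δ f x) (Δ (Δ f) x))

-- Identification of the heat semigroup with Q.

module Kernel (em : ExcludedMiddle 0ℓ) (ℝ : CompleteOrderedField) (G : WeightedGraph ℝ)
              (E : HeatKernel.Exhaustion em ℝ G)
              (B : ∀ k → HeatKernel.Eigenbasis em ℝ G (HeatKernel.Exhaustion.U E k)) where
  open CompleteOrderedField ℝ
  open Analysis em ℝ
  open WeightedGraph G
  open GradientForms ℝ G
  open HeatKernel em ℝ G
  open Exhaustion E
  open HeatSemigroup em ℝ G E B
  open OrderedField em ℝ
  open Series em ℝ
  open Fubini em ℝ
  open PowerSeries em ℝ
  open Curves em ℝ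
  open HeatCurves em ℝ G

  private
    _≟_ : (x y : V) → Dec (x ≡ y)
    x ≟ y = em

  toFiniteSubset : List V → FiniteSubset V
  toFiniteSubset xs = record { elements = deduplicate _≟_ xs ; unique = deduplicate-! _≟_ xs }

  ∈-toFiniteSubset : ∀ {x xs} → x ∈ xs → x ∈ᶠ toFiniteSubset xs
  ∈-toFiniteSubset = ∈-deduplicate⁺ _≟_

  extend-∈ : ∀ {S f x} → x ∈ᶠ S → extendByZero S f x ≈ f x
  extend-∈ {S} {f} {x} x∈ with em {x ∈ᶠ S}
  ... | yes _  = refl
  ... | no x∉  = ⊥-elim (x∉ x∈)

  extend-cong : ∀ S {f g} → (∀ x → x ∈ᶠ S → f x ≈ g x) → extendByZero S f ≗ extendByZero S g
  extend-cong S e x with em {x ∈ᶠ S}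
  ... | yes x∈ = e x x∈
  ... | no _   = refl

  extend-+ : ∀ S f g x → extendByZero S (λ y → f y + g y) x ≈ extendByZero S f x + extendByZero S g x
  extend-+ S f g x with em {x ∈ᶠ S}
  ... | yes _ = refl
  ... | no _  = sym (+-identityʳ 0#)

  extend-* : ∀ S a f x → extendByZero S (λ y → a * f y) x ≈ a * extendByZero S f x
  extend-* S a f x with em {x ∈ᶠ S}
  ... | yes _ = refl
  ... | no _  = sym (zeroʳ a)

  extend-bound : ∀ S {f b} → (∀ x → ∣ f x ∣ ≤ b) → ∀ x → ∣ extendByZero S f x ∣ ≤ b
  extend-bound S p x with em {x ∈ᶠ S}
  ... | yes _ = p x
  ... | no _  = ∣0∣≤ (0≤-bound (p x))

  module _ (U : FiniteSubset V) where
    Δᴰ^ : ℕ → Function → Function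
    Δᴰ^ zero    f = f
    Δᴰ^ (suc k) f = Δᴰ^ k (Δᴰ U f)

    Δᴰ^-bound : ∀ k {f b} → (∀ x → ∣ f x ∣ ≤ b) → ∀ x → ∣ Δᴰ^ k f x ∣ ≤ b * ι (degree ℕ.+ degree) ^ k
    Δᴰ^-bound zero    p x = ≤-respʳ (sym (*-identityʳ _)) (p x)
    Δᴰ^-bound (suc k) p x = ≤-respʳ (*-assoc _ _ _) (Δᴰ^-bound k (Δ-bound (extend-bound (interior U) p)) x)

    -- As long as the ball lies in the interior, none of the k applications seen from x meets a
    -- vertex where the extension by zero changes the function.
    Δᴰ^≈Δ^ : ∀ k {f} x → ball (suc k) x ⊆ elements (interior U) → Δᴰ^ k f x ≈ Δ^ k f x
    Δᴰ^≈Δ^ zero    x inside = refl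
    Δᴰ^≈Δ^ (suc k) {f} x inside = trans (Δᴰ^≈Δ^ k x (inside ∘ ∈-++⁺ˡ))
      (Δ^-local k x (Δ-expand (ball k x) λ y y∈ → extend-∈ {interior U} {f} (inside (∈-++⁺ˡ y∈))))

    module _ (basis : Eigenbasis U) where
      open Eigenbasis basis

      private
        combination : (Fin dimension → Carrier) → Function
        combination c x = sum λ i → c i * φ i x

      Δᴰ-cong : ∀ {f g} → (∀ x → x ∈ᶠ interior U → f x ≈ g x) → Δᴰ U f ≗ Δᴰ U g
      Δᴰ-cong e = Δ-cong (extend-cong (interior U) e)

      Δᴰ-sum : ∀ n (c : Fin n → Carrier) (ψ : Fin n → Function) x →
               Δᴰ U (λ y → sum λ i → c i * ψ i y) x ≈ sum λ i → c i * Δᴰ U (ψ i) x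
      Δᴰ-sum zero c ψ x = trans (Δᴰ-cong (λ y _ → sym (zeroˡ 0#)) x)
        (trans (Δ-cong (extend-* (interior U) 0# (λ _ → 0#)) x) (trans (Δ-* 0# _ x) (zeroˡ _)))
      Δᴰ-sum (suc n) c ψ x = trans (Δ-cong (extend-+ (interior U) _ _) x) (trans (Δ-+ _ _ x)
        (+-cong (trans (Δ-cong (extend-* (interior U) _ _) x) (Δ-* _ _ x)) (Δᴰ-sum n (c ∘ Fin.suc) (ψ ∘ Fin.suc) x)))

      Δᴰ-eigen : ∀ i x → x ∈ᶠ interior U → Δᴰ U (φ i) x ≈ - eigenvalue i * φ i x
      Δᴰ-eigen i x x∈ = trans (sym (R.-‿involutive _)) (trans (-‿cong (isEigen i x x∈)) (R.-‿distribˡ-* _ _))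

      -- Each application replaces the coefficient c i by c i times -λ i, so the induction has to
      -- run over all coefficient families.
      Δᴰ^-spectral : ∀ k c {f} → (∀ x → x ∈ᶠ interior U → f x ≈ combination c x) →
                     ∀ x → x ∈ᶠ interior U → Δᴰ^ k f x ≈ sum λ i → c i * φ i x * (- eigenvalue i) ^ k
      Δᴰ^-spectral zero    c e x x∈ = trans (e x x∈) (Sum.sum-cong-≋ {dimension} λ i → sym (*-identityʳ _))
      Δᴰ^-spectral (suc k) c {f} e x x∈ = trans (Δᴰ^-spectral k (λ i → c i * - eigenvalue i) e′ x x∈)
          (Sum.sum-cong-≋ {dimension} λ i → solve 4 (λ c l p q → c :* l :* p :* q := c :* p :* (l :* q)) refl (c i) (- eigenvalue i) (φ i x) _)
        where
        e′ : ∀ x → x ∈ᶠ interior U → Δᴰ U f x ≈ sum λ i → c i * - eigenvalue i * φ i x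
        e′ x x∈ = trans (Δᴰ-cong e x) (trans (Δᴰ-sum dimension c φ x)
          (Sum.sum-cong-≋ {dimension} λ i → trans (*-congˡ (Δᴰ-eigen i x x∈)) (sym (*-assoc _ _ _))))

      inner-sum : ∀ j n (c : Fin n → Carrier) (ψ : Fin n → Function) →
                  inner U (φ j) (λ y → sum λ i → c i * ψ i y) ≈ sum λ i → c i * inner U (φ j) (ψ i)
      inner-sum j zero c ψ = trans (∑-cong (elements (interior U)) λ y _ → trans (zeroʳ _) (sym (zeroˡ 0#)))
        (trans (∑-* (elements (interior U)) 0# (λ _ → 0#)) (zeroˡ _))
      inner-sum j (suc n) c ψ = trans (∑-cong (elements (interior U)) λ y _ →
          trans (distribˡ _ _ _) (+-congʳ (solve 4 (λ m p c q → m :* p :* (c :* q) := c :* (m :* p :* q)) refl _ _ _ _)))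
        (trans (∑-+ (elements (interior U)) _ _) (+-cong (∑-* (elements (interior U)) _ _) (inner-sum j n (c ∘ Fin.suc) (ψ ∘ Fin.suc))))

      coefficient : ∀ c {f} → (∀ x → x ∈ᶠ interior U → f x ≈ combination c x) → ∀ j → inner U (φ j) f ≈ c j
      coefficient c e j = trans (∑-cong (elements (interior U)) λ y y∈ → *-congˡ (e y y∈))
        (trans (inner-sum j dimension c φ) (trans (Sum.sum-cong-≋ {dimension} λ i → *-congˡ (orthonormal j i)) (select dimension c j)))
        where
        sum-0 : ∀ n (f : Fin n → Carrier) → (∀ i → f i ≈ 0#) → sum f ≈ 0#
        sum-0 zero    f z = refl
        sum-0 (suc n) f z = trans (+-cong (z Fin.zero) (sum-0 n _ (z ∘ Fin.suc))) (+-identityʳ 0#)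
        select : ∀ n (c : Fin n → Carrier) j → sum (λ i → c i * (if does (j Fin.≟ i) then 1# else 0#)) ≈ c j
        select (suc n) c Fin.zero    = trans (+-cong (*-identityʳ _) (sum-0 n _ λ i → zeroʳ _)) (+-identityʳ _)
        select (suc n) c (Fin.suc j) = trans (+-cong (zeroʳ _) (select n (c ∘ Fin.suc) j)) (+-identityˡ _)

  indicator : V → Function
  indicator y z = if does (em {z ≡ y}) then 1# else 0#

  indicator-self : ∀ y → indicator y y ≈ 1#
  indicator-self y with em {y ≡ y}
  ... | yes _  = refl
  ... | no y≢y = ⊥-elim (y≢y ≡.refl)

  indicator-other : ∀ {y z} → ¬ z ≡ y → indicator y z ≈ 0#
  indicator-other {y} {z} z≢y with em {z ≡ y}
  ... | yes z≡y = ⊥-elim (z≢y z≡y)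
  ... | no _    = refl

  ∣indicator∣ : ∀ y z → ∣ indicator y z ∣ ≤ 1#
  ∣indicator∣ y z with em {z ≡ y}
  ... | yes _ = ∣nonneg∣ 0≤1 ≤-refl
  ... | no _  = ∣0∣≤ 0≤1

  bounded-indicator : ∀ y → Bounded (indicator y)
  bounded-indicator y = 1# , ∣indicator∣ y

  ∑-∉ : ∀ {xs y} (f : Function) → All (λ z → ¬ y ≡ z) xs → ∑ xs (λ z → f z * indicator y z) ≈ 0#
  ∑-∉ f All.[]       = refl
  ∑-∉ f (p All.∷ ps) = trans (+-cong (trans (*-congˡ (indicator-other (p ∘ ≡.sym))) (zeroʳ _)) (∑-∉ f ps)) (+-identityʳ 0#)

  ∑-indicator : ∀ {xs y} (f : Function) → Unique xs → y ∈ xs → ∑ xs (λ z → f z * indicator y z) ≈ f y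
  ∑-indicator f (p ∷ ps) (here ≡.refl) = trans (+-cong (trans (*-congˡ (indicator-self _)) (*-identityʳ _)) (∑-∉ f p)) (+-identityʳ _)
  ∑-indicator f (p ∷ ps) (there y∈)    = trans (+-cong (trans (*-congˡ (indicator-other (All.lookup p y∈))) (zeroʳ _)) (∑-indicator f ps y∈)) (+-identityˡ _)

  -- Both sides are the exponential of t times the Dirichlet Laplacian applied to the indicator of
  -- y, evaluated at x: on the left through the eigenbasis, on the right as a power series. The
  -- factor μ y comes from expanding the indicator in the μ-weighted inner product.
  spectral-kernel : ∀ W (basis : Eigenbasis W) t x y → x ∈ᶠ interior W → y ∈ᶠ interior W →
                    μ y * dirichletKernel W basis t x y ≈ value (λ k → Δᴰ^ W k (indicator y) x) t
  spectral-kernel W basis t x y x∈ y∈ = sym (begin-equality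
    value (λ k → Δᴰ^ W k (indicator y) x) t
      ≈⟨ value-congˡ t (1# , degree ℕ.+ degree , dom λ k → Δᴰ^-bound W k (∣indicator∣ y) x) (λ k → Δᴰ^-spectral W basis k c c-spec x x∈) ⟩
    value (λ k → sum λ i → c i * φ i x * (- eigenvalue i) ^ k) t
      ≈⟨ value-sum dimension (λ i → c i * φ i x) (λ i → - eigenvalue i) ⟩
    sum (λ i → c i * φ i x * value ((- eigenvalue i) ^_) t)
      ≈⟨ Sum.sum-cong-≋ {dimension} term ⟩
    sum (λ i → μ y * (exp (- (eigenvalue i * t)) * extendByZero (interior W) (φ i) x * extendByZero (interior W) (φ i) y))
      ≈⟨ sym (Sum.*-distribˡ-sum {dimension} (μ y) _) ⟩
    μ y * dirichletKernel W basis t x y ∎)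
    where
    open ≤-Reasoning
    open Eigenbasis basis
    c      = proj₁ (spanning (indicator y))
    c-spec = proj₂ (spanning (indicator y))
    -- By orthonormality c i is the inner product of φ i with the indicator of y, and only the term
    -- at y survives.
    c≈ : ∀ i → c i ≈ μ y * φ i y
    c≈ i = trans (sym (coefficient W basis c c-spec i)) (∑-indicator (λ z → μ z * φ i z) (unique (interior W)) y∈)
    exp-tame : ∀ a → Tame (a ^_)
    exp-tame a = tame (expCurve {V} a) x
    value-sum : ∀ n (a : Fin n → Carrier) (b : Fin n → Carrier) →
                value (λ k → sum λ i → a i * b i ^ k) t ≈ sum λ i → a i * value (b i ^_) t
    tame-sum : ∀ n (a : Fin n → Carrier) (b : Fin n → Carrier) → Tame (λ k → sum λ i → a i * b i ^ k)
    tame-sum zero    a b = tame-0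
    tame-sum (suc n) a b = tame-+ (tame-* (a Fin.zero) (exp-tame (b Fin.zero))) (tame-sum n _ _)
    value-sum zero    a b = value-∑ {V} [] t (λ _ → tame-0)
    value-sum (suc n) a b = trans (value-+ t (tame-* (a Fin.zero) (exp-tame (b Fin.zero))) (tame-sum n _ _))
      (+-cong (value-* (a Fin.zero) t (exp-tame (b Fin.zero))) (value-sum n _ _))
    term : ∀ i → c i * φ i x * value ((- eigenvalue i) ^_) t ≈
                 μ y * (exp (- (eigenvalue i * t)) * extendByZero (interior W) (φ i) x * extendByZero (interior W) (φ i) y)
    term i = trans (*-cong (*-congʳ (c≈ i)) (sym (at-expCurve {V} (- eigenvalue i) t x (R.-‿distribˡ-* _ _))))
      (trans (solve 4 (λ m p q e → m :* p :* q :* e := m :* (e :* q :* p)) refl _ _ _ _)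
        (*-congˡ (sym (*-cong (*-congˡ (extend-∈ {interior W} {φ i} x∈)) (extend-∈ {interior W} {φ i} y∈)))))

  -- A difference that vanishes below N is unchanged by the cut-off factor, which is worth 2⁻ᴺ. The
  -- constant is computed from C, M and t alone, so one A serves a whole family of sequences with a
  -- common bound.
  value-close : ∀ {C M c d} t → Dom C M c → Dom C M d → ∃ λ A → 0# ≤ A × (∀ N → (∀ k → k ℕ.< N → c k ≈ d k) →
                ∣ value c t - value d t ∣ ≤ A * half ^ N)
  value-close {C} {M} {c} {d} t p q = A , *-nonneg (+-nonneg (dom-nonneg p) (dom-nonneg p)) (expBound-nonneg (M ℕ.* T ℕ.+ M ℕ.* T)) , close
    where
    T = magnitude t
    A = (C + C) * expBound (M ℕ.* T ℕ.+ M ℕ.* T)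
    difference : Seq
    difference k = c k + - 1# * d k
    domDiff : Dom (C + C) M difference
    domDiff = dom λ k → ≤-respʳ (sym (distribʳ _ _ _)) (∣∣≤-cong (+-congˡ (sym (R.-1*x≈-x _))) (∣-∣≤ (bound p k) (bound q k)))
    value-difference : value difference t ≈ value c t - value d t
    value-difference = trans (value-+ t (_ , _ , p) (tame-* (- 1#) (_ , _ , q)))
      (+-congˡ (trans (value-* (- 1#) t (_ , _ , q)) (R.-1*x≈-x _)))
    tail : ∀ N (e : Seq) → (∀ k → k ℕ.< N → e k ≈ 0#) → ∀ k → (1# - χ N k) * e k ≈ e k
    tail zero    e z k       = trans (*-congʳ (trans (+-congˡ R.-0#≈0#) (+-identityʳ 1#))) (*-identityˡ _)
    tail (suc N) e z zero    = trans (*-congʳ (-‿inverseʳ 1#)) (trans (zeroˡ _) (sym (z 0 (s≤s z≤n))))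
    tail (suc N) e z (suc k) = tail N (e ∘ suc) (λ j j<N → z (suc j) (s≤s j<N)) k
    close : ∀ N → (∀ k → k ℕ.< N → c k ≈ d k) → ∣ value c t - value d t ∣ ≤ A * half ^ N
    close N e = ≤-respʳ (solve 3 (λ h C x → h :* C :* x := C :* x :* h) refl _ _ _) (∣∣≤-cong value-difference (egf-bound domTail))
      where
      z : ∀ k → k ℕ.< N → difference k * t ^ k ≈ 0#
      z k k<N = trans (*-congʳ (trans (+-cong (e k k<N) (R.-1*x≈-x _)) (-‿inverseʳ _))) (zeroˡ _)
      domTail : Dom (half ^ N * (C + C)) (M ℕ.* T ℕ.+ M ℕ.* T) (λ k → difference k * t ^ k)
      domTail = dom λ k → ∣∣≤-cong (tail N (λ k → difference k * t ^ k) z k)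
        (≤-respʳ (trans (solve 4 (λ h w C m → h :* w :* (C :* m) := h :* C :* (w :* m)) refl _ _ _ _) (*-congˡ (doubled k)))
          (∣*∣≤ (∣nonneg∣ (1-χ-nonneg N k) (1-χ≤half^ N k)) (bound (dom-power T (∣∣≤magnitude t) domDiff) k)))
        where
        doubled : ∀ k → 2# ^ k * ι (M ℕ.* T) ^ k ≈ ι (M ℕ.* T ℕ.+ M ℕ.* T) ^ k
        doubled k = trans (sym (Exp.^-distrib-* 2# _ k)) (^-cong k
          (trans (solve 1 (λ m → (con ℤ.1ℤ :+ con ℤ.1ℤ) :* m := m :+ m) refl _) (sym (ι-+ (M ℕ.* T) (M ℕ.* T)))))

  eventually-interior : ∀ x → ∃ λ N → ∀ k → N ℕ.≤ k → x ∈ᶠ interior (U k)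
  eventually-interior x = suc k₀ , λ k p → go (ℕ.≤⇒≤′ p)
    where
    k₀ = proj₁ (covers x)
    go : ∀ {k} → suc k₀ ℕ.≤′ k → x ∈ᶠ interior (U k)
    go (ℕ.≤′-reflexive ≡.refl) = nested k₀ x (proj₂ (covers x))
    go (ℕ.≤′-step {n = k} p)   = nested k x (proj₁ (∈-filter⁻ _ (go p)))

  eventually-⊆-interior : ∀ xs → ∃ λ N → ∀ k → N ℕ.≤ k → xs ⊆ elements (interior (U k))
  eventually-⊆-interior []       = 0 , λ k _ ()
  eventually-⊆-interior (x ∷ xs) = N₁ ℕ.⊔ N₂ , λ k p → λ where
      (here ≡.refl) → proj₂ (eventually-interior x) k (ℕ.≤-trans (ℕ.m≤m⊔n N₁ N₂) p)
      (there y∈)    → proj₂ (eventually-⊆-interior xs) k (ℕ.≤-trans (ℕ.m≤n⊔m N₁ N₂) p) y∈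
    where
    N₁ = proj₁ (eventually-interior x)
    N₂ = proj₁ (eventually-⊆-interior xs)

  -- Choose N from ε, then k so large that the interior of U k contains y and the N-ball around x.
  -- The Dirichlet and the full coefficients at x agree below N, so the two exponentials differ by
  -- O(2⁻ᴺ).
  heatKernel≈ : ∀ t x y → μ y * heatKernel t x y ≈ Q t (indicator y) x
  heatKernel≈ t x y = trans (*-congˡ (lim-≈ converges)) (trans (sym (*-assoc _ _ _))
      (trans (*-congʳ (⁻¹-inverseʳ _ (pos⇒≉0 (μ-positive y)))) (*-identityˡ _)))
    where
    u = μ y ⁻¹
    module _ (k : ℕ) where
      close = value-close t (dom {1#} {degree ℕ.+ degree} λ j → Δᴰ^-bound (U k) j (∣indicator∣ y) x)
                            (dom {1#} {degree ℕ.+ degree} λ j → Δ^-bound j (∣indicator∣ y) x)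
    -- The constant of `value-close` is the same for every k, so the one for k = 0 may fix N before
    -- k is chosen.
    A = proj₁ (close 0)
    converges : ConvergesTo (λ k → dirichletKernel (U k) (B k) t x y) (u * Q t (indicator y) x)
    converges ε 0<ε = K , near
      where
      small = small-power (u * A) ε 0<ε
      N = proj₁ small
      inside = eventually-⊆-interior (y ∷ ball N x)
      K = proj₁ inside
      near : ∀ k → K ℕ.≤ k → ∣ dirichletKernel (U k) (B k) t x y - u * Q t (indicator y) x ∣ < ε
      near k p = ≤-<-trans (∣∣≤-cong e (≤-respʳ (sym (*-assoc _ _ _)) (∣*∣ˡ≤ (μ⁻¹-nonneg y) (proj₂ (proj₂ (close k)) N agree)))) (proj₂ small)
        where
        x∈ : x ∈ᶠ interior (U k)
        x∈ = proj₂ inside k p (there (ball-mono {0} {N} x (ℕ.≤⇒≤′ z≤n) (here ≡.refl)))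
        agree : ∀ j → j ℕ.< N → Δᴰ^ (U k) j (indicator y) x ≈ Δ^ j (indicator y) x
        agree j j<N = Δᴰ^≈Δ^ (U k) j x λ z∈ → proj₂ inside k p (there (ball-mono {suc j} {N} x (ℕ.≤⇒≤′ j<N) z∈))
        e : u * (value (λ j → Δᴰ^ (U k) j (indicator y) x) t - Q t (indicator y) x)
            ≈ dirichletKernel (U k) (B k) t x y - u * Q t (indicator y) x
        e = trans (R.x[y-z]≈xy-xz _ _ _) (+-congʳ (trans (*-congˡ (sym (spectral-kernel (U k) (B k) t x y x∈ (proj₂ inside k p (here ≡.refl)))))
          (trans (sym (*-assoc _ _ _)) (trans (*-congʳ (⁻¹-inverseˡ _ (pos⇒≉0 (μ-positive y)))) (*-identityˡ _)))))

  HasSum-unique : ∀ {g : V → Carrier} {l l′} → HasSum g l → HasSum g l′ → l ≈ l′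
  HasSum-unique {g} {l} {l′} p q = ≈-limit 2# near
    where
    near : ∀ n → ∣ l - l′ ∣ ≤ 2# * half ^ n
    near n = ≤-respʳ (solve 1 (λ e → e :+ e := (con ℤ.1ℤ :+ con ℤ.1ℤ) :* e) refl (half ^ n))
      (∣∣-triangle (∣-∣-sym (<⇒≤ (proj₂ pS T λ z∈ → ∈-toFiniteSubset (∈-++⁺ˡ z∈))))
                   (<⇒≤ (proj₂ qS T λ z∈ → ∈-toFiniteSubset (∈-++⁺ʳ (elements (proj₁ pS)) z∈))))
      where
      pS = p (half ^ n) (^-pos n 0<half)
      qS = q (half ^ n) (^-pos n 0<half)
      T = toFiniteSubset (elements (proj₁ pS) ++ elements (proj₁ qS))

  private
    -- The restriction of f to the list, written as a finite combination of indicators so that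
    -- linearity of Q applies to it.
    truncate : List V → Function → Function
    truncate xs f z = ∑ xs λ y → f y * indicator y z

    indicator-sym : ∀ y z → indicator y z ≈ indicator z y
    indicator-sym y z with em {z ≡ y}
    ... | yes ≡.refl = sym (indicator-self z)
    ... | no z≢y     = sym (indicator-other (z≢y ∘ ≡.sym))

    truncate-∈ : ∀ {xs z} f → Unique xs → z ∈ xs → truncate xs f z ≈ f z
    truncate-∈ {xs} {z} f u z∈ = trans (∑-cong xs λ y _ → *-congˡ (indicator-sym y z)) (∑-indicator f u z∈)

    -- As the entries are distinct, at most one summand is nonzero at z. The bound of f is therefore
    -- inherited whatever the size of the list, which keeps later constants uniform.
    truncate-bound : ∀ xs {f b} → Unique xs → (∀ z → ∣ f z ∣ ≤ b) → ∀ z → ∣ truncate xs f z ∣ ≤ b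
    truncate-bound []       u p z = ∣0∣≤ (0≤-bound (p z))
    truncate-bound (x ∷ xs) {f} {b} (x∉ ∷ u) p z with em {z ≡ x}
    ... | yes ≡.refl = ∣∣≤-cong (sym (trans (+-cong (*-identityʳ _)
                         (trans (∑-cong xs λ y _ → *-congˡ (indicator-sym y z)) (∑-∉ f x∉))) (+-identityʳ _))) (p z)
    ... | no z≢x     = ∣∣≤-cong (sym (trans (+-congʳ (zeroʳ _)) (+-identityˡ _))) (truncate-bound xs u p z)

    Q-truncate : ∀ t xs f x → Q t (truncate xs f) x ≈ ∑ xs λ y → f y * Q t (indicator y) x
    Q-truncate t []       f x = Q-1 t 0# x
    Q-truncate t (y ∷ xs) f x = trans (Q-+ t (bounded-* (f y) (bounded-indicator y)) (bounded-truncate xs) x)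
        (+-cong (Q-* t (f y) (bounded-indicator y) x) (Q-truncate t xs f x))
      where
      bounded-truncate : ∀ xs → Bounded (truncate xs f)
      bounded-truncate []       = bounded-const 0#
      bounded-truncate (y ∷ xs) = bounded-+ (bounded-* (f y) (bounded-indicator y)) (bounded-truncate xs)

  -- A sum over T is Q t of the truncation of f to T. If T contains the N-ball around x, the
  -- truncation has the same coefficients as f below N, so the error is O(2⁻ᴺ) uniformly in T.
  hasSum-kernel : ∀ t {f} → Bounded f → ∀ x → HasSum (λ y → μ y * heatKernel t x y * f y) (Q t f x)
  hasSum-kernel t {f} (b , p) x ε 0<ε = toFiniteSubset (ball N x) , near
    where
    module _ (T : FiniteSubset V) where
      close = value-close t (dom {b} {degree ℕ.+ degree} λ j → Δ^-bound j (truncate-bound (elements T) (unique T) p) x)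
                            (dom {b} {degree ℕ.+ degree} λ j → Δ^-bound j p x)
    -- The constant depends on the bound of f and on t, not on T, so it may be read off at the empty
    -- set.
    small = small-power (proj₁ (close (toFiniteSubset []))) ε 0<ε
    N = proj₁ small
    near : ∀ T → elements (toFiniteSubset (ball N x)) ⊆ elements T →
           ∣ ∑ (elements T) (λ y → μ y * heatKernel t x y * f y) - Q t f x ∣ < ε
    near T ball⊆T = ≤-<-trans (∣∣≤-cong (+-congʳ e) (proj₂ (proj₂ (close T)) N agree)) (proj₂ small)
      where
      agree : ∀ j → j ℕ.< N → Δ^ j (truncate (elements T) f) x ≈ Δ^ j f x
      agree j j<N = Δ^-local j x λ y y∈ →
        truncate-∈ f (unique T) (ball⊆T (∈-toFiniteSubset (ball-mono {j} {N} x (ℕ.≤⇒≤′ (ℕ.<⇒≤ j<N)) y∈)))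
      e : Q t (truncate (elements T) f) x ≈ ∑ (elements T) (λ y → μ y * heatKernel t x y * f y)
      e = trans (Q-truncate t (elements T) f x) (∑-cong (elements T) λ y _ → trans (*-comm _ _) (*-congʳ (sym (heatKernel≈ t x y))))

  P≈Q : ∀ t {f} → Bounded f → P t f ≗ Q t f
  P≈Q t {f} bf x with em {t ≈ 0#}
  ... | yes t≈0 = sym (at-0 (orbit f bf) x t≈0)
  ... | no _    = HasSum-unique (the-satisfies (HasSum g) (_ , hasSum-kernel t bf x)) (hasSum-kernel t bf x)
    where
    g : V → Carrier
    g y = μ y * heatKernel t x y * f y

-- Translating the four statements into statements about Q.

module Equivalence (em : ExcludedMiddle 0ℓ) (ℝ : CompleteOrderedField) (G : WeightedGraph ℝ) where
  open CompleteOrderedField ℝ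
  open WeightedGraph G
  open GradientForms ℝ G
  open OrderedField em ℝ
  open Integral em ℝ
  open Curves em ℝ
  open HeatCurves em ℝ G
  open Curvature em ℝ G hiding (α⁺≈; α⁻≈; β⁺≈; β⁻≈)
  open Flow em ℝ G
  open Converse em ℝ G

  -- Under the square, P (t - s) (Δ f) is minus the time derivative of s ↦ Q (t - s) f, so the
  -- integrand of (1) is a value of an entire curve and has an explicit antiderivative.
  integrand≈ : (P : Carrier → Function → Function) → (∀ t {f} → Bounded f → P t f ≗ Q t f) →
               ∀ K {f} (bf : Bounded f) {t s r e} {v w : Function} x →
               e ≈ at (expᶜ K) s x → r ≈ t - s → v ≗ Δ f → (λ y → P r v y ^ 2) ≗ w →
               e * P s w x ≈ at (expᶜ K ⊛ Backward.Ψ bf t) s x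
  integrand≈ P P≈ K {f} bf {t} {s} {r} {v = v} {w} x e≈ r≈ v≗ ≗w = trans
      (*-cong e≈ (trans (P≈ s (bounded-cong square bounded-u²) x) (sym (trans (at-Ψ-Q s x) (Q-cong s bounded-u² square x)))))
      (sym (at-⊛ (expᶜ K) Ψ s x))
    where
    open Backward bf t using (Ψ; at-Ψ-Q)
    u : Function
    u = Q (t - s) (Δ f)
    bounded-u² : Bounded (u ⊙ u)
    bounded-u² = bounded-⊙ (bounded-Q (t - s) (bounded-Δ bf)) (bounded-Q (t - s) (bounded-Δ bf))
    bv : Bounded v
    bv = bounded-cong (λ y → sym (v≗ y)) (bounded-Δ bf)
    square : u ⊙ u ≗ w
    square y = trans (solve 1 (λ a → a :* a := a :^ 2) refl (u y)) (trans (^-cong 2 (sym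
      (trans (P≈ r bv y) (trans (Q-cong r bv v≗ y) (Q-congᵗ (bounded-Δ bf) r≈ y))))) (≗w y))

  integral≈ : ∀ K {f} (bf : Bounded f) {t} → 0# ≤ t → ∀ x {g} → (∀ s → g s ≈ at (expᶜ K ⊛ Backward.Ψ bf t) s x) →
              Analysis.∫ em ℝ 0# t g ≈ at (integrate (expᶜ K ⊛ Backward.Ψ bf t)) t x
  integral≈ K bf {t} 0≤t x g≈ = ∫-value 0≤t (tame (expᶜ K ⊛ Backward.Ψ bf t) x) λ s _ _ → g≈ s

  -- What the statements use of the heat semigroup, the exponential, the integral and the four
  -- coefficients.  They are kept abstract because conversion checking would otherwise unfold the
  -- heat kernel whenever it compares two occurrences of P (t - s).
  record Operations (K : Carrier) (P : Carrier → Function → Function) (exp : Carrier → Carrier)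
                    (I : Carrier → Function → V → Carrier) (α⁺ α⁻ β⁺ β⁻ : Carrier → Carrier) : Set where
    field
      P≈   : ∀ t {f} → Bounded f → P t f ≗ Q t f
      exp≈ : ∀ t x → exp (2# * K * t) ≈ at (expᶜ K) t x
      I≈   : ∀ {t f} (bf : Bounded f) → 0# ≤ t → ∀ x → I t f x ≈ at (integrate (expᶜ K ⊛ Backward.Ψ bf t)) t x
      α⁺≈  : ∀ {t} x → 0# ≤ t → α⁺ t ≈ at (αᶜ K) t x
      α⁻≈  : ∀ {t} x → 0# ≤ t → α⁻ t ≈ at (αᶜ (- K)) t x
      β⁺≈  : ∀ {t} x → 0# ≤ t → β⁺ t ≈ at (βᶜ K) t x
      β⁻≈  : ∀ {t} x → 0# ≤ t → β⁻ t ≈ at (βᶜ (- K)) t x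

  module Proofs {K P exp I α⁺ α⁻ β⁺ β⁻} (operations : Operations K P exp I α⁺ α⁻ β⁺ β⁻)
                {n : Carrier} (0<n : 0# < n) where
    open Operations operations

    ForAllPositiveBounded : (Carrier → Function → V → Set) → Set
    ForAllPositiveBounded S = ∀ t → 0# ≤ t → ∀ f → (∀ x → 0# < f x) → Bounded f → ∀ x → S t f x

    Gradient∫ Gradient VarianceUpper VarianceLower : Carrier → Function → V → Set
    Gradient∫ t f x = Γ (P t f) x ≤ exp (2# * K * t) * P t (Γ f) x - (2# / n) * I t f x
    Gradient t f x = Γ (P t f) x ≤ exp (2# * K * t) * P t (Γ f) x - (α⁺ t / n) * P t (Δ f) x ^ 2
    VarianceUpper t f x = P t (λ y → f y ^ 2) x - P t f x ^ 2 ≤ α⁺ t * P t (Γ f) x - (β⁺ t / n) * P t (Δ f) x ^ 2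
    VarianceLower t f x = α⁻ t * Γ (P t f) x + (β⁻ t / n) * P t (Δ f) x ^ 2 ≤ P t (λ y → f y ^ 2) x - P t f x ^ 2

    module _ {f : Function} (bf : Bounded f) {t : Carrier} (0≤t : 0# ≤ t) (x : V) where
      open Backward bf t using (Ψ)

      private
        ΓP≈ : Γ (P t f) x ≈ Γ (Q t f) x
        ΓP≈ = Γ₁-cong (P≈ t bf) (P≈ t bf) x

        PΓ≈ : P t (Γ f) x ≈ Q t (Γ f) x
        PΓ≈ = P≈ t (bounded-Γ bf) x

        PΔ²≈ : P t (Δ f) x ^ 2 ≈ Q t (Δ f) x ^ 2
        PΔ²≈ = ^-cong 2 (P≈ t (bounded-Δ bf) x)

        square : ∀ {g : Function} → g ⊙ g ≗ λ y → g y ^ 2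
        square y = solve 1 (λ a → a :* a := a :^ 2) refl _

        variance≈ : P t (λ y → f y ^ 2) x - P t f x ^ 2 ≈ Q t (f ⊙ f) x - Q t f x ^ 2
        variance≈ = +-cong (trans (P≈ t (bounded-cong (square {f}) (bounded-⊙ bf bf)) x) (sym (Q-cong t (bounded-⊙ bf bf) (square {f}) x)))
          (-‿cong (^-cong 2 (P≈ t bf x)))

      CD⇒Gradient∫ : CD n (- K) → Gradient∫ t f x
      CD⇒Gradient∫ cd = ≤-respˡ (sym ΓP≈) (≤-respʳ (sym (+-cong (*-cong (exp≈ t x) PΓ≈) (-‿cong (*-congˡ (I≈ bf 0≤t x)))))
        (Forward.gradient-integral {n} {K} 0<n cd {f} bf {t} 0≤t x))

      -- The right sides of (2) and (1) differ by (2I - α (P_t Δ f)²) / n, with I the integral in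
      -- (1); this is nonnegative by `integral-lower`.
      Gradient∫⇒Gradient : Gradient∫ t f x → Gradient t f x
      Gradient∫⇒Gradient p = ≤-trans p (≤-from (*-nonneg (⁻¹-nonneg 0<n) (0≤y-x (integral-lower K bf 0≤t x)))
        (trans (solve 6 (λ e i a c w I → i :* (w :* I :- a :* c) := e :- a :* i :* c :- (e :- w :* i :* I)) refl
                 (exp (2# * K * t) * P t (Γ f) x) (n ⁻¹) _ _ 2# _)
          (sym (+-cong (+-congˡ (-‿cong (*-cong (*-congʳ (α⁺≈ x 0≤t)) PΔ²≈))) (-‿cong (+-congˡ (-‿cong (*-congˡ (I≈ bf 0≤t x)))))))))

      Gradient⇒ : Gradient t f x →
                  Γ (Q t f) x ≤ at (expᶜ K) t x * Q t (Γ f) x - at (αᶜ K) t x * n ⁻¹ * Q t (Δ f) x ^ 2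
      Gradient⇒ p = ≤-respˡ ΓP≈ (≤-respʳ (+-cong (*-cong (exp≈ t x) PΓ≈) (-‿cong (*-cong (*-congʳ (α⁺≈ x 0≤t)) PΔ²≈))) p)

      private
        upper≈ : α⁺ t * P t (Γ f) x - (β⁺ t / n) * P t (Δ f) x ^ 2 ≈
                 at (αᶜ K) t x * Q t (Γ f) x - at (βᶜ K) t x * n ⁻¹ * Q t (Δ f) x ^ 2
        upper≈ = +-cong (*-cong (α⁺≈ x 0≤t) PΓ≈) (-‿cong (*-cong (*-congʳ (β⁺≈ x 0≤t)) PΔ²≈))

        lower≈ : α⁻ t * Γ (P t f) x + (β⁻ t / n) * P t (Δ f) x ^ 2 ≈
                 at (αᶜ (- K)) t x * Γ (Q t f) x + at (βᶜ (- K)) t x * n ⁻¹ * Q t (Δ f) x ^ 2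
        lower≈ = +-cong (*-cong (α⁻≈ x 0≤t) ΓP≈) (*-cong (*-congʳ (β⁻≈ x 0≤t)) PΔ²≈)

      CD⇒VarianceUpper : CD n (- K) → VarianceUpper t f x
      CD⇒VarianceUpper cd = ≤-respˡ (sym variance≈) (≤-respʳ (sym upper≈) (Forward.variance-upper {n} {K} 0<n cd {f} bf {t} 0≤t x))

      VarianceUpper⇒ : VarianceUpper t f x → Q t (f ⊙ f) x - Q t f x ^ 2 ≤
                       at (αᶜ K) t x * Q t (Γ f) x - at (βᶜ K) t x * n ⁻¹ * Q t (Δ f) x ^ 2
      VarianceUpper⇒ p = ≤-respˡ variance≈ (≤-respʳ upper≈ p)

      CD⇒VarianceLower : CD n (- K) → VarianceLower t f x
      CD⇒VarianceLower cd = ≤-respˡ (sym lower≈) (≤-respʳ (sym variance≈) (Forward.variance-lower {n} {K} 0<n cd {f} bf {t} 0≤t x))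

      VarianceLower⇒ : VarianceLower t f x → at (αᶜ (- K)) t x * Γ (Q t f) x + at (βᶜ (- K)) t x * n ⁻¹ * Q t (Δ f) x ^ 2 ≤
                       Q t (f ⊙ f) x - Q t f x ^ 2
      VarianceLower⇒ p = ≤-respˡ lower≈ (≤-respʳ variance≈ p)

    Gradient⇒CD : ForAllPositiveBounded Gradient → CD n (- K)
    Gradient⇒CD p = CD-from-positive-bounded λ f pos bf x →
      gradient⇒CD {K = K} bf x λ t 0≤t → Gradient⇒ bf 0≤t x (p t 0≤t f pos bf x)

    -- The converse passes through (2), so that the integral is never differentiated at t = 0.
    CD⇔Gradient∫ : CD n (- K) ⇔ ForAllPositiveBounded Gradient∫
    CD⇔Gradient∫ = mk⇔ (λ cd t 0≤t f _ bf x → CD⇒Gradient∫ bf 0≤t x cd)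
      (λ p → Gradient⇒CD λ t 0≤t f pos bf x → Gradient∫⇒Gradient bf 0≤t x (p t 0≤t f pos bf x))

    CD⇔Gradient : CD n (- K) ⇔ ForAllPositiveBounded Gradient
    CD⇔Gradient = mk⇔ (λ cd t 0≤t f _ bf x → Gradient∫⇒Gradient bf 0≤t x (CD⇒Gradient∫ bf 0≤t x cd)) Gradient⇒CD

    CD⇔VarianceUpper : CD n (- K) ⇔ ForAllPositiveBounded VarianceUpper
    CD⇔VarianceUpper = mk⇔ (λ cd t 0≤t f _ bf x → CD⇒VarianceUpper bf 0≤t x cd)
      (λ p → CD-from-positive-bounded λ f pos bf x →
        variance-upper⇒CD {K = K} bf x λ t 0≤t → VarianceUpper⇒ bf 0≤t x (p t 0≤t f pos bf x))

    CD⇔VarianceLower : CD n (- K) ⇔ ForAllPositiveBounded VarianceLower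
    CD⇔VarianceLower = mk⇔ (λ cd t 0≤t f _ bf x → CD⇒VarianceLower bf 0≤t x cd)
      (λ p → CD-from-positive-bounded λ f pos bf x →
        variance-lower⇒CD {K = K} bf x λ t 0≤t → VarianceLower⇒ bf 0≤t x (p t 0≤t f pos bf x))

-- The equivalences for the heat semigroup itself.

module _ (em : ExcludedMiddle 0ℓ) (ℝ : CompleteOrderedField) (G : WeightedGraph ℝ)
         (E : HeatKernel.Exhaustion em ℝ G)
         (B : ∀ k → HeatKernel.Eigenbasis em ℝ G (HeatKernel.Exhaustion.U E k)) where
  open CompleteOrderedField ℝ
  open Analysis em ℝ
  open WeightedGraph G
  open GradientForms ℝ G
  open HeatSemigroup em ℝ G E B
  open Coefficients em ℝ

  private
    open OrderedField em ℝ using (^-cong; solve; _:=_; _:*_; _:^_)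
    open PowerSeries em ℝ using (value)
    open Curves em ℝ
    open HeatCurves em ℝ G
    open Curvature em ℝ G
    open Flow em ℝ G
    open Kernel em ℝ G E B
    open Equivalence em ℝ G using (integrand≈; integral≈; Operations; module Proofs)

    -- The integrand is named by equations, so that t - s occurs in types only.  Terms and types
    -- elaborate differently, and comparing two forms of P (t - s) means unfolding the heat kernel.
    pointwise : ∀ K {f} (bf : Bounded f) {t s r w} x → r ≡ t - s → w ≡ (λ y → P r (Δ f) y ^ 2) →
                exp (2# * K * s) * P s w x ≈ at (expᶜ K ⊛ Backward.Ψ bf t) s x
    pointwise K {f} bf {t} {s} {r} {w} x r≡ w≡ = integrand≈ P P≈Q K {f} bf {t} {s} {r} {v = Δ f} {w} x
      (exp-expᶜ K s x refl) (reflexive r≡) (λ _ → refl) (λ y → reflexive (≡.sym (≡.cong-app w≡ y)))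

    integralOf : ∀ K {f} (bf : Bounded f) {t} → 0# ≤ t → ∀ x g →
                 g ≡ (λ s → exp (2# * K * s) * P s (λ y → P (t - s) (Δ f) y ^ 2) x) →
                 ∫ 0# t g ≈ at (integrate (expᶜ K ⊛ Backward.Ψ bf t)) t x
    integralOf K {f} bf {t} 0≤t x g g≡ = integral≈ K {f} bf {t} 0≤t x {g} λ s →
      trans (reflexive (≡.cong-app g≡ s)) (pointwise K {f} bf {t} {s} x ≡.refl ≡.refl)

  theorem3p1 :
    (n K : Carrier) → 0# < n →
    let ForAllPositiveBounded : (Carrier → Function → V → Set) → Set
        ForAllPositiveBounded S =
          ∀ t → 0# ≤ t → ∀ (f : Function) → (∀ x → 0# < f x) → Bounded f →
          ∀ x → S t f x
    in
    (CD n (- K) ⇔ ForAllPositiveBounded λ t f x →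
      Γ (P t f) x ≤
        exp (2# * K * t) * P t (Γ f) x
        - (2# / n) * ∫ 0# t (λ s →
            exp (2# * K * s) * P s (λ y → P (t - s) (Δ f) y ^ 2) x))
    ×
    (CD n (- K) ⇔ ForAllPositiveBounded λ t f x →
      Γ (P t f) x ≤
        exp (2# * K * t) * P t (Γ f) x
        - (α⁺ K t / n) * P t (Δ f) x ^ 2)
    ×
    (CD n (- K) ⇔ ForAllPositiveBounded λ t f x →
      P t (λ y → f y ^ 2) x - P t f x ^ 2 ≤
        α⁺ K t * P t (Γ f) x
        - (β⁺ K t / n) * P t (Δ f) x ^ 2)
    ×
    (CD n (- K) ⇔ ForAllPositiveBounded λ t f x →
      α⁻ K t * Γ (P t f) x + (β⁻ K t / n) * P t (Δ f) x ^ 2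
        ≤ P t (λ y → f y ^ 2) x - P t f x ^ 2)
  theorem3p1 n K 0<n = CD⇔Gradient∫ , CD⇔Gradient , CD⇔VarianceUpper , CD⇔VarianceLower
    where
    operations : Operations K P exp
                   (λ t f x → ∫ 0# t (λ s → exp (2# * K * s) * P s (λ y → P (t - s) (Δ f) y ^ 2) x))
                   (α⁺ K) (α⁻ K) (β⁺ K) (β⁻ K)
    operations = record
      { P≈   = P≈Q
      ; exp≈ = λ t x → exp-expᶜ K t x refl
      ; I≈   = λ {t} {f} bf 0≤t x → integralOf K {f} bf {t} 0≤t x _ ≡.refl
      ; α⁺≈  = α⁺≈ K
      ; α⁻≈  = α⁻≈ K
      ; β⁺≈  = β⁺≈ K
      ; β⁻≈  = β⁻≈ K
      }
    open Proofs operations 0<n
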